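{- Let $p$ be a prime with $p\equiv 5\pmod 6$, let $b,c\in\mathbf{F}_p$, and assume that $g(z)=z^3-bz-c$ is irreducible over $\mathbf{F}_p$. Let $$f_1(u,v,w)=v^2w^3+3uvw+u^3-bu-v-c,$$ and let $X_1=\{(u,v,w)\mid f_1(u,v,w)=0\}$ be the affine variety over $\mathbf{F}_p$ in affine $3$-space defined by $f_1$. Then $X_1$ is a rational surface, and $|X_1(\mathbf{F}_p)|=p^2-1$.
   Context: $\mathbf{F}_p$ is the field with $p$ elements. A rational surface is one birational to the affine plane. -}

module Defs where

open import Algebra.Bundles.Raw using (RawRing)
import Algebra.Definitions.RawSemiring as RawSemiringDefs
open import Data.Fin.Base using (Fin; zero; suc; toℕ)
open import Data.List.Base using (List; []; _∷_; foldr; map)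
open import Data.List.Relation.Unary.All using (All)
open import Data.Nat.Base as ℕ using (ℕ; zero; suc; NonZero)
open import Data.Nat.DivMod using (_mod_)
open import Data.Product.Base using (Σ; ∃)
open import Data.Sum.Base using (_⊎_; [_,_])
open import Data.Vec.Base using (Vec; []; _∷_; lookup)
open import Function.Base using (id; _∘_)
open import Level using (0ℓ)
open import Relation.Binary.PropositionalEquality using (_≡_)
open import Relation.Nullary.Negation using (¬_)

-- Rings are given by their operations and equality only: the ring laws
-- are not needed to define any of the notions below.

Ring : Set₁
Ring = RawRing 0ℓ 0ℓ

∣_∣ : Ring → Set
∣ R ∣ = RawRing.Carrier R

𝔽 : (p : ℕ) .{{_ : NonZero p}} → Ring
𝔽 p = record
  { Carrier = Fin p
  ; _≈_     = _≡_
  ; _+_     = λ x y → (toℕ x ℕ.+ toℕ y) mod p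
  ; _*_     = λ x y → (toℕ x ℕ.* toℕ y) mod p
  ; -_      = λ x → (p ℕ.∸ toℕ x) mod p
  ; 0#      = 0 mod p
  ; 1#      = 1 mod p
  }

module _ (R : Ring) where
  open RawRing R

  -- A polynomial in one variable is its list of coefficients, constant
  -- term first; lists differing by trailing zeros are identified.
  coeff : List Carrier → ℕ → Carrier
  coeff []      _       = 0#
  coeff (a ∷ _) zero    = a
  coeff (_ ∷ f) (suc i) = coeff f i

  addPoly : List Carrier → List Carrier → List Carrier
  addPoly []      g       = g
  addPoly (a ∷ f) []      = a ∷ f
  addPoly (a ∷ f) (b ∷ g) = (a + b) ∷ addPoly f g

  mulPoly : List Carrier → List Carrier → List Carrier
  mulPoly []      g = []
  mulPoly (a ∷ f) g = addPoly (map (a *_) g) (0# ∷ mulPoly f g)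

  Poly : Ring
  Poly = record
    { Carrier = List Carrier
    ; _≈_     = λ f g → ∀ i → coeff f i ≈ coeff g i
    ; _+_     = addPoly
    ; _*_     = mulPoly
    ; -_      = map (-_)
    ; 0#      = []
    ; 1#      = 1# ∷ []
    }

  -- Membership in the ideal generated by a list of elements.
  InIdeal : List Carrier → Carrier → Set
  InIdeal []       h = h ≈ 0#
  InIdeal (f ∷ fs) h = ∃ λ q → InIdeal fs (h + - (q * f))

module Affine (k : Ring) where

  -- k[x₀,…,xₙ₋₁], built as k[xₙ₋₁]⋯[x₀]: x₀ is the outermost variable.
  k[X_] : ℕ → Ring
  k[X zero  ] = k
  k[X suc n ] = Poly k[X n ]

  const : ∀ n → ∣ k ∣ → ∣ k[X n ] ∣
  const zero    a = a
  const (suc n) a = const n a ∷ []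

  var : ∀ n → Fin n → ∣ k[X n ] ∣
  var (suc n) zero    = 0# ∷ 1# ∷ []
    where open RawRing k[X n ]
  var (suc n) (suc i) = var n i ∷ []

  -- The value of a polynomial at a tuple in a k-algebra A with structure
  -- map ι, by Horner's rule.
  eval : (A : Ring) (ι : ∣ k ∣ → ∣ A ∣) → ∀ {n} → Vec ∣ A ∣ n → ∣ k[X n ] ∣ → ∣ A ∣
  eval A ι []       f = ι f
  eval A ι (x ∷ xs) f = foldr (λ q r → eval A ι xs q + x * r) 0# f
    where open RawRing A

  -- The closed subscheme of affine n-space cut out by the equations.
  record ClosedSubscheme : Set where
    constructor V
    field
      n         : ℕ
      equations : List ∣ k[X n ] ∣

    _∈I _∉I : ∣ k[X n ] ∣ → Set
    h ∈I = InIdeal k[X n ] equations h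
    h ∉I = ¬ (h ∈I)

  𝔸 : ℕ → ClosedSubscheme
  𝔸 n = V n []

  -- The k-rational points.
  Points : ClosedSubscheme → Set
  Points (V n equations) =
    Σ (Vec ∣ k ∣ n) λ x → All (λ f → eval k id x f ≈ 0#) equations
    where open RawRing k

  -- Varieties are integral: the equations generate a prime ideal.
  record IsVariety (X : ClosedSubscheme) : Set where
    open ClosedSubscheme X
    open RawRing k[X n ]
    field
      1∉I   : 1# ∉I
      prime : ∀ f g → (f * g) ∈I → f ∈I ⊎ g ∈I

    *-∉I : ∀ {f g} → f ∉I → g ∉I → (f * g) ∉I
    *-∉I {f} {g} f∉I g∉I = [ f∉I , g∉I ] ∘ prime f g

  module FunctionField {X : ClosedSubscheme} (X-var : IsVariety X) where
    open ClosedSubscheme X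
    open IsVariety X-var
    open RawRing k[X n ]

    -- A rational function on X, as a fraction of polynomials whose
    -- denominator does not vanish identically on X.
    record Fraction : Set where
      constructor frac
      field
        num   : Carrier
        den   : Carrier
        den∉I : den ∉I

    open Fraction public

    fromPoly : Carrier → Fraction
    fromPoly f = frac f 1# 1∉I

    K : Ring
    K = record
      { Carrier = Fraction
      ; _≈_     = λ r s → (num r * den s + - (num s * den r)) ∈I
      ; _+_     = λ r s → frac (num r * den s + num s * den r)
                               (den r * den s) (*-∉I (den∉I r) (den∉I s))
      ; _*_     = λ r s → frac (num r * num s)
                               (den r * den s) (*-∉I (den∉I r) (den∉I s))
      ; -_      = λ r → frac (- num r) (den r) (den∉I r)
      ; 0#      = fromPoly 0#
      ; 1#      = fromPoly 1#
      }

    IsZero : Fraction → Set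
    IsZero r = num r ∈I

    divide : (r s : Fraction) → ¬ IsZero s → Fraction
    divide r s s≉0 = frac (num r * den s) (den r * num s) (*-∉I (den∉I r) s≉0)

    evalK : ∀ {m} → Vec Fraction m → ∣ k[X m ] ∣ → Fraction
    evalK = eval K (fromPoly ∘ const n)

  -- A rational map X ⇢ Y ⊆ 𝔸ᵐ is an m-tuple of rational functions on X
  -- satisfying the equations of Y.
  record RationalMap {X} (X-var : IsVariety X) (Y : ClosedSubscheme) : Set where
    open ClosedSubscheme Y
    open FunctionField X-var
    field
      coords : Vec Fraction n
      into   : All (λ f → IsZero (evalK coords f)) equations

    -- The image is dense: a polynomial vanishing on it vanishes on Y.
    Dominant : Set
    Dominant = ∀ h → IsZero (evalK coords h) → h ∈I

    -- The rational function r ∘ φ on X, for r a rational function on Y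
    -- and φ this rational map.
    pullback : (Y-var : IsVariety Y) → Dominant →
               FunctionField.Fraction Y-var → Fraction
    pullback Y-var dom r =
      divide (evalK coords (K[Y].num r)) (evalK coords (K[Y].den r))
             (K[Y].den∉I r ∘ dom (K[Y].den r))
      where module K[Y] = FunctionField Y-var

  -- The i-th coordinate of ψ ∘ φ is the i-th coordinate function.
  IsLeftInverse : ∀ {X Y} {X-var : IsVariety X} {Y-var : IsVariety Y}
                  (ψ : RationalMap Y-var X) (φ : RationalMap X-var Y) →
                  RationalMap.Dominant φ → Set
  IsLeftInverse {X} {X-var = X-var} {Y-var} ψ φ φ-dom = ∀ i →
    pullback Y-var φ-dom (lookup (coords ψ) i) ≈ fromPoly (var n i)
    where
    open ClosedSubscheme X
    open FunctionField X-var
    open RawRing K using (_≈_)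
    open RationalMap using (coords)
    open RationalMap φ using (pullback)

  record Birational (X Y : ClosedSubscheme) : Set where
    field
      X-var   : IsVariety X
      Y-var   : IsVariety Y
      φ       : RationalMap X-var Y
      ψ       : RationalMap Y-var X
      φ-dom   : RationalMap.Dominant φ
      ψ-dom   : RationalMap.Dominant ψ
      ψ∘φ≈id  : IsLeftInverse ψ φ φ-dom
      φ∘ψ≈id  : IsLeftInverse φ ψ ψ-dom

  RationalSurface : ClosedSubscheme → Set
  RationalSurface X = Birational X (𝔸 2)

module _ (p : ℕ) .{{_ : NonZero p}} where
  open Affine (𝔽 p)

  IrreduciblePoly : ∣ k[X 1 ] ∣ → Set
  IrreduciblePoly = RawSemiringDefs.Irreducible (RawRing.rawSemiring k[X 1 ])

  module _ (b c : Fin p) where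

    g : ∣ k[X 1 ] ∣
    g = z ^ 3 + - (const 1 b * z) + - const 1 c
      where
      open RawRing k[X 1 ]
      open RawSemiringDefs rawSemiring using (_^_)
      z : Carrier
      z = var 1 zero

    f₁ : ∣ k[X 3 ] ∣
    f₁ = v ^ 2 * w ^ 3 + 3 × (u * v * w) + u ^ 3
           + - (const 3 b * u) + - v + - const 3 c
      where
      open RawRing k[X 3 ]
      open RawSemiringDefs rawSemiring using (_^_; _×_)
      u v w : Carrier
      u = var 3 zero
      v = var 3 (suc zero)
      w = var 3 (suc (suc zero))

    X₁ : ClosedSubscheme
    X₁ = V 3 (f₁ ∷ [])

-- Put D(y, t) = b − (y² + yt + t²). In the coordinates y = u + vw² and
-- t = u − 1/w the equation f₁ = 0 becomes w g(t) = D(y, t), which is linear in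
-- w; hence φ = (y, t) is birational onto the plane, with inverse
--   u = t + g(t)/D,  v = −g(y) g(t)²/D³,  w = D/g(t).
-- If a polynomial h in u, v, w vanishes under these substitutions, then h is
-- annihilated modulo f₁ by a product of powers of w and of g(t) w³, a polynomial
-- in u and w. Neither is a zero divisor modulo f₁, because f₁, as a polynomial
-- in v, is proportional to a monic one modulo each of them. So (f₁) is the
-- kernel of the substitution, which makes it prime.
--
-- The points with w = 0 are (u, g(u), 0), and φ maps the other ones
-- bijectively onto the complement of the conic D = 0, as g has no root. Since
-- p ≡ 2 mod 3, cubing is injective, so y² + yt + t² is anisotropic, and the
-- conic, having a point, has p + 1 of them. The total is p + p² − (p + 1).

module Submission where

open import Defs
open import Algebra.Bundles using (CommutativeRing)
open import Algebra.Bundles.Raw using (RawRing)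
open import Algebra.Core using (Op₁; Op₂)
import Algebra.Definitions.RawMagma as RawMagmaDefs
import Algebra.Definitions.RawSemiring as RawSemiringDefs
import Algebra.Morphism.Construct.Composition as Composition
import Algebra.Morphism.RingMonomorphism as RingMono
open import Algebra.Morphism.Structures using (module RingMorphisms)
import Algebra.Solver.Ring
open import Algebra.Structures using (IsCommutativeRing; IsAbelianGroup)
open import Axiom.UniquenessOfIdentityProofs using (module Decidable⇒UIP)
open import Data.Fin.Base using (Fin; zero; suc; toℕ; punchIn; punchOut)
import Data.Fin.Permutation as Perm
import Data.Fin.Properties as Finₚ
import Data.Integer.Base as ℤ
import Data.Integer.Properties as ℤₚ
open import Data.List.Base using (List; []; _∷_; map; foldr)
open import Data.List.Relation.Unary.All as All using (All; []; _∷_)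
import Data.Maybe.Base as Maybe
import Data.Nat.Base
open import Data.Nat.Base as ℕ using (ℕ; zero; suc; NonZero)
open import Data.Nat.Divisibility as ℕ∣ using (divides)
open import Data.Nat.DivMod as DivMod using (_mod_; _%_; _/_)
open import Data.Nat.Primality using (Prime; euclidsLemma; prime⇒nonTrivial)
import Data.Nat.Properties as ℕₚ
open import Data.Nat.Solver using (module +-*-Solver)
open import Data.Product.Base using (_,_; proj₁; proj₂; _×_; ∃; ∃₂; Σ; uncurry)
open import Data.Product.Properties using (×-≡,≡→≡; ≡-dec)
open import Data.Sum.Algebra using (⊎-cong; ⊎-comm; ⊎-assoc)
open import Data.Sum.Base as ⊎ using (_⊎_; inj₁; inj₂; [_,_]′; map₁; map₂)
open import Data.Sum.Properties using (inj₁-injective)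
open import Data.Unit.Base using (⊤; tt)
open import Data.Vec.Base using (Vec; []; _∷_; lookup)
open import Data.Vec.Functional using (removeAt; replicate)
open import Function.Base using (id; _∘_)
open import Function.Bundles using (_↔_; mk↔ₛ′; Inverse)
open import Function.Construct.Composition using (_↔-∘_)
open import Function.Construct.Identity using (↔-id)
open import Function.Construct.Symmetry using (↔-sym)
open import Level using (0ℓ)
open import Relation.Binary.Consequences using (dec⇒weaklyDec)
open import Relation.Binary.Definitions using (WeaklyDecidable)
open import Relation.Binary.PropositionalEquality as ≡ using (_≡_; _≢_)
open import Relation.Binary.Structures using (IsEquivalence)
open import Relation.Nullary.Decidable using (Dec; yes; no)
open import Relation.Nullary.Negation using (¬_; contradiction)

open RingMorphisms using (IsRingHomomorphism)

-- Origin of the coordinates: put `a = 1/w` and `e = v w²`, so that f₁ = e²a + 3uea - ea² + g(u);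
-- the substitution `t = u − a`, `y = u + e` collects this into g(t) - a D(y, t).
--
-- The obstacle is a circularity. The function field of `X₁` is defined only once (f₁) is known to
-- be prime, but the natural proof of primality computes in that field. The substitution is
-- therefore inverted first in the total ring of fractions of k[u, v, w]/(f₁), whose denominators
-- are the nonzerodivisors; this is why the regularity of `w` and of `cleared u w` modulo f₁ has to
-- be settled by hand. Once this has given primality, the same computation is run again in the
-- function field and yields the birational map. Accordingly the identities are stated over
-- arbitrary commutative rings, with inverses as additional elements subject to equations such as
-- `w a = 1`, and they serve a third time in the count of points.

IsCR : Ring → Set
IsCR R = IsCommutativeRing _≈_ _+_ _*_ -_ 0# 1#
  where open RawRing R

bundle : (R : Ring) → IsCR R → CommutativeRing 0ℓ 0ℓ
bundle R isCR = record { isCommutativeRing = isCR }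

-- Ring homomorphisms and transport of the ring laws

module _ (R S : Ring) where
  private
    module R = RawRing R
    module S = RawRing S

  ringHomomorphism : (φ : ∣ R ∣ → ∣ S ∣) →
    (∀ {x y} → x R.≈ y → φ x S.≈ φ y) →
    (∀ x y → φ (x R.+ y) S.≈ φ x S.+ φ y) →
    (∀ x y → φ (x R.* y) S.≈ φ x S.* φ y) →
    (∀ x → φ (R.- x) S.≈ S.- φ x) →
    φ R.0# S.≈ S.0# → φ R.1# S.≈ S.1# →
    IsRingHomomorphism R S φ
  ringHomomorphism φ φ-cong φ-+ φ-* φ-neg φ-0 φ-1 = record
    { isSemiringHomomorphism = record
      { isNearSemiringHomomorphism = record
        { +-isMonoidHomomorphism = record
          { isMagmaHomomorphism = record
            { isRelHomomorphism = record { cong = φ-cong }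
            ; homo = φ-+
            }
          ; ε-homo = φ-0
          }
        ; *-homo = φ-*
        }
      ; 1#-homo = φ-1
      }
    ; -‿homo = φ-neg
    }

-- The ring laws only concern the operations up to the equality, hence
-- they transfer along any relabelling of the carrier that reflects it.
transfer-isCR : (R : Ring) (S : CommutativeRing 0ℓ 0ℓ) (let module S = CommutativeRing S) →
  (φ : ∣ R ∣ → S.Carrier) → IsRingHomomorphism R S.rawRing φ →
  (∀ {x y} → φ x S.≈ φ y → RawRing._≈_ R x y) → IsCR R
transfer-isCR R S φ φ-hom φ-injective = RingMono.isCommutativeRing
  (record { isRingHomomorphism = φ-hom ; injective = φ-injective })
  (CommutativeRing.isCommutativeRing S)

-- Equality wrapped in a record, so that Agda can infer the two sides where
-- the equality itself would unfold.
module Wrap (R : Ring) where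
  open RawRing R

  record _≋_ (x y : Carrier) : Set where
    constructor wrap
    field unwrap : x ≈ y
  open _≋_ public

  wrapped : Ring
  wrapped = record R { _≈_ = _≋_ }

  module _ (isCR : IsCR R) where
    private module R = CommutativeRing (bundle R isCR)

    wrapped-isCR : IsCR wrapped
    wrapped-isCR = transfer-isCR wrapped (bundle R isCR) id
      (ringHomomorphism wrapped R id unwrap (λ _ _ → R.refl) (λ _ _ → R.refl) (λ _ → R.refl) R.refl R.refl)
      wrap

    wrappedRing : CommutativeRing 0ℓ 0ℓ
    wrappedRing = bundle wrapped wrapped-isCR

  wrap-isRingHomomorphism : ∀ {S φ} → IsRingHomomorphism S R φ → IsRingHomomorphism S wrapped φ
  wrap-isRingHomomorphism {S} {φ} φ-hom = ringHomomorphism S wrapped φ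
    (λ x≈y → wrap (⟦⟧-cong x≈y)) (λ x y → wrap (+-homo x y)) (λ x y → wrap (*-homo x y))
    (λ x → wrap (-‿homo x)) (wrap 0#-homo) (wrap 1#-homo)
    where open IsRingHomomorphism φ-hom

-- A ring solver with integer coefficients

infixl 7 _:+_ _:-_
infixl 8 _:*_
infixr 9 _:×_
infix  9 :-_
infixr 9 _:^_
infix  4 _:=_

-- Kept out of RingSolver, so that using the syntax does not copy the solver
-- for every ring.
data Expr (n : ℕ) : Set where
  atom       : Fin n → Expr n
  con       : ℕ → Expr n
  _:+_ _:*_ : Expr n → Expr n → Expr n
  :-_       : Expr n → Expr n
  _:^_      : Expr n → ℕ → Expr n

_:-_ : ∀ {n} → Expr n → Expr n → Expr n
x :- y = x :+ :- y

-- Unfolds to a sum ending in `con 0`, just as the multiples `_×_` in the definition of `f₁` end in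
-- `0#`, so that solved equations match definitionally.
_:×_ : ∀ {n} → ℕ → Expr n → Expr n
zero  :× x = con 0
suc m :× x = x :+ m :× x

_:=_ : ∀ {n} → Expr n → Expr n → Expr n × Expr n
_:=_ = _,_

module RingSolver (R : CommutativeRing 0ℓ 0ℓ) where
  open ℤ using (ℤ; +_; -[1+_]; +[1+_])
  open CommutativeRing R
  open import Algebra.Properties.Ring ring
  open import Algebra.Properties.AbelianGroup +-abelianGroup using (⁻¹-∙-comm)
  open import Algebra.Properties.Semiring.Mult.TCOptimised semiring using (1+×; ×-homo-+; ×1-homo-*) renaming (_×_ to _×ᴿ_)
  open import Algebra.Properties.CommutativeSemigroup +-commutativeSemigroup using (interchange)
  open import Algebra.Solver.Ring.AlmostCommutativeRing
  open import Relation.Binary.Reasoning.Setoid setoid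

  -- With the optimised multiples the constants `con 0` and `con 1` denote `0#` and `1#` on the
  -- nose.
  fromℤ : ℤ → Carrier
  fromℤ (+ n)    = n ×ᴿ 1#
  fromℤ -[1+ n ] = - (suc n ×ᴿ 1#)

  fromℤ-⊖ : ∀ m n → fromℤ (m ℤ.⊖ n) ≈ m ×ᴿ 1# + - (n ×ᴿ 1#)
  fromℤ-⊖ m       zero    = sym (trans (+-congˡ -0#≈0#) (+-identityʳ _))
  fromℤ-⊖ zero    (suc n) = sym (+-identityˡ _)
  fromℤ-⊖ (suc m) (suc n) = begin
    fromℤ (suc m ℤ.⊖ suc n)                    ≡⟨ ≡.cong fromℤ (ℤₚ.[1+m]⊖[1+n]≡m⊖n m n) ⟩
    fromℤ (m ℤ.⊖ n)                            ≈⟨ fromℤ-⊖ m n ⟩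
    m ×ᴿ 1# + - (n ×ᴿ 1#)                        ≈⟨ +-identityˡ _ ⟨
    0# + (m ×ᴿ 1# + - (n ×ᴿ 1#))                 ≈⟨ +-congʳ (-‿inverseʳ 1#) ⟨
    (1# + - 1#) + (m ×ᴿ 1# + - (n ×ᴿ 1#))        ≈⟨ interchange _ _ _ _ ⟩
    (1# + m ×ᴿ 1#) + (- 1# + - (n ×ᴿ 1#))        ≈⟨ +-cong (sym (1+× m 1#)) (⁻¹-∙-comm _ _) ⟩
    suc m ×ᴿ 1# + - (1# + n ×ᴿ 1#)               ≈⟨ +-congˡ (-‿cong (1+× n 1#)) ⟨
    suc m ×ᴿ 1# + - (suc n ×ᴿ 1#)                ∎

  fromℤ-neg : ∀ i → fromℤ (ℤ.- i) ≈ - fromℤ i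
  fromℤ-neg (+ zero)  = sym -0#≈0#
  fromℤ-neg +[1+ n ]  = refl
  fromℤ-neg -[1+ n ]  = sym (-‿involutive _)

  fromℤ-+ : ∀ i j → fromℤ (i ℤ.+ j) ≈ fromℤ i + fromℤ j
  fromℤ-+ (+ m)    (+ n)    = ×-homo-+ 1# m n
  fromℤ-+ (+ m)    -[1+ n ] = fromℤ-⊖ m (suc n)
  fromℤ-+ -[1+ m ] (+ n)    = trans (fromℤ-⊖ n (suc m)) (+-comm _ _)
  fromℤ-+ -[1+ m ] -[1+ n ] = begin
    - (suc (suc (m ℕ.+ n)) ×ᴿ 1#)      ≡⟨ ≡.cong (λ k → - (suc k ×ᴿ 1#)) (ℕₚ.+-suc m n) ⟨
    - ((suc m ℕ.+ suc n) ×ᴿ 1#)        ≈⟨ -‿cong (×-homo-+ 1# (suc m) (suc n)) ⟩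
    - (suc m ×ᴿ 1# + suc n ×ᴿ 1#)       ≈⟨ ⁻¹-∙-comm _ _ ⟨
    - (suc m ×ᴿ 1#) + - (suc n ×ᴿ 1#)   ∎
    where import Data.Nat.Properties as ℕₚ

  fromℤ-*-pos : ∀ m j → fromℤ (+ m ℤ.* j) ≈ fromℤ (+ m) * fromℤ j
  fromℤ-*-pos m (+ n)    = begin
    fromℤ (+ m ℤ.* + n)       ≡⟨ ≡.cong fromℤ (ℤₚ.pos-* m n) ⟨
    (m ℕ.* n) ×ᴿ 1#            ≈⟨ ×1-homo-* m n ⟩
    (m ×ᴿ 1#) * (n ×ᴿ 1#)       ∎
  fromℤ-*-pos m -[1+ n ] = begin
    fromℤ (+ m ℤ.* -[1+ n ])          ≡⟨ ≡.cong fromℤ (ℤₚ.neg-distribʳ-* (+ m) +[1+ n ]) ⟨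
    fromℤ (ℤ.- (+ m ℤ.* +[1+ n ]))    ≈⟨ fromℤ-neg (+ m ℤ.* +[1+ n ]) ⟩
    - fromℤ (+ m ℤ.* +[1+ n ])        ≈⟨ -‿cong (fromℤ-*-pos m +[1+ n ]) ⟩
    - ((m ×ᴿ 1#) * (suc n ×ᴿ 1#))       ≈⟨ -‿distribʳ-* _ _ ⟩
    (m ×ᴿ 1#) * - (suc n ×ᴿ 1#)         ∎

  fromℤ-* : ∀ i j → fromℤ (i ℤ.* j) ≈ fromℤ i * fromℤ j
  fromℤ-* (+ m)    j = fromℤ-*-pos m j
  fromℤ-* -[1+ m ] j = begin
    fromℤ (-[1+ m ] ℤ.* j)            ≡⟨ ≡.cong fromℤ (ℤₚ.neg-distribˡ-* +[1+ m ] j) ⟨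
    fromℤ (ℤ.- (+[1+ m ] ℤ.* j))      ≈⟨ fromℤ-neg (+[1+ m ] ℤ.* j) ⟩
    - fromℤ (+[1+ m ] ℤ.* j)          ≈⟨ -‿cong (fromℤ-*-pos (suc m) j) ⟩
    - ((suc m ×ᴿ 1#) * fromℤ j)        ≈⟨ -‿distribˡ-* _ _ ⟩
    - (suc m ×ᴿ 1#) * fromℤ j          ∎

  private
    fromℤ-morphism : ℤ.+-*-rawRing -Raw-AlmostCommutative⟶ fromCommutativeRing R
    fromℤ-morphism = record
      { ⟦_⟧ = fromℤ ; +-homo = fromℤ-+ ; *-homo = fromℤ-* ; -‿homo = fromℤ-neg
      ; 0-homo = refl ; 1-homo = refl }

    _≟_ : WeaklyDecidable (Induced-equivalence fromℤ-morphism)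
    i ≟ j = Maybe.map (λ i≡j → reflexive (≡.cong fromℤ i≡j)) (dec⇒weaklyDec ℤₚ._≟_ i j)

    module S = Algebra.Solver.Ring ℤ.+-*-rawRing (fromCommutativeRing R) fromℤ-morphism _≟_
    open RawSemiringDefs (RawRing.rawSemiring rawRing) using (_^_)

  ⟦_⟧ : ∀ {n} → Expr n → Vec Carrier n → Carrier
  ⟦ atom i  ⟧ ρ = lookup ρ i
  ⟦ con n  ⟧ ρ = n ×ᴿ 1#
  ⟦ x :+ y ⟧ ρ = ⟦ x ⟧ ρ + ⟦ y ⟧ ρ
  ⟦ x :* y ⟧ ρ = ⟦ x ⟧ ρ * ⟦ y ⟧ ρ
  ⟦ :- x   ⟧ ρ = - ⟦ x ⟧ ρ
  ⟦ x :^ n ⟧ ρ = ⟦ x ⟧ ρ ^ n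

  private
    translate : ∀ {n} → Expr n → S.Polynomial n
    translate (atom i)  = S.var i
    translate (con n)  = S.con (+ n)
    translate (x :+ y) = translate x S.:+ translate y
    translate (x :* y) = translate x S.:* translate y
    translate (:- x)   = S.:- translate x
    translate (x :^ n) = translate x S.:^ n

    ⟦translate⟧ : ∀ {n} (x : Expr n) ρ → S.⟦ translate x ⟧ ρ ≡ ⟦ x ⟧ ρ
    ⟦translate⟧ (atom i)  ρ = ≡.refl
    ⟦translate⟧ (con n)  ρ = ≡.refl
    ⟦translate⟧ (x :+ y) ρ = ≡.cong₂ _+_ (⟦translate⟧ x ρ) (⟦translate⟧ y ρ)
    ⟦translate⟧ (x :* y) ρ = ≡.cong₂ _*_ (⟦translate⟧ x ρ) (⟦translate⟧ y ρ)
    ⟦translate⟧ (:- x)   ρ = ≡.cong -_ (⟦translate⟧ x ρ)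
    ⟦translate⟧ (x :^ n) ρ = ≡.cong (_^ n) (⟦translate⟧ x ρ)

    correct : ∀ {n} (x : Expr n) ρ → S.⟦ translate x ⟧↓ ρ ≈ ⟦ x ⟧ ρ
    correct x ρ = trans (S.correct (translate x) ρ) (reflexive (⟦translate⟧ x ρ))

    ⟦_⇓⟧ : ∀ {n} → Expr n → Vec Carrier n → Carrier
    ⟦ x ⇓⟧ = S.⟦ translate x ⟧↓

  open import Relation.Binary.Reflection setoid atom ⟦_⟧ ⟦_⇓⟧ correct public using (solve)

-- Polynomial rings

module PolyRing (R : Ring) (isCR : IsCR R) where
  open CommutativeRing (bundle R isCR)
  open import Algebra.Properties.Ring ring using (-0#≈0#)
  open import Algebra.Properties.CommutativeSemigroup +-commutativeSemigroup using (interchange)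
  open RawRing (Poly R) using () renaming
    (_+_ to _+ₚ_; _*_ to _*ₚ_; -_ to -ₚ_)

  -- Equality of polynomials as a record, from which Agda can infer the
  -- two sides.
  infix 4 _≈ₚ_
  record _≈ₚ_ (f h : List Carrier) : Set where
    constructor pointwise
    field at : ∀ i → coeff R f i ≈ coeff R h i
  open _≈ₚ_ public

  private
    variable
      a b : Carrier
      f f′ h h′ : List Carrier

  scale : Carrier → List Carrier → List Carrier
  scale a = map (a *_)

  shift : List Carrier → List Carrier
  shift f = 0# ∷ f

  coeff-+ : ∀ f g i → coeff R (f +ₚ g) i ≈ coeff R f i + coeff R g i
  coeff-+ []      g       i       = sym (+-identityˡ _)
  coeff-+ (a ∷ f) []      i       = sym (+-identityʳ _)
  coeff-+ (a ∷ f) (b ∷ g) zero    = refl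
  coeff-+ (a ∷ f) (b ∷ g) (suc i) = coeff-+ f g i

  coeff-scale : ∀ a f i → coeff R (scale a f) i ≈ a * coeff R f i
  coeff-scale a []      i       = sym (zeroʳ a)
  coeff-scale a (b ∷ f) zero    = refl
  coeff-scale a (b ∷ f) (suc i) = coeff-scale a f i

  coeff-neg : ∀ f i → coeff R (-ₚ f) i ≈ - coeff R f i
  coeff-neg []      i       = sym -0#≈0#
  coeff-neg (b ∷ f) zero    = refl
  coeff-neg (b ∷ f) (suc i) = coeff-neg f i

  ≈ₚ-isEquivalence : IsEquivalence _≈ₚ_
  ≈ₚ-isEquivalence = record
    { refl  = pointwise λ _ → refl
    ; sym   = λ f≈g → pointwise λ i → sym (at f≈g i)
    ; trans = λ f≈g g≈h → pointwise λ i → trans (at f≈g i) (at g≈h i)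
    }

  open IsEquivalence ≈ₚ-isEquivalence public using ()
    renaming (refl to ≈ₚ-refl; sym to ≈ₚ-sym; trans to ≈ₚ-trans)

  +ₚ-isAbelianGroup : IsAbelianGroup _≈ₚ_ _+ₚ_ [] (-ₚ_)
  +ₚ-isAbelianGroup = record
    { isGroup = record
      { isMonoid = record
        { isSemigroup = record
          { isMagma = record
            { isEquivalence = ≈ₚ-isEquivalence
            ; ∙-cong = λ {f} {f′} {g} {g′} f≈f′ g≈g′ → pointwise λ i →
                trans (coeff-+ f g i) (trans (+-cong (at f≈f′ i) (at g≈g′ i)) (sym (coeff-+ f′ g′ i)))
            }
          ; assoc = λ f g h → pointwise λ i →
              trans (coeff-+ (f +ₚ g) h i) (trans (+-congʳ (coeff-+ f g i))
              (trans (+-assoc _ _ _) (trans (+-congˡ (sym (coeff-+ g h i))) (sym (coeff-+ f (g +ₚ h) i)))))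
          }
        ; identity = (λ f → ≈ₚ-refl) , (λ f → pointwise λ i → trans (coeff-+ f [] i) (+-identityʳ _))
        }
      ; inverse = (λ f → pointwise λ i → trans (coeff-+ (-ₚ f) f i) (trans (+-congʳ (coeff-neg f i)) (-‿inverseˡ _)))
                , (λ f → pointwise λ i → trans (coeff-+ f (-ₚ f) i) (trans (+-congˡ (coeff-neg f i)) (-‿inverseʳ _)))
      ; ⁻¹-cong = λ {f} {g} f≈g → pointwise λ i →
          trans (coeff-neg f i) (trans (-‿cong (at f≈g i)) (sym (coeff-neg g i)))
      }
    ; comm = λ f g → pointwise λ i → trans (coeff-+ f g i) (trans (+-comm _ _) (sym (coeff-+ g f i)))
    }

  private
    module P = IsAbelianGroup +ₚ-isAbelianGroup
    open import Algebra.Bundles using (AbelianGroup)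
    +ₚ-abelianGroup : AbelianGroup 0ℓ 0ℓ
    +ₚ-abelianGroup = record { isAbelianGroup = +ₚ-isAbelianGroup }
    module PG = AbelianGroup +ₚ-abelianGroup
    open import Algebra.Properties.CommutativeSemigroup PG.commutativeSemigroup using ()
      renaming (interchange to +ₚ-interchange; x∙yz≈y∙xz to +ₚ-swap)
    open import Relation.Binary.Reasoning.Setoid PG.setoid

  ∷-cong : a ≈ b → f ≈ₚ h → (a ∷ f) ≈ₚ (b ∷ h)
  ∷-cong a≈b f≈h = pointwise λ { zero → a≈b ; (suc i) → at f≈h i }

  ∷-zero : a ≈ 0# → f ≈ₚ [] → (a ∷ f) ≈ₚ []
  ∷-zero a≈0 f≈0 = pointwise λ { zero → a≈0 ; (suc i) → at f≈0 i }

  tail-cong : (a ∷ f) ≈ₚ (b ∷ h) → f ≈ₚ h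
  tail-cong af≈bh = pointwise λ i → at af≈bh (suc i)

  tail-zero : (a ∷ f) ≈ₚ [] → f ≈ₚ []
  tail-zero af≈0 = pointwise λ i → at af≈0 (suc i)

  shift-cong : f ≈ₚ h → shift f ≈ₚ shift h
  shift-cong = ∷-cong refl

  shift-zero : shift [] ≈ₚ []
  shift-zero = ∷-zero refl ≈ₚ-refl

  shift-+ : ∀ f g → shift (f +ₚ g) ≈ₚ shift f +ₚ shift g
  shift-+ f g = ∷-cong (sym (+-identityˡ 0#)) ≈ₚ-refl

  scale-cong : a ≈ b → f ≈ₚ h → scale a f ≈ₚ scale b h
  scale-cong {f = f} {h} a≈b f≈h = pointwise λ i →
    trans (coeff-scale _ f i) (trans (*-cong a≈b (at f≈h i)) (sym (coeff-scale _ h i)))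

  scale-+ : ∀ a f g → scale a (f +ₚ g) ≈ₚ scale a f +ₚ scale a g
  scale-+ a f g = pointwise λ i → trans (coeff-scale a (f +ₚ g) i) (trans (*-congˡ (coeff-+ f g i))
    (trans (distribˡ _ _ _) (trans (+-cong (sym (coeff-scale a f i)) (sym (coeff-scale a g i)))
    (sym (coeff-+ (scale a f) (scale a g) i)))))

  scale-scale : ∀ a b f → scale a (scale b f) ≈ₚ scale (a * b) f
  scale-scale a b f = pointwise λ i → trans (coeff-scale a (scale b f) i) (trans (*-congˡ (coeff-scale b f i))
    (trans (sym (*-assoc _ _ _)) (sym (coeff-scale (a * b) f i))))

  scale-shift : ∀ a f → scale a (shift f) ≈ₚ shift (scale a f)
  scale-shift a f = ∷-cong (zeroʳ a) ≈ₚ-refl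

  scale-zero : a ≈ 0# → ∀ f → scale a f ≈ₚ []
  scale-zero a≈0 f = pointwise λ i → trans (coeff-scale _ f i) (trans (*-congʳ a≈0) (zeroˡ _))

  scale-one : ∀ f → scale 1# f ≈ₚ f
  scale-one f = pointwise λ i → trans (coeff-scale 1# f i) (*-identityˡ _)

  scale-*ₚ : ∀ a f g → scale a f *ₚ g ≈ₚ scale a (f *ₚ g)
  scale-*ₚ a []      g = ≈ₚ-refl
  scale-*ₚ a (b ∷ f) g = begin
    scale (a * b) g +ₚ shift (scale a f *ₚ g)       ≈⟨ P.∙-cong (≈ₚ-sym (scale-scale a b g)) (shift-cong (scale-*ₚ a f g)) ⟩
    scale a (scale b g) +ₚ shift (scale a (f *ₚ g)) ≈⟨ P.∙-congˡ (scale-shift a (f *ₚ g)) ⟨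
    scale a (scale b g) +ₚ scale a (shift (f *ₚ g)) ≈⟨ scale-+ a (scale b g) (shift (f *ₚ g)) ⟨
    scale a (scale b g +ₚ shift (f *ₚ g))           ∎

  shift-*ₚ : ∀ f g → shift f *ₚ g ≈ₚ shift (f *ₚ g)
  shift-*ₚ f g = P.∙-congʳ (scale-zero refl g)

  *ₚ-zeroʳ : ∀ f → f *ₚ [] ≈ₚ []
  *ₚ-zeroʳ []      = ≈ₚ-refl
  *ₚ-zeroʳ (a ∷ f) = ≈ₚ-trans (shift-cong (*ₚ-zeroʳ f)) shift-zero

  *ₚ-congˡ : ∀ f → h ≈ₚ h′ → f *ₚ h ≈ₚ f *ₚ h′
  *ₚ-congˡ []      h≈h′ = ≈ₚ-refl
  *ₚ-congˡ (a ∷ f) h≈h′ = P.∙-cong (scale-cong refl h≈h′) (shift-cong (*ₚ-congˡ f h≈h′))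

  -- Multiplication recurses on its left factor; this is the matching recursion on the right factor,
  -- from which commutativity follows by induction.
  *ₚ-∷ : ∀ f b g → f *ₚ (b ∷ g) ≈ₚ scale b f +ₚ shift (f *ₚ g)
  *ₚ-∷ []      b g = ≈ₚ-sym shift-zero
  *ₚ-∷ (a ∷ f) b g = ∷-cong (+-congʳ (*-comm a b)) (begin
    scale a g +ₚ f *ₚ (b ∷ g)                     ≈⟨ P.∙-congˡ (*ₚ-∷ f b g) ⟩
    scale a g +ₚ (scale b f +ₚ shift (f *ₚ g))    ≈⟨ +ₚ-swap (scale a g) (scale b f) (shift (f *ₚ g)) ⟩
    scale b f +ₚ (scale a g +ₚ shift (f *ₚ g))    ∎)

  *ₚ-comm : ∀ f g → f *ₚ g ≈ₚ g *ₚ f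
  *ₚ-comm f []      = *ₚ-zeroʳ f
  *ₚ-comm f (b ∷ g) = ≈ₚ-trans (*ₚ-∷ f b g) (P.∙-congˡ (shift-cong (*ₚ-comm f g)))

  *ₚ-distribˡ : ∀ f g h → f *ₚ (g +ₚ h) ≈ₚ f *ₚ g +ₚ f *ₚ h
  *ₚ-distribˡ []      g h = ≈ₚ-refl
  *ₚ-distribˡ (a ∷ f) g h = begin
    scale a (g +ₚ h) +ₚ shift (f *ₚ (g +ₚ h))
      ≈⟨ P.∙-cong (scale-+ a g h) (≈ₚ-trans (shift-cong (*ₚ-distribˡ f g h)) (shift-+ (f *ₚ g) (f *ₚ h))) ⟩
    (scale a g +ₚ scale a h) +ₚ (shift (f *ₚ g) +ₚ shift (f *ₚ h))
      ≈⟨ +ₚ-interchange (scale a g) (scale a h) (shift (f *ₚ g)) (shift (f *ₚ h)) ⟩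
    (scale a g +ₚ shift (f *ₚ g)) +ₚ (scale a h +ₚ shift (f *ₚ h)) ∎

  *ₚ-distribʳ : ∀ h f g → (f +ₚ g) *ₚ h ≈ₚ f *ₚ h +ₚ g *ₚ h
  *ₚ-distribʳ h f g = begin
    (f +ₚ g) *ₚ h       ≈⟨ *ₚ-comm (f +ₚ g) h ⟩
    h *ₚ (f +ₚ g)       ≈⟨ *ₚ-distribˡ h f g ⟩
    h *ₚ f +ₚ h *ₚ g    ≈⟨ P.∙-cong (*ₚ-comm h f) (*ₚ-comm h g) ⟩
    f *ₚ h +ₚ g *ₚ h    ∎

  *ₚ-assoc : ∀ f g h → (f *ₚ g) *ₚ h ≈ₚ f *ₚ (g *ₚ h)
  *ₚ-assoc []      g h = ≈ₚ-refl
  *ₚ-assoc (a ∷ f) g h = begin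
    (scale a g +ₚ shift (f *ₚ g)) *ₚ h            ≈⟨ *ₚ-distribʳ h (scale a g) (shift (f *ₚ g)) ⟩
    scale a g *ₚ h +ₚ shift (f *ₚ g) *ₚ h         ≈⟨ P.∙-cong (scale-*ₚ a g h) (≈ₚ-trans (shift-*ₚ (f *ₚ g) h) (shift-cong (*ₚ-assoc f g h))) ⟩
    scale a (g *ₚ h) +ₚ shift (f *ₚ (g *ₚ h))     ∎

  *ₚ-identityˡ : ∀ f → (1# ∷ []) *ₚ f ≈ₚ f
  *ₚ-identityˡ f = begin
    scale 1# f +ₚ shift []    ≈⟨ P.∙-cong (scale-one f) shift-zero ⟩
    f +ₚ []                   ≈⟨ P.identityʳ f ⟩
    f                         ∎

  *ₚ-cong : f ≈ₚ f′ → h ≈ₚ h′ → f *ₚ h ≈ₚ f′ *ₚ h′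
  *ₚ-cong {f} {f′} {h} {h′} f≈f′ h≈h′ = begin
    f *ₚ h      ≈⟨ *ₚ-congˡ f h≈h′ ⟩
    f *ₚ h′     ≈⟨ *ₚ-comm f h′ ⟩
    h′ *ₚ f     ≈⟨ *ₚ-congˡ h′ f≈f′ ⟩
    h′ *ₚ f′    ≈⟨ *ₚ-comm h′ f′ ⟩
    f′ *ₚ h′    ∎

  polyRing : CommutativeRing 0ℓ 0ℓ
  polyRing = record
    { isCommutativeRing = record
      { isRing = record
        { +-isAbelianGroup = +ₚ-isAbelianGroup
        ; *-cong     = *ₚ-cong
        ; *-assoc    = *ₚ-assoc
        ; *-identity = *ₚ-identityˡ , λ f → ≈ₚ-trans (*ₚ-comm f (1# ∷ [])) (*ₚ-identityˡ f)
        ; distrib    = *ₚ-distribˡ , *ₚ-distribʳ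
        }
      ; *-comm = *ₚ-comm
      }
    }

-- The zero test makes the passage to polynomials constructive: coefficient lists have no normal
-- form, and the proof for products branches on whether the lowest coefficient vanishes.
record IsDecidableDomain (R : Ring) : Set where
  open RawRing R
  field
    zero?  : ∀ x → x ≈ 0# ⊎ ¬ (x ≈ 0#)
    domain : ∀ x y → x * y ≈ 0# → x ≈ 0# ⊎ y ≈ 0#
    1≉0    : ¬ (1# ≈ 0#)

module _ {R : Ring} (isCR : IsCR R) (dom : IsDecidableDomain R) where
  open CommutativeRing (bundle R isCR)
  open PolyRing R isCR
  open IsDecidableDomain dom
  open RawRing (Poly R) using () renaming (_*_ to _*ₚ_)
  private module P = CommutativeRing polyRing
  open import Relation.Binary.Reasoning.Setoid P.setoid

  private
    poly-zero? : ∀ f → f ≈ₚ [] ⊎ ¬ (f ≈ₚ [])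
    poly-zero? []      = inj₁ P.refl
    poly-zero? (a ∷ f) with zero? a | poly-zero? f
    ... | inj₂ a≉0 | _        = inj₂ λ af≈0 → a≉0 (at af≈0 0)
    ... | inj₁ a≈0 | inj₁ f≈0 = inj₁ (∷-zero a≈0 f≈0)
    ... | inj₁ _   | inj₂ f≉0 = inj₂ λ af≈0 → f≉0 (tail-zero af≈0)

    -- Descends along the lowest coefficients: a vanishing one is shifted
    -- away, and if neither vanishes then neither does their product.
    poly-domain : ∀ f g → f *ₚ g ≈ₚ [] → f ≈ₚ [] ⊎ g ≈ₚ []
    poly-domain []      g _ = inj₁ P.refl
    poly-domain (a ∷ f) g afg≈0 = [ (λ a≈0 → shiftˡ a≈0 g afg≈0) , (λ a≉0 → shiftʳ a≉0 g afg≈0) ]′ (zero? a)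
      where
      shiftˡ : a ≈ 0# → ∀ g → (a ∷ f) *ₚ g ≈ₚ [] → (a ∷ f) ≈ₚ [] ⊎ g ≈ₚ []
      shiftˡ a≈0 g afg≈0 = map₁ (∷-zero a≈0) (poly-domain f g (tail-zero (begin
        shift (f *ₚ g)               ≈⟨ P.+-congʳ (scale-zero a≈0 g) ⟨
        (a ∷ f) *ₚ g                 ≈⟨ afg≈0 ⟩
        []                           ∎)))

      shiftʳ : ¬ (a ≈ 0#) → ∀ g → (a ∷ f) *ₚ g ≈ₚ [] → (a ∷ f) ≈ₚ [] ⊎ g ≈ₚ []
      shiftʳ a≉0 []      _     = inj₂ P.refl
      shiftʳ a≉0 (b ∷ g) afg≈0 with domain a b (trans (sym (+-identityʳ _)) (at afg≈0 0))
      ... | inj₁ a≈0 = contradiction a≈0 a≉0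
      ... | inj₂ b≈0 = map₂ (∷-zero b≈0) (shiftʳ a≉0 g (tail-zero (begin
        shift ((a ∷ f) *ₚ g)                     ≈⟨ P.+-congʳ (scale-zero b≈0 (a ∷ f)) ⟨
        scale b (a ∷ f) P.+ shift ((a ∷ f) *ₚ g) ≈⟨ *ₚ-∷ (a ∷ f) b g ⟨
        (a ∷ f) *ₚ (b ∷ g)                       ≈⟨ afg≈0 ⟩
        []                                       ∎)))

  poly-isDecidableDomain : IsDecidableDomain (Poly R)
  poly-isDecidableDomain = record
    { zero?  = λ f → ⊎.map {A = f ≈ₚ []} at (λ f≉0 f≈0 → f≉0 (pointwise f≈0)) (poly-zero? f)
    ; domain = λ f g fg≈0 → ⊎.map {A = f ≈ₚ []} {B = g ≈ₚ []} at at (poly-domain f g (pointwise fg≈0))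
    ; 1≉0    = λ 1≈0 → 1≉0 (1≈0 0)
    }

poly-isCR : ∀ {R} → IsCR R → IsCR (Poly R)
poly-isCR {R} isCR = transfer-isCR (Poly R) polyRing id
  (ringHomomorphism (Poly R) P.rawRing id pointwise
    (λ _ _ → P.refl) (λ _ _ → P.refl) (λ _ → P.refl) P.refl P.refl)
  at
  where
  open PolyRing R isCR using (at; pointwise; polyRing)
  module P = CommutativeRing polyRing

module _ (R : Ring) (isCR : IsCR R) where
  open CommutativeRing (bundle R isCR)
  open import Algebra.Properties.Ring ring using (-0#≈0#)
  open PolyRing R isCR
  private module P = CommutativeRing polyRing

  constant-isRingHomomorphism : IsRingHomomorphism R (Poly R) (_∷ [])
  constant-isRingHomomorphism = ringHomomorphism R (Poly R) (_∷ [])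
    (λ x≈y → at (∷-cong x≈y P.refl))
    (λ x y _ → refl)
    (λ x y → at (∷-cong (sym (+-identityʳ _)) P.refl))
    (λ x _ → refl)
    (at shift-zero)
    (λ _ → refl)

  constant-polyRing-isRingHomomorphism : IsRingHomomorphism R P.rawRing (_∷ [])
  constant-polyRing-isRingHomomorphism = ringHomomorphism R P.rawRing (_∷ [])
    (λ x≈y → pointwise (⟦⟧-cong x≈y)) (λ x y → pointwise (+-homo x y)) (λ x y → pointwise (*-homo x y))
    (λ x → pointwise (-‿homo x)) (pointwise 0#-homo) (pointwise 1#-homo)
    where open IsRingHomomorphism constant-isRingHomomorphism

  -- Rewrites an explicit coefficient list as an expression in `X` and constants, the form that the
  -- ring solver and homomorphisms can handle.
  constant-+-X* : ∀ a f → (a ∷ []) P.+ (0# ∷ 1# ∷ []) P.* f ≈ₚ a ∷ f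
  constant-+-X* a f = begin
    (a ∷ []) P.+ (0# ∷ 1# ∷ []) P.* f    ≈⟨ P.+-congˡ {x = a ∷ []} (P.trans (shift-*ₚ P.1# f) (shift-cong (P.*-identityˡ f))) ⟩
    (a ∷ []) P.+ shift f                 ≈⟨ ∷-cong (+-identityʳ a) P.refl ⟩
    a ∷ f                                ∎
    where open import Relation.Binary.Reasoning.Setoid P.setoid

  module Horner (A : CommutativeRing 0ℓ 0ℓ)
    (φ : ∣ R ∣ → CommutativeRing.Carrier A) (φ-hom : IsRingHomomorphism R (CommutativeRing.rawRing A) φ)
    (x : CommutativeRing.Carrier A) where
    private module A = CommutativeRing A
    open IsRingHomomorphism φ-hom renaming (⟦⟧-cong to φ-cong)
    open import Algebra.Properties.Ring A.ring using () renaming (-0#≈0# to A-0#≈0#; -‿distribʳ-* to A-distribʳ-*)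
    open import Algebra.Properties.AbelianGroup A.+-abelianGroup using (⁻¹-∙-comm)
    open import Relation.Binary.Reasoning.Setoid A.setoid

    horner : List Carrier → A.Carrier
    horner = foldr (λ q r → φ q A.+ x A.* r) A.0#

    private
      φ-zero : ∀ {a} → a ≈ 0# → φ a A.≈ A.0#
      φ-zero a≈0 = A.trans (φ-cong a≈0) 0#-homo

    horner-zero : ∀ f → f ≈ₚ [] → horner f A.≈ A.0#
    horner-zero []      _   = A.refl
    horner-zero (a ∷ f) f≈0 = begin
      φ a A.+ x A.* horner f    ≈⟨ A.+-cong (φ-zero (at f≈0 0)) (A.*-congˡ (horner-zero f (tail-zero f≈0))) ⟩
      A.0# A.+ x A.* A.0#       ≈⟨ A.trans (A.+-identityˡ _) (A.zeroʳ x) ⟩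
      A.0#                      ∎

    horner-cong : ∀ f g → f ≈ₚ g → horner f A.≈ horner g
    horner-cong []      g       f≈g = A.sym (horner-zero g (P.sym f≈g))
    horner-cong (a ∷ f) []      f≈g = horner-zero (a ∷ f) f≈g
    horner-cong (a ∷ f) (b ∷ g) f≈g =
      A.+-cong (φ-cong (at f≈g 0)) (A.*-congˡ (horner-cong f g (tail-cong f≈g)))

    horner-+ : ∀ f g → horner (f P.+ g) A.≈ horner f A.+ horner g
    horner-+ []      g       = A.sym (A.+-identityˡ _)
    horner-+ (a ∷ f) []      = A.sym (A.+-identityʳ _)
    horner-+ (a ∷ f) (b ∷ g) = begin
      φ (a + b) A.+ x A.* horner (f P.+ g)
        ≈⟨ A.+-cong (+-homo a b) (A.*-congˡ (horner-+ f g)) ⟩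
      (φ a A.+ φ b) A.+ x A.* (horner f A.+ horner g)
        ≈⟨ RingSolver.solve A 5 (λ a b x f g → (a :+ b) :+ x :* (f :+ g) := (a :+ x :* f) :+ (b :+ x :* g))
             A.refl (φ a) (φ b) x (horner f) (horner g) ⟩
      (φ a A.+ x A.* horner f) A.+ (φ b A.+ x A.* horner g) ∎

    horner-scale : ∀ a f → horner (scale a f) A.≈ φ a A.* horner f
    horner-scale a []      = A.sym (A.zeroʳ (φ a))
    horner-scale a (b ∷ f) = begin
      φ (a * b) A.+ x A.* horner (scale a f)
        ≈⟨ A.+-cong (*-homo a b) (A.*-congˡ (horner-scale a f)) ⟩
      φ a A.* φ b A.+ x A.* (φ a A.* horner f)
        ≈⟨ RingSolver.solve A 4 (λ a b x f → a :* b :+ x :* (a :* f) := a :* (b :+ x :* f))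
             A.refl (φ a) (φ b) x (horner f) ⟩
      φ a A.* (φ b A.+ x A.* horner f) ∎

    horner-* : ∀ f g → horner (f P.* g) A.≈ horner f A.* horner g
    horner-* []      g = A.sym (A.zeroˡ _)
    horner-* (a ∷ f) g = begin
      horner (scale a g P.+ shift (f P.* g))
        ≈⟨ horner-+ (scale a g) (shift (f P.* g)) ⟩
      horner (scale a g) A.+ (φ 0# A.+ x A.* horner (f P.* g))
        ≈⟨ A.+-cong (horner-scale a g) (A.+-cong 0#-homo (A.*-congˡ (horner-* f g))) ⟩
      φ a A.* horner g A.+ (A.0# A.+ x A.* (horner f A.* horner g))
        ≈⟨ RingSolver.solve A 4 (λ a x f g → a :* g :+ (con 0 :+ x :* (f :* g)) := (a :+ x :* f) :* g)
             A.refl (φ a) x (horner f) (horner g) ⟩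
      (φ a A.+ x A.* horner f) A.* horner g ∎

    horner-neg : ∀ f → horner (P.- f) A.≈ A.- horner f
    horner-neg []      = A.sym A-0#≈0#
    horner-neg (a ∷ f) = begin
      φ (- a) A.+ x A.* horner (P.- f)    ≈⟨ A.+-cong (-‿homo a) (A.*-congˡ (horner-neg f)) ⟩
      A.- φ a A.+ x A.* (A.- horner f)    ≈⟨ A.+-congˡ (A-distribʳ-* x (horner f)) ⟨
      A.- φ a A.+ A.- (x A.* horner f)    ≈⟨ ⁻¹-∙-comm _ _ ⟩
      A.- (φ a A.+ x A.* horner f)        ∎

    horner-isRingHomomorphism : IsRingHomomorphism (Poly R) A.rawRing horner
    horner-isRingHomomorphism = ringHomomorphism (Poly R) A.rawRing horner
      (λ {f} {g} f≈g → horner-cong f g (pointwise f≈g)) horner-+ horner-* horner-neg A.refl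
      (A.trans (A.+-cong 1#-homo (A.zeroʳ x)) (A.+-identityʳ _))

-- Evaluation of polynomials in several variables

module Polynomials (k : Ring) (k-isCR : IsCR k) where
  open Affine k

  kX-isCR : ∀ n → IsCR k[X n ]
  kX-isCR zero    = k-isCR
  kX-isCR (suc n) = poly-isCR (kX-isCR n)

  kX : ℕ → CommutativeRing 0ℓ 0ℓ
  kX n = bundle k[X n ] (kX-isCR n)

  ∘-isRingHomomorphism : ∀ {R S} (T : CommutativeRing 0ℓ 0ℓ) {f : ∣ R ∣ → ∣ S ∣} {g} →
    IsRingHomomorphism R S f → IsRingHomomorphism S (CommutativeRing.rawRing T) g →
    IsRingHomomorphism R (CommutativeRing.rawRing T) (g ∘ f)
  ∘-isRingHomomorphism T = Composition.isRingHomomorphism (CommutativeRing.trans T)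

  const-isRingHomomorphism : ∀ n → IsRingHomomorphism k k[X n ] (const n)
  const-isRingHomomorphism zero    = ringHomomorphism k k id id (λ _ _ → refl) (λ _ _ → refl) (λ _ → refl) refl refl
    where open CommutativeRing (kX 0) using (refl)
  const-isRingHomomorphism (suc n) = ∘-isRingHomomorphism (kX (suc n))
    (const-isRingHomomorphism n) (constant-isRingHomomorphism k[X n ] (kX-isCR n))

  module _ (A : CommutativeRing 0ℓ 0ℓ) (ι : ∣ k ∣ → CommutativeRing.Carrier A) where
    private module A = CommutativeRing A

    eval-isRingHomomorphism : IsRingHomomorphism k A.rawRing ι →
      ∀ {n} (xs : Vec A.Carrier n) → IsRingHomomorphism k[X n ] A.rawRing (eval A.rawRing ι xs)
    eval-isRingHomomorphism ι-hom []       = ι-hom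
    eval-isRingHomomorphism ι-hom {suc n} (x ∷ xs) = Horner.horner-isRingHomomorphism k[X n ] (kX-isCR n) A
      (eval A.rawRing ι xs) (eval-isRingHomomorphism ι-hom xs) x

    eval-const : IsRingHomomorphism k A.rawRing ι →
      ∀ {n} (xs : Vec A.Carrier n) a → eval A.rawRing ι xs (const n a) A.≈ ι a
    eval-const ι-hom []       a = A.refl
    eval-const ι-hom (x ∷ xs) a =
      A.trans (A.+-cong (eval-const ι-hom xs a) (A.zeroʳ x)) (A.+-identityʳ _)

    eval-var : IsRingHomomorphism k A.rawRing ι →
      ∀ {n} (xs : Vec A.Carrier n) i → eval A.rawRing ι xs (var n i) A.≈ lookup xs i
    eval-var ι-hom {suc n} (x ∷ xs) zero = begin
      eval A.rawRing ι xs N.0# A.+ x A.* (eval A.rawRing ι xs N.1# A.+ x A.* A.0#)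
        ≈⟨ A.+-cong 0#-homo (A.*-congˡ (A.+-cong 1#-homo (A.zeroʳ x))) ⟩
      A.0# A.+ x A.* (A.1# A.+ A.0#)
        ≈⟨ RingSolver.solve A 1 (λ x → con 0 :+ x :* (con 1 :+ con 0) := x) A.refl x ⟩
      x ∎
      where
      module N = RawRing k[X n ]
      open IsRingHomomorphism (eval-isRingHomomorphism ι-hom xs)
      open import Relation.Binary.Reasoning.Setoid A.setoid
    eval-var ι-hom (x ∷ xs) (suc i) =
      A.trans (A.+-cong (eval-var ι-hom xs i) (A.zeroʳ x)) (A.+-identityʳ _)

    -- The uniqueness half of the universal property of polynomial rings. It identifies
    -- homomorphisms given otherwise, such as `fromPoly` or `σ ∘ σ`, with evaluations.
    eval-unique : ∀ {n} (χ : ∣ k[X n ] ∣ → A.Carrier) → IsRingHomomorphism k[X n ] A.rawRing χ →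
      (xs : Vec A.Carrier n) → (∀ i → χ (var n i) A.≈ lookup xs i) → (∀ a → χ (const n a) A.≈ ι a) →
      ∀ f → χ f A.≈ eval A.rawRing ι xs f
    eval-unique χ χ-hom [] _ χ-const f = χ-const f
    eval-unique {suc n} χ χ-hom (x ∷ xs) χ-var χ-const = go
      where
      open IsRingHomomorphism χ-hom
      open RawRing k[X n ] using (0#; 1#)
      open RawRing (Poly k[X n ]) using () renaming (_+_ to _+ₚ_; _*_ to _*ₚ_)
      open import Relation.Binary.Reasoning.Setoid A.setoid

      χ-constant : ∀ a → χ (a ∷ []) A.≈ eval A.rawRing ι xs a
      χ-constant = eval-unique (χ ∘ (_∷ []))
        (∘-isRingHomomorphism A (constant-isRingHomomorphism k[X n ] (kX-isCR n)) χ-hom)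
        xs (χ-var ∘ suc) χ-const

      go : ∀ f → χ f A.≈ eval A.rawRing ι (x ∷ xs) f
      go []      = 0#-homo
      go (a ∷ f) = begin
        χ (a ∷ f)                                   ≈⟨ ⟦⟧-cong (at (constant-+-X* k[X n ] (kX-isCR n) a f)) ⟨
        χ ((a ∷ []) +ₚ (0# ∷ 1# ∷ []) *ₚ f)         ≈⟨ +-homo (a ∷ []) ((0# ∷ 1# ∷ []) *ₚ f) ⟩
        χ (a ∷ []) A.+ χ ((0# ∷ 1# ∷ []) *ₚ f)      ≈⟨ A.+-cong (χ-constant a) (*-homo (0# ∷ 1# ∷ []) f) ⟩
        eval A.rawRing ι xs a A.+ χ (0# ∷ 1# ∷ []) A.* χ f
                                                    ≈⟨ A.+-congˡ (A.*-cong (χ-var zero) (go f)) ⟩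
        eval A.rawRing ι xs a A.+ x A.* eval A.rawRing ι (x ∷ xs) f ∎
        where open PolyRing k[X n ] (kX-isCR n) using (at)

  -- Parametricity of Horner's rule: a relation compatible with sums, products and zero passes from
  -- the arguments to the values. It will be applied to `_↦_`, which relates fractions to their
  -- values without being a function.
  eval-related : (A B : Ring) (let module A = RawRing A) (let module B = RawRing B)
    (_∼_ : ∣ A ∣ → ∣ B ∣ → Set) →
    (∀ {x x′ y y′} → x ∼ y → x′ ∼ y′ → (x A.+ x′) ∼ (y B.+ y′)) →
    (∀ {x x′ y y′} → x ∼ y → x′ ∼ y′ → (x A.* x′) ∼ (y B.* y′)) →
    A.0# ∼ B.0# →
    ∀ {ι κ} → (∀ a → ι a ∼ κ a) →
    ∀ {n} (xs : Vec ∣ A ∣ n) (ys : Vec ∣ B ∣ n) → (∀ i → lookup xs i ∼ lookup ys i) →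
    ∀ f → eval A ι xs f ∼ eval B κ ys f
  eval-related A B _∼_ ∼-+ ∼-* ∼-0 ∼-const [] [] _ f = ∼-const f
  eval-related A B _∼_ ∼-+ ∼-* ∼-0 ∼-const (x ∷ xs) (y ∷ ys) ∼-var = go
    where
    go : ∀ f → eval A _ (x ∷ xs) f ∼ eval B _ (y ∷ ys) f
    go []      = ∼-0
    go (a ∷ f) = ∼-+ (eval-related A B _∼_ ∼-+ ∼-* ∼-0 ∼-const xs ys (∼-var ∘ suc) a)
                     (∼-* (∼-var zero) (go f))

-- Quotient rings and localisation

module Regularity (R : CommutativeRing 0ℓ 0ℓ) where
  open CommutativeRing R

  -- Records, lest Agda compare products when comparing types.
  record Invertible (x : Carrier) : Set where
    constructor invertible
    field
      inv       : Carrier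
      *-inverse : x * inv ≈ 1#
  open Invertible public

  record Regular (d : Carrier) : Set where
    constructor regular
    field cancel : ∀ x → d * x ≈ 0# → x ≈ 0#
  open Regular public

  regular-cong : ∀ {d e} → d ≈ e → Regular d → Regular e
  regular-cong d≈e d-reg = regular λ x ex≈0 → cancel d-reg x (trans (*-congʳ d≈e) ex≈0)

  1-regular : Regular 1#
  1-regular = regular λ x 1x≈0 → trans (sym (*-identityˡ x)) 1x≈0

  *-regular : ∀ {d e} → Regular d → Regular e → Regular (d * e)
  *-regular {d} {e} d-reg e-reg = regular λ x dex≈0 →
    cancel e-reg x (cancel d-reg (e * x) (trans (sym (*-assoc d e x)) dex≈0))

  regular-factorʳ : ∀ d {e} → Regular (d * e) → Regular e
  regular-factorʳ d {e} de-reg = regular λ x ex≈0 →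
    cancel de-reg x (trans (*-assoc d e x) (trans (*-congˡ ex≈0) (zeroʳ d)))

module Ideals (R : Ring) (isCR : IsCR R) where
  open CommutativeRing (bundle R isCR)
  open import Relation.Binary.Reasoning.Setoid setoid

  ∈-cong : ∀ fs {x y} → x ≈ y → InIdeal R fs x → InIdeal R fs y
  ∈-cong []       x≈y x≈0     = trans (sym x≈y) x≈0
  ∈-cong (f ∷ fs) x≈y (q , r) = q , ∈-cong fs (+-congʳ x≈y) r

  0∈ : ∀ fs → InIdeal R fs 0#
  0∈ []       = refl
  0∈ (f ∷ fs) = 0# , ∈-cong fs (RingSolver.solve (bundle R isCR) 1 (λ f → con 0 := con 0 :+ :- (con 0 :* f)) refl f) (0∈ fs)

  +-∈ : ∀ fs {x y} → InIdeal R fs x → InIdeal R fs y → InIdeal R fs (x + y)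
  +-∈ []       x≈0 y≈0 = trans (+-cong x≈0 y≈0) (+-identityʳ 0#)
  +-∈ (f ∷ fs) {x} {y} (q , r) (q′ , r′) = q + q′ , ∈-cong fs
    (RingSolver.solve (bundle R isCR) 5 (λ x y q q′ f → (x :+ :- (q :* f)) :+ (y :+ :- (q′ :* f)) := (x :+ y) :+ :- ((q :+ q′) :* f))
      refl x y q q′ f)
    (+-∈ fs r r′)

  *-∈ : ∀ fs a {x} → InIdeal R fs x → InIdeal R fs (a * x)
  *-∈ []       a x≈0 = trans (*-congˡ x≈0) (zeroʳ a)
  *-∈ (f ∷ fs) a {x} (q , r) = a * q , ∈-cong fs
    (RingSolver.solve (bundle R isCR) 4 (λ a x q f → a :* (x :+ :- (q :* f)) := a :* x :+ :- (a :* q :* f)) refl a x q f)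
    (*-∈ fs a r)

  ≈0⇒∈ : ∀ fs {x} → x ≈ 0# → InIdeal R fs x
  ≈0⇒∈ fs x≈0 = ∈-cong fs (sym x≈0) (0∈ fs)

  neg-∈ : ∀ fs {x} → InIdeal R fs x → InIdeal R fs (- x)
  neg-∈ fs {x} x∈ = ∈-cong fs
    (RingSolver.solve (bundle R isCR) 1 (λ x → :- con 1 :* x := :- x) refl x) (*-∈ fs (- 1#) x∈)

  generator-∈ : ∀ f → InIdeal R (f ∷ []) f
  generator-∈ f = 1# , RingSolver.solve (bundle R isCR) 1 (λ f → f :+ :- (con 1 :* f) := con 0) refl f

  module _ (fs : List Carrier) where
    -- The carrier is kept and only the equality is coarsened, so that the projection is `id` and no
    -- representatives are ever chosen.
    quotient : Ring
    quotient = record (CommutativeRing.rawRing (bundle R isCR)) { _≈_ = λ x y → InIdeal R fs (x + - y) }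

    ≈⇒≈/ : ∀ {x y} → x ≈ y → InIdeal R fs (x + - y)
    ≈⇒≈/ x≈y = ≈0⇒∈ fs (trans (+-congʳ x≈y) (-‿inverseʳ _))

    ∈⇒≈/0 : ∀ {x} → InIdeal R fs x → InIdeal R fs (x + - 0#)
    ∈⇒≈/0 {x} = ∈-cong fs (RingSolver.solve (bundle R isCR) 1 (λ x → x := x :+ :- con 0) refl x)

    ≈/0⇒∈ : ∀ {x} → InIdeal R fs (x + - 0#) → InIdeal R fs x
    ≈/0⇒∈ {x} = ∈-cong fs (RingSolver.solve (bundle R isCR) 1 (λ x → x :+ :- con 0 := x) refl x)

    quotient-isCR : IsCR quotient
    quotient-isCR = record
      { isRing = record
        { +-isAbelianGroup = record
          { isGroup = record
            { isMonoid = record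
              { isSemigroup = record
                { isMagma = record
                  { isEquivalence = record
                    { refl  = ≈⇒≈/ refl
                    ; sym   = λ {x} {y} r → ∈-cong fs
                        (RingSolver.solve (bundle R isCR) 2 (λ x y → :- (x :- y) := y :- x) refl x y) (neg-∈ fs r)
                    ; trans = λ {x} {y} {z} r s → ∈-cong fs
                        (RingSolver.solve (bundle R isCR) 3 (λ x y z → (x :- y) :+ (y :- z) := x :- z) refl x y z) (+-∈ fs r s)
                    }
                  ; ∙-cong = λ {x} {y} {u} {v} r s → ∈-cong fs
                      (RingSolver.solve (bundle R isCR) 4 (λ x y u v → (x :- y) :+ (u :- v) := (x :+ u) :- (y :+ v)) refl x y u v)
                      (+-∈ fs r s)
                  }
                ; assoc = λ x y z → ≈⇒≈/ (+-assoc x y z)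
                }
              ; identity = (λ x → ≈⇒≈/ (+-identityˡ x)) , λ x → ≈⇒≈/ (+-identityʳ x)
              }
            ; inverse = (λ x → ≈⇒≈/ (-‿inverseˡ x)) , λ x → ≈⇒≈/ (-‿inverseʳ x)
            ; ⁻¹-cong = λ {x} {y} r → ∈-cong fs
                (RingSolver.solve (bundle R isCR) 2 (λ x y → :- (x :- y) := :- x :- :- y) refl x y) (neg-∈ fs r)
            }
          ; comm = λ x y → ≈⇒≈/ (+-comm x y)
          }
        ; *-cong     = λ {x} {y} {u} {v} r s → ∈-cong fs
            (RingSolver.solve (bundle R isCR) 4 (λ x y u v → u :* (x :- y) :+ y :* (u :- v) := x :* u :- y :* v) refl x y u v)
            (+-∈ fs (*-∈ fs u r) (*-∈ fs y s))
        ; *-assoc    = λ x y z → ≈⇒≈/ (*-assoc x y z)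
        ; *-identity = (λ x → ≈⇒≈/ (*-identityˡ x)) , λ x → ≈⇒≈/ (*-identityʳ x)
        ; distrib    = (λ x y z → ≈⇒≈/ (distribˡ x y z)) , λ x y z → ≈⇒≈/ (distribʳ x y z)
        }
      ; *-comm = λ x y → ≈⇒≈/ (*-comm x y)
      }

    quotientRing : CommutativeRing 0ℓ 0ℓ
    quotientRing = bundle quotient quotient-isCR

    -- If `e` were in the ideal, then `e * 1#` would vanish in the quotient, and cancelling `e`
    -- would put `1#` into the ideal.
    regular⇒∉ : ∀ e → ¬ InIdeal R fs 1# → Regularity.Regular quotientRing e → ¬ InIdeal R fs e
    regular⇒∉ e 1∉ e-reg e∈ = 1∉ (≈/0⇒∈ (Regularity.cancel e-reg 1#
      (∈⇒≈/0 (∈-cong fs (sym (*-identityʳ e)) e∈))))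

    projection-isRingHomomorphism : IsRingHomomorphism R quotient id
    projection-isRingHomomorphism = ringHomomorphism R quotient id ≈⇒≈/
      (λ _ _ → ≈⇒≈/ refl) (λ _ _ → ≈⇒≈/ refl) (λ _ → ≈⇒≈/ refl) (≈⇒≈/ refl) (≈⇒≈/ refl)

-- As denominators are regular, equality of fractions is plain cross-multiplication without an
-- auxiliary factor; regularity is what makes it transitive. The denominators will be the complement
-- of a prime ideal for function fields, and all regular elements for the total ring of fractions.
module Localisation (R : CommutativeRing 0ℓ 0ℓ)
  (Den : CommutativeRing.Carrier R → Set) (Den-1 : Den (CommutativeRing.1# R))
  (Den-* : ∀ {x y} → Den x → Den y → Den (CommutativeRing._*_ R x y))
  (Den⇒regular : ∀ {x} → Den x → Regularity.Regular R x) where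

  open CommutativeRing R
  open Regularity R
  open import Algebra.Properties.Ring ring using (-‿distribˡ-*)
  open import Algebra.Properties.AbelianGroup +-abelianGroup using (x∙y⁻¹≈ε⇒x≈y)
  open import Relation.Binary.Reasoning.Setoid setoid

  record Quotient : Set where
    constructor quot
    field
      num     : Carrier
      den     : Carrier
      den-Den : Den den
  open Quotient public

  infix 4 _≈ₗ_
  _≈ₗ_ : Quotient → Quotient → Set
  r ≈ₗ s = num r * den s ≈ num s * den r

  fraction : Carrier → Quotient
  fraction x = quot x 1# Den-1

  private
    module _ {n d n′ d′ : Carrier} (eq : n * d′ ≈ n′ * d) where
      +-lemma : ∀ m e m′ e′ → m * e′ ≈ m′ * e → (n * e + m * d) * (d′ * e′) ≈ (n′ * e′ + m′ * d′) * (d * e)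
      +-lemma m e m′ e′ eq′ = begin
        (n * e + m * d) * (d′ * e′)
          ≈⟨ RingSolver.solve R 6 (λ n d m e d′ e′ → (n :* e :+ m :* d) :* (d′ :* e′) := n :* d′ :* (e :* e′) :+ m :* e′ :* (d :* d′))
               refl n d m e d′ e′ ⟩
        n * d′ * (e * e′) + m * e′ * (d * d′)
          ≈⟨ +-cong (*-congʳ eq) (*-congʳ eq′) ⟩
        n′ * d * (e * e′) + m′ * e * (d * d′)
          ≈⟨ RingSolver.solve R 6 (λ n′ d m′ e d′ e′ → n′ :* d :* (e :* e′) :+ m′ :* e :* (d :* d′) := (n′ :* e′ :+ m′ :* d′) :* (d :* e))
               refl n′ d m′ e d′ e′ ⟩
        (n′ * e′ + m′ * d′) * (d * e) ∎

      *-lemma : ∀ m e m′ e′ → m * e′ ≈ m′ * e → (n * m) * (d′ * e′) ≈ (n′ * m′) * (d * e)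
      *-lemma m e m′ e′ eq′ = begin
        (n * m) * (d′ * e′)   ≈⟨ RingSolver.solve R 4 (λ n m d′ e′ → (n :* m) :* (d′ :* e′) := n :* d′ :* (m :* e′)) refl n m d′ e′ ⟩
        n * d′ * (m * e′)     ≈⟨ *-cong eq eq′ ⟩
        n′ * d * (m′ * e)     ≈⟨ RingSolver.solve R 4 (λ n′ d m′ e → n′ :* d :* (m′ :* e) := (n′ :* m′) :* (d :* e)) refl n′ d m′ e ⟩
        (n′ * m′) * (d * e)   ∎

      trans-lemma : ∀ m e → Regular d′ → n′ * e ≈ m * d′ → n * e ≈ m * d
      trans-lemma m e d′-reg eq′ = x∙y⁻¹≈ε⇒x≈y (n * e) (m * d) (cancel d′-reg _ (begin
        d′ * (n * e + - (m * d))
          ≈⟨ RingSolver.solve R 5 (λ d′ n e m d → d′ :* (n :* e :+ :- (m :* d)) := n :* d′ :* e :+ :- (m :* d′ :* d))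
               refl d′ n e m d ⟩
        n * d′ * e + - (m * d′ * d)
          ≈⟨ +-cong (*-congʳ eq) (-‿cong (*-congʳ (sym eq′))) ⟩
        n′ * d * e + - (n′ * e * d)
          ≈⟨ RingSolver.solve R 3 (λ n′ d e → n′ :* d :* e :+ :- (n′ :* e :* d) := con 0) refl n′ d e ⟩
        0# ∎))

      neg-lemma : (- n) * d′ ≈ (- n′) * d
      neg-lemma = begin
        (- n) * d′    ≈⟨ -‿distribˡ-* n d′ ⟨
        - (n * d′)    ≈⟨ -‿cong eq ⟩
        - (n′ * d)    ≈⟨ -‿distribˡ-* n′ d ⟩
        (- n′) * d    ∎

  localisation : CommutativeRing 0ℓ 0ℓ
  localisation = record
    { Carrier = Quotient
    ; _≈_ = _≈ₗ_
    ; _+_ = λ r s → quot (num r * den s + num s * den r) (den r * den s) (Den-* (den-Den r) (den-Den s))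
    ; _*_ = λ r s → quot (num r * num s) (den r * den s) (Den-* (den-Den r) (den-Den s))
    ; -_  = λ r → quot (- num r) (den r) (den-Den r)
    ; 0#  = fraction 0#
    ; 1#  = fraction 1#
    ; isCommutativeRing = record
      { isRing = record
        { +-isAbelianGroup = record
          { isGroup = record
            { isMonoid = record
              { isSemigroup = record
                { isMagma = record
                  { isEquivalence = record
                    { refl  = refl
                    ; sym   = sym
                    ; trans = λ {r} {s} {t} p q → trans-lemma p (num t) (den t) (Den⇒regular (den-Den s)) q
                    }
                  ; ∙-cong = λ {r} {r′} {s} {s′} p q → +-lemma p (num s) (den s) (num s′) (den s′) q
                  }
                ; assoc = λ r s t → RingSolver.solve R 6 (λ n d n′ d′ n″ d″ →
                    ((n :* d′ :+ n′ :* d) :* d″ :+ n″ :* (d :* d′)) :* (d :* (d′ :* d″)) :=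
                    (n :* (d′ :* d″) :+ (n′ :* d″ :+ n″ :* d′) :* d) :* (d :* d′ :* d″))
                    refl (num r) (den r) (num s) (den s) (num t) (den t)
                }
              ; identity =
                  (λ r → RingSolver.solve R 2 (λ n d → (con 0 :* d :+ n :* con 1) :* d := n :* (con 1 :* d))
                    refl (num r) (den r))
                , (λ r → RingSolver.solve R 2 (λ n d → (n :* con 1 :+ con 0 :* d) :* d := n :* (d :* con 1))
                    refl (num r) (den r))
              }
            ; inverse =
                (λ r → RingSolver.solve R 2 (λ n d → (:- n :* d :+ n :* d) :* con 1 := con 0 :* (d :* d))
                  refl (num r) (den r))
              , (λ r → RingSolver.solve R 2 (λ n d → (n :* d :+ :- n :* d) :* con 1 := con 0 :* (d :* d))
                  refl (num r) (den r))
            ; ⁻¹-cong = λ p → neg-lemma p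
            }
          ; comm = λ r s → RingSolver.solve R 4 (λ n d n′ d′ →
              (n :* d′ :+ n′ :* d) :* (d′ :* d) := (n′ :* d :+ n :* d′) :* (d :* d′))
              refl (num r) (den r) (num s) (den s)
          }
        ; *-cong     = λ {r} {r′} {s} {s′} p q → *-lemma p (num s) (den s) (num s′) (den s′) q
        ; *-assoc    = λ r s t → RingSolver.solve R 6 (λ n d n′ d′ n″ d″ →
            (n :* n′ :* n″) :* (d :* (d′ :* d″)) := (n :* (n′ :* n″)) :* (d :* d′ :* d″))
            refl (num r) (den r) (num s) (den s) (num t) (den t)
        ; *-identity =
            (λ r → RingSolver.solve R 2 (λ n d → con 1 :* n :* d := n :* (con 1 :* d)) refl (num r) (den r))
          , (λ r → RingSolver.solve R 2 (λ n d → n :* con 1 :* d := n :* (d :* con 1)) refl (num r) (den r))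
        ; distrib    =
            (λ r s t → RingSolver.solve R 6 (λ n d n′ d′ n″ d″ →
              n :* (n′ :* d″ :+ n″ :* d′) :* (d :* d′ :* (d :* d″)) :=
              (n :* n′ :* (d :* d″) :+ n :* n″ :* (d :* d′)) :* (d :* (d′ :* d″)))
              refl (num r) (den r) (num s) (den s) (num t) (den t))
          , (λ r s t → RingSolver.solve R 6 (λ n d n′ d′ n″ d″ →
              (n′ :* d″ :+ n″ :* d′) :* n :* (d′ :* d :* (d″ :* d)) :=
              (n′ :* n :* (d″ :* d) :+ n″ :* n :* (d′ :* d)) :* (d′ :* d″ :* d))
              refl (num r) (den r) (num s) (den s) (num t) (den t))
        }
      ; *-comm = λ r s → RingSolver.solve R 4 (λ n d n′ d′ → n :* n′ :* (d′ :* d) := n′ :* n :* (d :* d′))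
          refl (num r) (den r) (num s) (den s)
      }
    }

  private module L = CommutativeRing localisation

  fraction-isRingHomomorphism : IsRingHomomorphism rawRing L.rawRing fraction
  fraction-isRingHomomorphism = ringHomomorphism rawRing L.rawRing fraction
    (λ x≈y → *-congʳ x≈y)
    (λ x y → RingSolver.solve R 2 (λ x y → (x :+ y) :* (con 1 :* con 1) := (x :* con 1 :+ y :* con 1) :* con 1) refl x y)
    (λ x y → RingSolver.solve R 2 (λ x y → (x :* y) :* (con 1 :* con 1) := (x :* y) :* con 1) refl x y)
    (λ x → refl) refl refl

  ≈0⇒num≈0 : ∀ r → r ≈ₗ L.0# → num r ≈ 0#
  ≈0⇒num≈0 r r≈0 = trans (sym (*-identityʳ _)) (trans r≈0 (zeroˡ _))

  num≈0⇒≈0 : ∀ r → num r ≈ 0# → r ≈ₗ L.0#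
  num≈0⇒≈0 r n≈0 = trans (*-congʳ n≈0) (trans (zeroˡ _) (sym (zeroˡ _)))

  fraction-regular : ∀ {x} → Regular x → Regularity.Regular localisation (fraction x)
  fraction-regular {x} x-reg = Regularity.regular λ r xr≈0 →
    num≈0⇒≈0 r (cancel x-reg (num r) (≈0⇒num≈0 (fraction x L.* r) xr≈0))

  inverse : ∀ r → Den (num r) → ∃ λ s → (r L.* s) L.≈ L.1#
  inverse r n-Den = quot (den r) (num r) n-Den ,
    RingSolver.solve R 2 (λ n d → n :* d :* con 1 := con 1 :* (d :* n)) refl (num r) (den r)

-- Function fields

module FunctionFields (k : Ring) (k-isCR : IsCR k) where
  open Affine k
  open Polynomials k k-isCR

  module FunctionFieldRing {X : ClosedSubscheme} (X-var : IsVariety X) where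
    open ClosedSubscheme X
    open IsVariety X-var
    open FunctionField X-var
    open Ideals k[X n ] (kX-isCR n)
    private
      module N = CommutativeRing (kX n)
      A : CommutativeRing 0ℓ 0ℓ
      A = quotientRing equations
      open Regularity A using (Regular; regular)

    ∉I⇒regular : ∀ {d} → d ∉I → Regular d
    ∉I⇒regular d∉I = regular λ x dx≈0 → [ (λ d∈I → contradiction d∈I d∉I) , ∈⇒≈/0 equations ]′
      (prime _ x (≈/0⇒∈ equations dx≈0))

    open Localisation A _∉I 1∉I *-∉I ∉I⇒regular

    private
      module Loc = CommutativeRing localisation

      toLoc : Fraction → Quotient
      toLoc (frac n d d∉I) = quot n d d∉I

    K-isCR : IsCR K
    K-isCR = transfer-isCR K localisation toLoc
      (ringHomomorphism K Loc.rawRing toLoc id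
        (λ r s → Loc.refl {toLoc (r K.+ s)}) (λ r s → Loc.refl {toLoc (r K.* s)})
        (λ r → Loc.refl {toLoc (K.- r)}) (Loc.refl {Loc.0#}) (Loc.refl {Loc.1#}))
      id
      where module K = RawRing K

    open Wrap K public using (wrap; unwrap)

    K-ring : CommutativeRing 0ℓ 0ℓ
    K-ring = Wrap.wrappedRing K K-isCR

    private module K = CommutativeRing K-ring

    private
      fromPoly-hom : IsRingHomomorphism k[X n ] K fromPoly
      fromPoly-hom = ringHomomorphism k[X n ] K fromPoly
        (λ {x} {y} x≈y → ⟦⟧-cong {x} {y} (≈⇒≈/ equations x≈y)) +-homo *-homo -‿homo 0#-homo 1#-homo
        where open IsRingHomomorphism fraction-isRingHomomorphism

    fromPoly-isRingHomomorphism : IsRingHomomorphism k[X n ] K.rawRing fromPoly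
    fromPoly-isRingHomomorphism = Wrap.wrap-isRingHomomorphism K fromPoly-hom

    evalK-isRingHomomorphism : ∀ {m} (xs : Vec Fraction m) → IsRingHomomorphism k[X m ] K.rawRing (evalK xs)
    evalK-isRingHomomorphism xs = Wrap.wrap-isRingHomomorphism K
      (eval-isRingHomomorphism (bundle K K-isCR) (fromPoly ∘ const n)
        (∘-isRingHomomorphism (bundle K K-isCR) (const-isRingHomomorphism n) fromPoly-hom) xs)

    evalK-const : ∀ {m} (xs : Vec Fraction m) a → evalK xs (const m a) K.≈ fromPoly (const n a)
    evalK-const xs a = wrap (eval-const (bundle K K-isCR) (fromPoly ∘ const n)
      (∘-isRingHomomorphism (bundle K K-isCR) (const-isRingHomomorphism n) fromPoly-hom) xs a)

    evalK-var : ∀ {m} (xs : Vec Fraction m) i → evalK xs (var m i) K.≈ lookup xs i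
    evalK-var xs i = wrap (eval-var (bundle K K-isCR) (fromPoly ∘ const n)
      (∘-isRingHomomorphism (bundle K K-isCR) (const-isRingHomomorphism n) fromPoly-hom) xs i)

    IsZero⇒≈0 : ∀ r → IsZero r → r K.≈ K.0#
    IsZero⇒≈0 r n∈I = wrap (num≈0⇒≈0 (toLoc r) (∈⇒≈/0 equations n∈I))

    ≈0⇒IsZero : ∀ r → r K.≈ K.0# → IsZero r
    ≈0⇒IsZero r r≈0 = ≈/0⇒∈ equations (≈0⇒num≈0 (toLoc r) (unwrap r≈0))

    zero-product : ∀ r s → (r K.* s) K.≈ K.0# → IsZero r ⊎ IsZero s
    zero-product r s rs≈0 = prime (num r) (num s) (≈0⇒IsZero (r K.* s) rs≈0)

    recip : ∀ r → ¬ IsZero r → ∃ λ s → (r K.* s) K.≈ K.1#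
    recip r r≉0 = frac (den r) (num r) r≉0 , wrap (proj₂ (inverse (toLoc r) r≉0))

    ≉0⇒regular : ∀ r → ¬ IsZero r → Regularity.Regular K-ring r
    ≉0⇒regular r r≉0 = Regularity.regular λ s rs≈0 → IsZero⇒≈0 s
      ([ (λ r∈I → contradiction r∈I r≉0) , id ]′ (zero-product r s rs≈0))

    *-den : ∀ r → (r K.* fromPoly (den r)) K.≈ fromPoly (num r)
    *-den r = wrap (≈⇒≈/ equations (RingSolver.solve (kX n) 2 (λ n d → n :* d :* con 1 := n :* (d :* con 1))
      N.refl (num r) (den r)))

    -- `IsLeftInverse` compares fractions built by `divide`; their cross-multiplied equation is that
    -- of `r ≈ s * f`, rearranged.
    divide-≈ : ∀ r s f (s≉0 : ¬ IsZero s) → r K.≈ (s K.* fromPoly f) →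
      RawRing._≈_ K (divide r s s≉0) (fromPoly f)
    divide-≈ r s f s≉0 r≈sf = ∈-cong equations
      (RingSolver.solve (kX n) 5 (λ rn rd sn sd f → rn :* (sd :* con 1) :- sn :* f :* rd := rn :* sd :* con 1 :- f :* (rd :* sn))
        N.refl (num r) (den r) (num s) (den s) f)
      (unwrap r≈sf)

  -- If χ : k[Y] → B inverts the rational functions xs on Y, in the sense of
  -- sending each of them to an honest element of B, then a polynomial
  -- relation between the xs is inherited by their images.
  module Transport {Y : ClosedSubscheme} (Y-var : IsVariety Y) (B : CommutativeRing 0ℓ 0ℓ)
    {κ : ∣ k ∣ → CommutativeRing.Carrier B}
    {χ : ∣ k[X ClosedSubscheme.n Y ] ∣ → CommutativeRing.Carrier B}
    (χ-hom : IsRingHomomorphism k[X ClosedSubscheme.n Y ] (CommutativeRing.rawRing B) χ)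
    (χ-const : ∀ a → CommutativeRing._≈_ B (χ (const (ClosedSubscheme.n Y) a)) (κ a))
    (χ-vanishes : ∀ f → ClosedSubscheme._∈I Y f → CommutativeRing._≈_ B (χ f) (CommutativeRing.0# B)) where

    private module B = CommutativeRing B
    open ClosedSubscheme Y
    open FunctionField Y-var
    open Regularity B
    open IsRingHomomorphism χ-hom
    open import Relation.Binary.Reasoning.Setoid B.setoid

    -- Says that `b` is the value of `r` under `χ`. A relation spares extending `χ` to those
    -- fractions whose denominators stay regular, and regularity makes the value unique.
    record _↦_ (r : Fraction) (b : B.Carrier) : Set where
      constructor _,_
      field
        num≈den*     : χ (num r) B.≈ χ (den r) B.* b
        den-regular  : Regular (χ (den r))
    open _↦_ public

    ↦-cong : ∀ {r b b′} → b B.≈ b′ → r ↦ b → r ↦ b′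
    ↦-cong b≈b′ (p , r-reg) = B.trans p (B.*-congˡ b≈b′) , r-reg

    private
      module N = RawRing k[X n ]
      module K = RawRing K

      den-* : ∀ {r s b b′} → r ↦ b → s ↦ b′ → Regular (χ (den r N.* den s))
      den-* {r} {s} (_ , r-reg) (_ , s-reg) =
        regular-cong (B.sym (*-homo (den r) (den s))) (*-regular r-reg s-reg)
    ↦-+ : ∀ {r s b b′} → r ↦ b → s ↦ b′ → (r K.+ s) ↦ (b B.+ b′)
    ↦-+ {r} {s} {b} {b′} r↦b@(p , _) s↦b′@(q , _) = (begin
      χ (num r N.* den s N.+ num s N.* den r)
        ≈⟨ +-homo (num r N.* den s) (num s N.* den r) ⟩
      χ (num r N.* den s) B.+ χ (num s N.* den r)
        ≈⟨ B.+-cong (*-homo (num r) (den s)) (*-homo (num s) (den r)) ⟩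
      χ (num r) B.* χ (den s) B.+ χ (num s) B.* χ (den r)
        ≈⟨ B.+-cong (B.*-congʳ p) (B.*-congʳ q) ⟩
      χ (den r) B.* b B.* χ (den s) B.+ χ (den s) B.* b′ B.* χ (den r)
        ≈⟨ RingSolver.solve B 4 (λ d b d′ b′ → d :* b :* d′ :+ d′ :* b′ :* d := d :* d′ :* (b :+ b′))
             B.refl (χ (den r)) b (χ (den s)) b′ ⟩
      χ (den r) B.* χ (den s) B.* (b B.+ b′)
        ≈⟨ B.*-congʳ (*-homo (den r) (den s)) ⟨
      χ (den r N.* den s) B.* (b B.+ b′) ∎) , den-* {r} {s} r↦b s↦b′

    ↦-* : ∀ {r s b b′} → r ↦ b → s ↦ b′ → (r K.* s) ↦ (b B.* b′)
    ↦-* {r} {s} {b} {b′} r↦b@(p , _) s↦b′@(q , _) = (begin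
      χ (num r N.* num s)
        ≈⟨ *-homo (num r) (num s) ⟩
      χ (num r) B.* χ (num s)
        ≈⟨ B.*-cong p q ⟩
      χ (den r) B.* b B.* (χ (den s) B.* b′)
        ≈⟨ RingSolver.solve B 4 (λ d b d′ b′ → d :* b :* (d′ :* b′) := d :* d′ :* (b :* b′))
             B.refl (χ (den r)) b (χ (den s)) b′ ⟩
      χ (den r) B.* χ (den s) B.* (b B.* b′)
        ≈⟨ B.*-congʳ (*-homo (den r) (den s)) ⟨
      χ (den r N.* den s) B.* (b B.* b′) ∎) , den-* {r} {s} r↦b s↦b′

    ↦-neg : ∀ {r b} → r ↦ b → (K.- r) ↦ (B.- b)
    ↦-neg {r} {b} (p , r-reg) = (begin
      χ (N.- num r)             ≈⟨ -‿homo (num r) ⟩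
      B.- χ (num r)             ≈⟨ B.-‿cong p ⟩
      B.- (χ (den r) B.* b)     ≈⟨ RingSolver.solve B 2 (λ d b → :- (d :* b) := d :* :- b) B.refl (χ (den r)) b ⟩
      χ (den r) B.* (B.- b)     ∎) , r-reg

    fromPoly-↦ : ∀ {f b} → χ f B.≈ b → fromPoly f ↦ b
    fromPoly-↦ {f} {b} χf≈b =
      (begin
        χ f             ≈⟨ χf≈b ⟩
        b               ≈⟨ B.*-identityˡ b ⟨
        B.1# B.* b      ≈⟨ B.*-congʳ 1#-homo ⟨
        χ N.1# B.* b    ∎) , regular-cong (B.sym 1#-homo) 1-regular

    evalK-↦ : ∀ {m} (xs : Vec Fraction m) (bs : Vec B.Carrier m) →
      (∀ i → lookup xs i ↦ lookup bs i) → ∀ h → evalK xs h ↦ eval B.rawRing κ bs h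
    evalK-↦ = eval-related K B.rawRing _↦_
      (λ {r} {s} {b} {b′} → ↦-+ {r} {s} {b} {b′})
      (λ {r} {s} {b} {b′} → ↦-* {r} {s} {b} {b′})
      (fromPoly-↦ {N.0#} 0#-homo)
      (λ a → fromPoly-↦ {const n a} (χ-const a))

    -- The numerator of `evalK xs h` lies in the ideal of `Y`, so `χ` kills it; it is also the image
    -- of the denominator times the value of `h` at `bs`, and that image can be cancelled.
    relation-transport : ∀ {m} (xs : Vec Fraction m) (bs : Vec B.Carrier m) →
      (∀ i → lookup xs i ↦ lookup bs i) → ∀ h → IsZero (evalK xs h) → eval B.rawRing κ bs h B.≈ B.0#
    relation-transport xs bs xs↦bs h h≈0 = cancel d-reg _ (B.trans (B.sym n≈db) (χ-vanishes _ h≈0))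
      where
      n≈db = num≈den* (evalK-↦ xs bs xs↦bs h)
      d-reg = den-regular (evalK-↦ xs bs xs↦bs h)

  affine-isVariety : ∀ n → IsDecidableDomain k → IsVariety (𝔸 n)
  affine-isVariety n k-dom = record { 1∉I = 1≉0 ; prime = domain }
    where
    kX-isDecidableDomain : ∀ n → IsDecidableDomain k[X n ]
    kX-isDecidableDomain zero    = k-dom
    kX-isDecidableDomain (suc n) = poly-isDecidableDomain (kX-isCR n) (kX-isDecidableDomain n)
    open IsDecidableDomain (kX-isDecidableDomain n)

-- The change of coordinates

-- The polynomials g (cubic) and f₁ (surface), over any ring.
module Forms (R : Ring) (b c : ∣ R ∣) where
  open RawRing R
  open RawSemiringDefs rawSemiring using (_^_) renaming (_×_ to _×ᴿ_)

  cubic : Carrier → Carrier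
  cubic z = z ^ 3 + - (b * z) + - c

  surface : Carrier → Carrier → Carrier → Carrier
  surface u v w = v ^ 2 * w ^ 3 + 3 ×ᴿ (u * v * w) + u ^ 3 + - (b * u) + - v + - c

  conic : Carrier → Carrier → Carrier
  conic y t = b + - (y * y + y * t + t * t)

  -- w³ g(u − 1/w)
  cleared : Carrier → Carrier → Carrier
  cleared u w = (u * w + - 1#) ^ 3 + - (b * (u * w + - 1#) * w ^ 2) + - (c * w ^ 3)

module _ {R : Ring} (S : CommutativeRing 0ℓ 0ℓ) {φ : ∣ R ∣ → CommutativeRing.Carrier S}
  (φ-hom : IsRingHomomorphism R (CommutativeRing.rawRing S) φ) where
  private module R = RawRing R
  open CommutativeRing S
  open IsRingHomomorphism φ-hom
  private
    module RS = RawSemiringDefs R.rawSemiring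
    open RawSemiringDefs (RawRing.rawSemiring rawRing) using (_^_) renaming (_×_ to _×ᴿ_)

  ^-homo : ∀ n x → φ (x RS.^ n) ≈ φ x ^ n
  ^-homo ℕ.zero    x = 1#-homo
  ^-homo (ℕ.suc n) x = trans (*-homo x (x RS.^ n)) (*-congˡ (^-homo n x))

  ×-homo : ∀ n x → φ (n RS.× x) ≈ n ×ᴿ φ x
  ×-homo ℕ.zero    x = 0#-homo
  ×-homo (ℕ.suc n) x = trans (+-homo x (n RS.× x)) (+-congˡ (×-homo n x))

  ^-cong : ∀ n {x y} → x ≈ y → x ^ n ≈ y ^ n
  ^-cong ℕ.zero    x≈y = refl
  ^-cong (ℕ.suc n) x≈y = *-cong x≈y (^-cong n x≈y)

  sub-homo : ∀ x y {x′ y′} → φ x ≈ x′ → φ y ≈ y′ → φ (x R.+ R.- y) ≈ x′ + - y′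
  sub-homo x y φx φy = trans (+-homo x (R.- y)) (+-cong φx (trans (-‿homo y) (-‿cong φy)))

  +-homo′ : ∀ x y {x′ y′} → φ x ≈ x′ → φ y ≈ y′ → φ (x R.+ y) ≈ x′ + y′
  +-homo′ x y φx φy = trans (+-homo x y) (+-cong φx φy)

  *-homo′ : ∀ x y {x′ y′} → φ x ≈ x′ → φ y ≈ y′ → φ (x R.* y) ≈ x′ * y′
  *-homo′ x y φx φy = trans (*-homo x y) (*-cong φx φy)

  ^-homo′ : ∀ n x {x′} → φ x ≈ x′ → φ (x RS.^ n) ≈ x′ ^ n
  ^-homo′ n x φx = trans (^-homo n x) (^-cong n φx)

  module _ {b c : R.Carrier} {b′ c′ : Carrier} (φb : φ b ≈ b′) (φc : φ c ≈ c′) where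
    private
      module FR = Forms R b c
      module FS = Forms rawRing b′ c′

    cubic-homo : ∀ z {z′} → φ z ≈ z′ → φ (FR.cubic z) ≈ FS.cubic z′
    cubic-homo z φz = sub-homo _ _ (sub-homo _ _ (^-homo′ 3 z φz) (*-homo′ b z φb φz)) φc

    conic-homo : ∀ y t {y′ t′} → φ y ≈ y′ → φ t ≈ t′ → φ (FR.conic y t) ≈ FS.conic y′ t′
    conic-homo y t φy φt = sub-homo _ _ φb
      (+-homo′ _ _ (+-homo′ _ _ (*-homo′ y y φy φy) (*-homo′ y t φy φt)) (*-homo′ t t φt φt))

    surface-homo : ∀ u v w {u′ v′ w′} → φ u ≈ u′ → φ v ≈ v′ → φ w ≈ w′ →
      φ (FR.surface u v w) ≈ FS.surface u′ v′ w′
    surface-homo u v w φu φv φw =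
      sub-homo _ _ (sub-homo _ _ (sub-homo _ _ (+-homo′ _ _ (+-homo′ _ _
        (*-homo′ _ _ (^-homo′ 2 v φv) (^-homo′ 3 w φw))
        (trans (×-homo 3 _) (+-cong uvw (+-cong uvw (+-cong uvw refl)))))
        (^-homo′ 3 u φu)) (*-homo′ b u φb φu)) φv) φc
      where uvw = *-homo′ (u R.* v) w (*-homo′ u v φu φv) φw

    cleared-homo : ∀ u w {u′ w′} → φ u ≈ u′ → φ w ≈ w′ → φ (FR.cleared u w) ≈ FS.cleared u′ w′
    cleared-homo u w φu φw = sub-homo _ _ (sub-homo _ _ (^-homo′ 3 _ uw-1)
      (*-homo′ _ _ (*-homo′ b _ φb uw-1) (^-homo′ 2 w φw))) (*-homo′ c _ φc (^-homo′ 3 w φw))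
      where uw-1 = sub-homo _ _ (*-homo′ u w φu φw) 1#-homo

module Identities (R : CommutativeRing 0ℓ 0ℓ) (b c : CommutativeRing.Carrier R) where
  open CommutativeRing R
  open Forms rawRing b c public
  open import Algebra.Properties.AbelianGroup +-abelianGroup using (x∙y⁻¹≈ε⇒x≈y)
  open RawSemiringDefs (RawRing.rawSemiring rawRing) using (_^_)
  open import Relation.Binary.Reasoning.Setoid setoid

  private
    cubicₚ : ∀ {n} → Expr n → Expr n → Expr n → Expr n
    cubicₚ b c z = z :^ 3 :+ :- (b :* z) :+ :- c

    surfaceₚ : ∀ {n} (b c u v w : Expr n) → Expr n
    surfaceₚ b c u v w = v :^ 2 :* w :^ 3 :+ 3 :× (u :* v :* w) :+ u :^ 3 :+ :- (b :* u) :+ :- v :+ :- c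

    conicₚ : ∀ {n} (b y t : Expr n) → Expr n
    conicₚ b y t = b :+ :- (y :* y :+ y :* t :+ t :* t)

    clearedₚ : ∀ {n} (b c u w : Expr n) → Expr n
    clearedₚ b c u w =
      (u :* w :+ :- con 1) :^ 3 :+ :- (b :* (u :* w :+ :- con 1) :* w :^ 2) :+ :- (c :* w :^ 3)

    sub-zero : ∀ {x y} → x + - y ≈ 0# → x ≈ y
    sub-zero = x∙y⁻¹≈ε⇒x≈y _ _

    unit-sub : ∀ {x} → x ≈ 1# → x + - 1# ≈ 0#
    unit-sub x≈1 = trans (+-congʳ x≈1) (-‿inverseʳ 1#)

  cleared-cubic : ∀ u w a → w * a ≈ 1# → cleared u w ≈ w ^ 3 * cubic (u + - a)
  cleared-cubic u w a wa≈1 = begin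
    cleared u w
      ≈⟨ RingSolver.solve R 4 (λ b c u w → clearedₚ b c u w :=
           (u :* w :- con 1) :^ 3 :- b :* (u :* w :- con 1) :* w :^ 2 :- c :* w :^ 3)
           refl b c u w ⟩
    (u * w + - 1#) ^ 3 + - (b * (u * w + - 1#) * w ^ 2) + - (c * w ^ 3)
      ≈⟨ +-congʳ (+-cong (^3-cong s≈) (-‿cong (*-congʳ (*-congˡ s≈)))) ⟩
    (w * (u + - a)) ^ 3 + - (b * (w * (u + - a)) * w ^ 2) + - (c * w ^ 3)
      ≈⟨ RingSolver.solve R 4 (λ b c t w → (w :* t) :^ 3 :+ :- (b :* (w :* t) :* w :^ 2) :+ :- (c :* w :^ 3) :=
           w :^ 3 :* cubicₚ b c t) refl b c (u + - a) w ⟩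
    w ^ 3 * cubic (u + - a) ∎
    where
    ^3-cong : ∀ {x y} → x ≈ y → x ^ 3 ≈ y ^ 3
    ^3-cong x≈y = *-cong x≈y (*-cong x≈y (*-congʳ x≈y))
    s≈ : u * w + - 1# ≈ w * (u + - a)
    s≈ = begin
      u * w + - 1#         ≈⟨ +-congˡ (-‿cong wa≈1) ⟨
      u * w + - (w * a)    ≈⟨ RingSolver.solve R 3 (λ u w a → u :* w :+ :- (w :* a) := w :* (u :+ :- a)) refl u w a ⟩
      w * (u + - a)        ∎

  -- The conic is the negated divided difference of the cubic: (y - t) D = g(t) - g(y).
  conic-cubic : ∀ y t → (y + - t) * conic y t + - cubic t ≈ - cubic y
  conic-cubic y t = RingSolver.solve R 4 (λ b c y t →
    (y :+ :- t) :* conicₚ b y t :+ :- cubicₚ b c t := :- cubicₚ b c y) refl b c y t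

  module ToPlane (u v w a : Carrier) (wa≈1 : w * a ≈ 1#) (on-surface : surface u v w ≈ 0#) where
    y t D γ : Carrier
    y = u + v * w ^ 2
    t = u + - a
    D = conic y t
    γ = cubic t

    D≈wγ : D ≈ w * γ
    D≈wγ = sub-zero (begin
      D + - (w * γ)
        -- D - wγ lies in the ideal generated by `wa − 1` and the equation of the surface; the long
        -- factor is the exact quotient of D - wγ + w f₁ by `wa − 1`.
        ≈⟨ RingSolver.solve R 6 (λ b c u v w a → let t = u :+ :- a ; y = u :+ v :* w :^ 2 in
             conicₚ b y t :+ :- (w :* cubicₚ b c t) :=
             (w :* a :- con 1) :* (w :* v :+ (3 :× (t :* t) :- b :+ 3 :× (t :* a) :+ a :* a))
               :+ :- (w :* surfaceₚ b c u v w)) refl b c u v w a ⟩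
      (w * a + - 1#) * _ + - (w * surface u v w)
        ≈⟨ +-cong (*-congʳ (unit-sub wa≈1)) (-‿cong (*-congˡ on-surface)) ⟩
      0# * _ + - (w * 0#)
        ≈⟨ RingSolver.solve R 2 (λ x w → con 0 :* x :+ :- (w :* con 0) := con 0) refl _ w ⟩
      0# ∎)

    u-from-yt : t * D + γ ≈ D * u
    u-from-yt = begin
      t * D + γ              ≈⟨ RingSolver.solve R 4 (λ u a D γ → (u :+ :- a) :* D :+ γ := D :* u :+ (γ :- a :* D)) refl u a D γ ⟩
      D * u + (γ + - (a * D))        ≈⟨ +-congˡ (+-congˡ (-‿cong (*-congˡ D≈wγ))) ⟩
      D * u + (γ + - (a * (w * γ)))  ≈⟨ RingSolver.solve R 4 (λ x γ a w → x :+ (γ :+ :- (a :* (w :* γ))) := x :+ :- ((w :* a :- con 1) :* γ)) refl (D * u) γ a w ⟩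
      D * u + - ((w * a + - 1#) * γ) ≈⟨ +-congˡ (-‿cong (*-congʳ (unit-sub wa≈1))) ⟩
      D * u + - (0# * γ)             ≈⟨ RingSolver.solve R 2 (λ x γ → x :+ :- (con 0 :* γ) := x) refl (D * u) γ ⟩
      D * u ∎

    -- By `conic-cubic` and `u-from-yt`, -g(y) is (y - u) D = v w² D, and the factor γ² turns w²
    -- into D².
    v-from-yt : - cubic y * γ ^ 2 ≈ D ^ 3 * v
    v-from-yt = begin
      - cubic y * γ ^ 2
        ≈⟨ *-congʳ (conic-cubic y t) ⟨
      ((y + - t) * D + - γ) * γ ^ 2
        ≈⟨ RingSolver.solve R 4 (λ y t D γ → ((y :+ :- t) :* D :+ :- γ) :* γ :^ 2 := (y :* D :+ :- (t :* D :+ γ)) :* γ :^ 2) refl y t D γ ⟩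
      (y * D + - (t * D + γ)) * γ ^ 2
        ≈⟨ *-congʳ (+-congˡ (-‿cong u-from-yt)) ⟩
      ((u + v * w ^ 2) * D + - (D * u)) * γ ^ 2
        ≈⟨ RingSolver.solve R 5 (λ u v w D γ → ((u :+ v :* w :^ 2) :* D :+ :- (D :* u)) :* γ :^ 2 := D :* ((w :* γ) :* ((w :* γ) :* v))) refl u v w D γ ⟩
      D * ((w * γ) * ((w * γ) * v))
        ≈⟨ *-congˡ (*-cong (sym D≈wγ) (*-congʳ (sym D≈wγ))) ⟩
      D * (D * (D * v))
        ≈⟨ RingSolver.solve R 2 (λ D v → D :* (D :* (D :* v)) := D :^ 3 :* v) refl D v ⟩
      D ^ 3 * v ∎

  -- The coordinates enter through equations without denominators, because these hold alike for the
  -- fractions in the function field of the plane and for elements of the finite field. The private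
  -- `a = γ δ` plays the role of 1/w.
  module FromPlane (y t : Carrier) {u v w δ : Carrier}
    (u-eq : u * conic y t ≈ t * conic y t + cubic t)
    (v-eq : v * conic y t ^ 3 ≈ - cubic y * cubic t ^ 2)
    (w-eq : w * cubic t ≈ conic y t)
    (Dδ≈1 : conic y t * δ ≈ 1#) where
    private
      D γ a : Carrier
      D = conic y t
      γ = cubic t
      a = γ * δ

      scaled : ∀ x z → x * D ≈ z → x ≈ z * δ
      scaled x z xD≈z = begin
        x              ≈⟨ *-identityʳ x ⟨
        x * 1#         ≈⟨ *-congˡ Dδ≈1 ⟨
        x * (D * δ)    ≈⟨ *-assoc x D δ ⟨
        x * D * δ      ≈⟨ *-congʳ xD≈z ⟩
        z * δ          ∎

      wa≈1 : w * a ≈ 1#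
      wa≈1 = trans (sym (*-assoc w γ δ)) (trans (*-congʳ w-eq) Dδ≈1)

      u≈t+a : u ≈ t + a
      u≈t+a = begin
        u                     ≈⟨ scaled u (t * D + γ) u-eq ⟩
        (t * D + γ) * δ       ≈⟨ RingSolver.solve R 4 (λ t D γ δ → (t :* D :+ γ) :* δ := t :* (D :* δ) :+ γ :* δ) refl t D γ δ ⟩
        t * (D * δ) + γ * δ   ≈⟨ +-congʳ (*-congˡ Dδ≈1) ⟩
        t * 1# + γ * δ        ≈⟨ +-congʳ (*-identityʳ t) ⟩
        t + a                 ∎

      v≈ : v ≈ (y + - (t + a)) * a ^ 2
      v≈ = begin
        v                                   ≈⟨ scaled v _ (scaled (v * D) _ (scaled (v * D * D) _
                                                 (trans (RingSolver.solve R 2 (λ v D → v :* D :* D :* D := v :* D :^ 3) refl v D) v-eq))) ⟩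
        - cubic y * γ ^ 2 * δ * δ * δ       ≈⟨ *-congʳ (*-congʳ (*-congʳ (*-congʳ (conic-cubic y t)))) ⟨
        ((y + - t) * D + - γ) * γ ^ 2 * δ * δ * δ
          ≈⟨ RingSolver.solve R 5 (λ y t D γ δ → ((y :+ :- t) :* D :+ :- γ) :* γ :^ 2 :* δ :* δ :* δ :=
               ((y :+ :- t) :* (D :* δ) :+ :- (γ :* δ)) :* (γ :* δ) :^ 2) refl y t D γ δ ⟩
        ((y + - t) * (D * δ) + - a) * a ^ 2 ≈⟨ *-congʳ (+-congʳ (*-congˡ Dδ≈1)) ⟩
        ((y + - t) * 1# + - a) * a ^ 2      ≈⟨ RingSolver.solve R 3 (λ y t a → ((y :+ :- t) :* con 1 :+ :- a) :* a :^ 2 := (y :+ :- (t :+ a)) :* a :^ 2) refl y t a ⟩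
        (y + - (t + a)) * a ^ 2             ∎

    t-from-uvw : u * w + - 1# ≈ w * t
    t-from-uvw = begin
      u * w + - 1#                ≈⟨ +-cong (*-congʳ u≈t+a) (-‿cong (sym wa≈1)) ⟩
      (t + a) * w + - (w * a)     ≈⟨ RingSolver.solve R 3 (λ t a w → (t :+ a) :* w :+ :- (w :* a) := w :* t) refl t a w ⟩
      w * t                       ∎

    y-from-uvw : u + v * w ^ 2 ≈ y
    y-from-uvw = begin
      u + v * w ^ 2                                           ≈⟨ +-cong u≈t+a (*-congʳ v≈) ⟩
      t + a + (y + - (t + a)) * a ^ 2 * w ^ 2
        ≈⟨ RingSolver.solve R 4 (λ y t a w → t :+ a :+ (y :+ :- (t :+ a)) :* a :^ 2 :* w :^ 2 :=
             y :+ (w :* a :- con 1) :* ((w :* a :+ con 1) :* (y :- (t :+ a)))) refl y t a w ⟩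
      y + (w * a + - 1#) * ((w * a + 1#) * (y + - (t + a)))   ≈⟨ +-congˡ (*-congʳ (unit-sub wa≈1)) ⟩
      y + 0# * ((w * a + 1#) * (y + - (t + a)))               ≈⟨ +-congˡ (zeroˡ _) ⟩
      y + 0#                                                  ≈⟨ +-identityʳ y ⟩
      y                                                       ∎

    on-surface : surface u v w ≈ 0#
    on-surface = begin
      surface u v w
        ≈⟨ surface-homo R id-hom refl refl u v w u≈t+a v≈ refl ⟩
      surface (t + a) (e * a ^ 2) w
        -- In terms of `t`, `a` and `e = y − u` the equation is g(t) - aD up to a multiple of
        -- `wa − 1`.
        ≈⟨ RingSolver.solve R 6 (λ b c y t a w → let e = y :+ :- (t :+ a) in
             surfaceₚ b c (t :+ a) (e :* a :^ 2) w :=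
             (w :* a :- con 1) :* (e :^ 2 :* a :* (w :^ 2 :* a :^ 2 :+ w :* a :+ con 1) :+ 3 :× ((t :+ a) :* e :* a))
               :+ (cubicₚ b c t :+ :- (a :* conicₚ b y t))) refl b c y t a w ⟩
      (w * a + - 1#) * _ + (γ + - (a * D))
        ≈⟨ +-cong (*-congʳ (unit-sub wa≈1)) (+-congˡ (-‿cong aD≈γ)) ⟩
      0# * _ + (γ + - γ)
        ≈⟨ +-cong (zeroˡ _) (-‿inverseʳ γ) ⟩
      0# + 0#
        ≈⟨ +-identityʳ 0# ⟩
      0# ∎
      where
      e : Carrier
      e = y + - (t + a)
      aD≈γ : a * D ≈ γ
      aD≈γ = begin
        γ * δ * D    ≈⟨ RingSolver.solve R 3 (λ γ δ D → γ :* δ :* D := γ :* (D :* δ)) refl γ δ D ⟩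
        γ * (D * δ)  ≈⟨ *-congˡ Dδ≈1 ⟩
        γ * 1#       ≈⟨ *-identityʳ γ ⟩
        γ            ∎
      id-hom : IsRingHomomorphism rawRing rawRing id
      id-hom = ringHomomorphism rawRing rawRing id id (λ _ _ → refl) (λ _ _ → refl) (λ _ → refl) refl refl

-- Regular elements modulo f₁

module Monic (R : Ring) (isCR : IsCR R) where
  open CommutativeRing (bundle R isCR)
  open PolyRing R isCR
  open import Relation.Binary.Reasoning.Setoid setoid
  private module P = CommutativeRing polyRing

  -- The degree is given separately from the length of the list, which may have trailing zeros.
  record IsMonic (f : List Carrier) : Set where
    field
      degree  : ℕ
      leading : coeff R f degree ≈ 1#
      above   : ∀ {i} → degree ℕ.< i → coeff R f i ≈ 0#

  module _ (e : Carrier) where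
    Multiple : Carrier → Set
    Multiple x = ∃ λ z → x ≈ e * z

    private
      multiple-diff : ∀ {x y z} → Multiple x → Multiple y → x ≈ z + y → Multiple z
      multiple-diff {x} {y} {z} (p , x≈ep) (q , y≈eq) x≈z+y = p + - q , (begin
        z                     ≈⟨ RingSolver.solve (bundle R isCR) 2 (λ z y → z := z :+ y :- y) refl z y ⟩
        z + y + - y           ≈⟨ +-cong (trans (sym x≈z+y) x≈ep) (-‿cong y≈eq) ⟩
        e * p + - (e * q)     ≈⟨ RingSolver.solve (bundle R isCR) 3 (λ e p q → e :* p :+ :- (e :* q) := e :* (p :+ :- q)) refl e p q ⟩
        e * (p + - q)         ∎)

    multiples⇒scale : ∀ f → (∀ i → Multiple (coeff R f i)) → ∃ λ h → f ≈ₚ scale e h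
    multiples⇒scale []      _ = [] , P.refl
    multiples⇒scale (a ∷ f) m with m 0 | multiples⇒scale f (m ∘ suc)
    ... | z , a≈ez | h , f≈eh = z ∷ h , ∷-cong a≈ez f≈eh

    *-scale : ∀ f h → f P.* scale e h ≈ₚ scale e (f P.* h)
    *-scale f h = P.trans (P.*-comm f (scale e h)) (P.trans (scale-*ₚ e h f) (scale-cong refl (P.*-comm h f)))

    module _ {f : List Carrier} (f-monic : IsMonic f) where
      open IsMonic f-monic

      -- For the induction the product is accompanied by the carry r, of
      -- degree at most that of f.
      private
        carry : ∀ r q → (∀ {i} → degree ℕ.< i → coeff R r i ≈ 0#) →
          (∀ i → Multiple (coeff R (r P.+ shift (f P.* q)) i)) → ∀ i → Multiple (coeff R q i)
        carry r []      r-above m i = 0# , sym (zeroʳ e)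
        carry r (b ∷ q) r-above m = λ { zero → b-multiple ; (suc i) → q-multiple i }
          where
          r₁ : List Carrier → List Carrier
          r₁ []      = []
          r₁ (_ ∷ r) = r

          r₁-coeff : ∀ r i → coeff R (r₁ r) i ≈ coeff R r (suc i)
          r₁-coeff []      i = refl
          r₁-coeff (_ ∷ r) i = refl

          r′ : List Carrier
          r′ = r₁ r P.+ scale b f

          expand : ∀ i → coeff R (r P.+ shift (f P.* (b ∷ q))) (suc i) ≈ coeff R (r′ P.+ shift (f P.* q)) i
          expand i = begin
            coeff R (r P.+ shift (f P.* (b ∷ q))) (suc i)
              ≈⟨ coeff-+ r (shift (f P.* (b ∷ q))) (suc i) ⟩
            coeff R r (suc i) + coeff R (f P.* (b ∷ q)) i
              ≈⟨ +-cong (sym (r₁-coeff r i)) (at (*ₚ-∷ f b q) i) ⟩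
            coeff R (r₁ r) i + coeff R (scale b f P.+ shift (f P.* q)) i
              ≈⟨ coeff-+ (r₁ r) (scale b f P.+ shift (f P.* q)) i ⟨
            coeff R (r₁ r P.+ (scale b f P.+ shift (f P.* q))) i
              ≈⟨ at (P.+-assoc (r₁ r) (scale b f) (shift (f P.* q))) i ⟨
            coeff R (r′ P.+ shift (f P.* q)) i ∎

          m′ : ∀ i → Multiple (coeff R (r′ P.+ shift (f P.* q)) i)
          m′ i = proj₁ (m (suc i)) , trans (sym (expand i)) (proj₂ (m (suc i)))

          r′-coeff : ∀ i → coeff R r′ i ≈ coeff R r (suc i) + b * coeff R f i
          r′-coeff i = trans (coeff-+ (r₁ r) (scale b f) i) (+-cong (r₁-coeff r i) (coeff-scale b f i))

          -- The higher coefficients come first: the contribution `scale b f` of the lowest one goes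
          -- into the new carry, whose degree is again at most that of `f`.
          q-multiple : ∀ i → Multiple (coeff R q i)
          q-multiple = carry r′ q (λ {i} d<i → begin
            coeff R r′ i                      ≈⟨ r′-coeff i ⟩
            coeff R r (suc i) + b * coeff R f i ≈⟨ +-cong (r-above (ℕₚ.m<n⇒m<1+n d<i)) (*-congˡ (above d<i)) ⟩
            0# + b * 0#                       ≈⟨ trans (+-identityˡ _) (zeroʳ b) ⟩
            0#                                ∎) m′

          fq-multiple : ∀ i → Multiple (coeff R (shift (f P.* q)) i)
          fq-multiple i with multiples⇒scale q q-multiple
          ... | h , q≈eh = coeff R (shift (f P.* h)) i , (begin
            coeff R (shift (f P.* q)) i          ≈⟨ at (shift-cong (P.trans (*ₚ-congˡ f q≈eh) (*-scale f h))) i ⟩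
            coeff R (shift (scale e (f P.* h))) i ≈⟨ at (scale-shift e (f P.* h)) i ⟨
            coeff R (scale e (shift (f P.* h))) i ≈⟨ coeff-scale e (shift (f P.* h)) i ⟩
            e * coeff R (shift (f P.* h)) i      ∎)

          -- In position `degree` the new carry is exactly `b`, as `f` is monic and `r` vanishes
          -- above; everything else in that position is already known to be a multiple of `e`.
          b-multiple : Multiple b
          b-multiple = multiple-diff (m′ degree) (fq-multiple degree) (begin
            coeff R (r′ P.+ shift (f P.* q)) degree
              ≈⟨ coeff-+ r′ (shift (f P.* q)) degree ⟩
            coeff R r′ degree + coeff R (shift (f P.* q)) degree
              ≈⟨ +-congʳ (r′-coeff degree) ⟩
            coeff R r (suc degree) + b * coeff R f degree + coeff R (shift (f P.* q)) degree
              ≈⟨ +-congʳ (+-cong (r-above (ℕₚ.n<1+n degree)) (*-congˡ leading)) ⟩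
            0# + b * 1# + coeff R (shift (f P.* q)) degree
              ≈⟨ +-congʳ (trans (+-identityˡ _) (*-identityʳ b)) ⟩
            b + coeff R (shift (f P.* q)) degree ∎)

      -- Uniqueness of division by the monic polynomial X f modulo `e`: its product with `q` can
      -- cancel the remainder `r`, of smaller degree, only if `q` vanishes modulo `e`.
      monic-*-multiple : ∀ r q → (∀ {i} → degree ℕ.< i → coeff R r i ≈ 0#) →
        (∀ i → Multiple (coeff R (r P.+ shift (f P.* q)) i)) → ∃ λ h → q ≈ₚ scale e h
      monic-*-multiple r q r-above m = multiples⇒scale q (carry r q r-above m)

    -- Modulo `e` the multiple `s f` is the monic `M`, so `f q ≡ 0` gives `M q ≡ 0` and hence
    -- `q ≡ 0`.
    regular-mod : ∀ f s r {M} → IsMonic M → s P.* f ≈ₚ M P.+ scale e r →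
      ∀ q h → f P.* q ≈ₚ scale e h → ∃ λ q′ → q ≈ₚ scale e q′
    regular-mod f s r {M} M-monic sf≈ q h fq≈eh =
      monic-*-multiple M-monic [] q (λ _ → refl) multiple
      where
      [e] : List Carrier
      [e] = e ∷ []
      [e]* : ∀ f → [e] P.* f ≈ₚ scale e f
      [e]* f = P.trans (P.+-congˡ shift-zero) (P.+-identityʳ (scale e f))
      multiple : ∀ i → Multiple (coeff R (shift (M P.* q)) i)

      Mq≈ : M P.* q ≈ₚ scale e (s P.* h P.+ P.- (r P.* q))
      Mq≈ = P.trans (solveM M ([e] P.* r) q) (P.trans
        (P.+-congʳ (P.trans
          (P.*-congʳ (P.trans (P.+-congˡ ([e]* r)) (P.sym sf≈)))
          (P.trans (P.*-assoc s f q) (P.*-congˡ {s} (P.trans fq≈eh (P.sym ([e]* h)))))))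
        (P.trans (solveE s [e] h r q) ([e]* (s P.* h P.+ P.- (r P.* q)))))
        where
        solveM : ∀ M x q → M P.* q ≈ₚ (M P.+ x) P.* q P.+ P.- (x P.* q)
        solveM = RingSolver.solve polyRing 3 (λ M x q → M :* q := (M :+ x) :* q :+ :- (x :* q)) P.refl
        solveE : ∀ s e h r q → s P.* (e P.* h) P.+ P.- (e P.* r P.* q) ≈ₚ e P.* (s P.* h P.+ P.- (r P.* q))
        solveE = RingSolver.solve polyRing 5 (λ s e h r q → s :* (e :* h) :+ :- (e :* r :* q) :=
          e :* (s :* h :+ :- (r :* q))) P.refl

      multiple zero    = 0# , sym (zeroʳ e)
      multiple (suc i) = coeff R (s P.* h P.+ P.- (r P.* q)) i ,
        trans (at Mq≈ i) (coeff-scale e (s P.* h P.+ P.- (r P.* q)) i)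

    -- Exchanging the two members of a regular sequence: `f q = e h` makes `q` divisible by `e`,
    -- since `f` is regular modulo `e`, and cancelling `e` makes `h` divisible by `f`. So `e` is
    -- regular modulo `f`.
    regular-exchange : Regularity.Regular (bundle R isCR) e →
      ∀ f s r {M} → IsMonic M → s P.* f ≈ₚ M P.+ scale e r →
      ∀ q h → f P.* q ≈ₚ scale e h → ∃ λ q′ → h ≈ₚ f P.* q′
    regular-exchange e-regular f s r M-monic sf≈ q h fq≈eh with regular-mod f s r M-monic sf≈ q h fq≈eh
    ... | q′ , q≈eq′ = q′ , pointwise λ i → x∙y⁻¹≈ε⇒x≈y _ _ (Regularity.cancel e-regular _ (begin
      e * (coeff R h i + - coeff R (f P.* q′) i)
        ≈⟨ RingSolver.solve (bundle R isCR) 3 (λ e x y → e :* (x :+ :- y) := e :* x :+ :- (e :* y)) refl e (coeff R h i) (coeff R (f P.* q′) i) ⟩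
      e * coeff R h i + - (e * coeff R (f P.* q′) i)
        ≈⟨ +-cong (coeff-scale e h i) (-‿cong (coeff-scale e (f P.* q′) i)) ⟨
      coeff R (scale e h) i + - coeff R (scale e (f P.* q′)) i
        ≈⟨ +-congʳ (at (P.sym fq≈eh) i) ⟩
      coeff R (f P.* q) i + - coeff R (scale e (f P.* q′)) i
        ≈⟨ +-congˡ (-‿cong (at (P.trans (P.sym (*-scale f q′)) (*ₚ-congˡ f (P.sym q≈eq′))) i)) ⟩
      coeff R (f P.* q) i + - coeff R (f P.* q) i
        ≈⟨ -‿inverseʳ _ ⟩
      0# ∎))
      where open import Algebra.Properties.AbelianGroup +-abelianGroup using (x∙y⁻¹≈ε⇒x≈y)

QuotientRegular : (R : Ring) → IsCR R → ∣ R ∣ → ∣ R ∣ → Set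
QuotientRegular R isCR f = Regularity.Regular (Ideals.quotientRing R isCR (f ∷ []))

module _ (R : Ring) (isCR : IsCR R) where
  open CommutativeRing (bundle R isCR)
  open import Relation.Binary.Reasoning.Setoid setoid
  open import Algebra.Properties.AbelianGroup +-abelianGroup using (x∙y⁻¹≈ε⇒x≈y)

  quotient-regular : ∀ {f e} → (∀ q h → f * q ≈ e * h → ∃ λ q′ → h ≈ f * q′) → QuotientRegular R isCR f e
  quotient-regular {f} {e} exchange = Regularity.regular λ x (q , ex≈qf) → reduce x q ex≈qf
    where
    reduce : ∀ x q → e * x + - 0# + - (q * f) ≈ 0# → ∃ λ q → x + - 0# + - (q * f) ≈ 0#
    reduce x q ex≈qf = proj₁ quotient , trans (+-congʳ (+-congʳ (proj₂ quotient)))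
      (RingSolver.solve (bundle R isCR) 2 (λ f q → f :* q :+ :- con 0 :+ :- (q :* f) := con 0) refl f (proj₁ quotient))
      where
      quotient : ∃ λ q′ → x ≈ f * q′
      quotient = exchange q x (sym (x∙y⁻¹≈ε⇒x≈y (e * x) (f * q) (trans
        (RingSolver.solve (bundle R isCR) 4 (λ e x f q → e :* x :+ :- (f :* q) := e :* x :+ :- con 0 :+ :- (q :* f)) refl e x f q) ex≈qf)))

  -- The involution induces an isomorphism between the quotients by `f` and by `f′` that matches `e`
  -- with `e′`.
  involution-regular : ∀ {σ} → IsRingHomomorphism R R σ → (∀ x → σ (σ x) ≈ x) →
    ∀ {f f′ e e′} → σ f ≈ f′ → σ e ≈ e′ → QuotientRegular R isCR f′ e′ → QuotientRegular R isCR f e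
  involution-regular {σ} σ-hom σσ {f} {f′} {e} {e′} σf σe e′-regular = Regularity.regular λ x (q , ex≈qf) → back x (Regularity.cancel e′-regular (σ x) (σ q , (begin
    e′ * σ x + - 0# + - (σ q * f′)
      ≈⟨ +-cong (+-cong (*-congʳ (sym σe)) (-‿cong (sym 0#-homo))) (-‿cong (*-congˡ (sym σf))) ⟩
    σ e * σ x + - σ 0# + - (σ q * σ f)
      ≈⟨ +-cong (+-cong (sym (*-homo e x)) (sym (-‿homo 0#))) (-‿cong (sym (*-homo q f))) ⟩
    σ (e * x) + σ (- 0#) + - σ (q * f)
      ≈⟨ +-cong (sym (+-homo (e * x) (- 0#))) (sym (-‿homo (q * f))) ⟩
    σ (e * x + - 0#) + σ (- (q * f))
      ≈⟨ +-homo (e * x + - 0#) (- (q * f)) ⟨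
    σ (e * x + - 0# + - (q * f))
      ≈⟨ ⟦⟧-cong ex≈qf ⟩
    σ 0#
      ≈⟨ 0#-homo ⟩
    0# ∎)))
    where
    open IsRingHomomorphism σ-hom
    σf′≈f : σ f′ ≈ f
    σf′≈f = trans (⟦⟧-cong (sym σf)) (σσ f)
    back : ∀ x → (∃ λ q → σ x + - 0# + - (q * f′) ≈ 0#) → ∃ λ q → x + - 0# + - (q * f) ≈ 0#
    back x (q , σx≈qf′) = σ q , (begin
      x + - 0# + - (σ q * f)
        ≈⟨ +-cong (+-cong (sym (σσ x)) (-‿cong (sym 0#-homo))) (-‿cong (*-congˡ (sym σf′≈f))) ⟩
      σ (σ x) + - σ 0# + - (σ q * σ f′)
        ≈⟨ +-cong (+-congˡ (sym (-‿homo 0#))) (-‿cong (sym (*-homo q f′))) ⟩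
      σ (σ x) + σ (- 0#) + - σ (q * f′)
        ≈⟨ +-cong (sym (+-homo (σ x) (- 0#))) (sym (-‿homo (q * f′))) ⟩
      σ (σ x + - 0#) + σ (- (q * f′))
        ≈⟨ +-homo (σ x + - 0#) (- (q * f′)) ⟨
      σ (σ x + - 0# + - (q * f′))
        ≈⟨ ⟦⟧-cong σx≈qf′ ⟩
      σ 0#
        ≈⟨ 0#-homo ⟩
      0# ∎)

-- As a polynomial in v the equation f₁ is −v + … modulo w and, w being
-- invertible modulo cleared u w, also proportional to a monic quadratic
-- modulo the latter.
module SurfaceRegularity (R : Ring) (isCR : IsCR R) (b c u w : ∣ R ∣) where
  open CommutativeRing (bundle R isCR)
  open PolyRing R isCR
  open Monic R isCR
  private
    module P = CommutativeRing polyRing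
    ν-hom : IsRingHomomorphism R P.rawRing (_∷ [])
    ν-hom = constant-polyRing-isRingHomomorphism R isCR
    module ν = IsRingHomomorphism ν-hom

    B C U W V : List Carrier
    B = b ∷ []
    C = c ∷ []
    U = u ∷ []
    W = w ∷ []
    V = 0# ∷ 1# ∷ []

  open Forms R b c using (cubic; cleared)
  open Forms P.rawRing B C using (surface) renaming (cubic to cubicᵛ)
  open import Relation.Binary.Reasoning.Setoid P.setoid
  private
    module RD = RawSemiringDefs (RawRing.rawSemiring R)
  open RawSemiringDefs (RawRing.rawSemiring P.rawRing) using () renaming (_^_ to _^ᵛ_; _×_ to _×ᵛ_)

  private
    ν-cubic : cubic u ∷ [] ≈ₚ cubicᵛ U
    ν-cubic = cubic-homo polyRing ν-hom P.refl P.refl u P.refl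

    ν* : ∀ e f → (e ∷ []) P.* f ≈ₚ scale e f
    ν* e f = P.trans (P.+-congˡ {scale e f} shift-zero) (P.+-identityʳ (scale e f))

    V-expand : ∀ a f → a ∷ f ≈ₚ (a ∷ []) P.+ V P.* f
    V-expand a f = P.sym (constant-+-X* R isCR a f)

  surfaceᵛ : List Carrier
  surfaceᵛ = surface U V W

  W-regular : Regularity.Regular (bundle R isCR) w → QuotientRegular (Poly R) (poly-isCR isCR) surfaceᵛ W
  W-regular w-regular = quotient-regular (Poly R) (poly-isCR isCR) {surfaceᵛ} {W} λ q h fq≈Wh →
    let q′ , h≈fq′ = regular-exchange w w-regular surfaceᵛ (P.- P.1#) r M-monic equation q h
                       (P.trans (pointwise fq≈Wh) (ν* w h))
    in q′ , at h≈fq′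
    where
    r M : List Carrier
    r = P.- (3 ×ᵛ (U P.* V)) P.+ P.- (V ^ᵛ 2 P.* W ^ᵛ 2)
    M = - cubic u ∷ 1# ∷ []
    M-monic : IsMonic M
    M-monic = record { degree = 1 ; leading = refl ; above = λ { (ℕ.s≤s (ℕ.s≤s _)) → refl } }
    equation : P.- P.1# P.* surfaceᵛ ≈ₚ M P.+ scale w r
    equation = begin
      P.- P.1# P.* surfaceᵛ
        ≈⟨ RingSolver.solve polyRing 5 (λ b c u v w →
             :- con 1 :* (v :^ 2 :* w :^ 3 :+ 3 :× (u :* v :* w) :+ u :^ 3 :+ :- (b :* u) :+ :- v :+ :- c) :=
             (:- (u :^ 3 :+ :- (b :* u) :+ :- c) :+ v :* con 1) :+ w :* (:- (3 :× (u :* v)) :+ :- (v :^ 2 :* w :^ 2)))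
             P.refl B C U V W ⟩
      (P.- cubicᵛ U P.+ V P.* P.1#) P.+ W P.* r
        ≈⟨ P.+-cong (P.+-congʳ {V P.* P.1#} (P.-‿cong (P.sym ν-cubic))) (ν* w r) ⟩
      ((- cubic u ∷ []) P.+ V P.* P.1#) P.+ scale w r
        ≈⟨ P.+-congʳ {scale w r} (V-expand (- cubic u) P.1#) ⟨
      M P.+ scale w r ∎

  cleared-regular : Regularity.Regular (bundle R isCR) (cleared u w) →
    QuotientRegular (Poly R) (poly-isCR isCR) surfaceᵛ (cleared u w ∷ [])
  cleared-regular e-regular = quotient-regular (Poly R) (poly-isCR isCR) {surfaceᵛ} {E} λ q h fq≈eh →
    let q′ , h≈fq′ = regular-exchange e e-regular surfaceᵛ (Π ^ᵛ 3) r M-monic equation q h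
                       (P.trans (pointwise fq≈eh) (ν* e h))
    in q′ , at h≈fq′
    where
    open RD using (_^_)
    e π : Carrier
    e = cleared u w
    -- `cleared u w` has constant term -1 as a polynomial in `w`, so 1 + e is divisible by `w`; the
    -- quotient is an inverse of `w` modulo `e`.
    π = (u ^ 3 * w ^ 2 + - (3 RD.× (u ^ 2 * w)) + 3 RD.× u) + - (b * (u * w + - 1#) * w) + - (c * w ^ 2)

    wπ≈1+e : w * π ≈ 1# + e
    wπ≈1+e = RingSolver.solve (bundle R isCR) 4 (λ b c u w →
      w :* ((u :^ 3 :* w :^ 2 :+ :- (3 :× (u :^ 2 :* w)) :+ 3 :× u)
        :+ :- (b :* (u :* w :+ :- con 1) :* w) :+ :- (c :* w :^ 2)) :=
      con 1 :+ ((u :* w :+ :- con 1) :^ 3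
        :+ :- (b :* (u :* w :+ :- con 1) :* w :^ 2) :+ :- (c :* w :^ 3)))
      refl b c u w

    Π E r M : List Carrier
    Π = π ∷ []
    E = e ∷ []
    -- The leading coefficient w³π³ is (1 + e)³ = 1 + e (3 + 3e + e²).
    r = V ^ᵛ 2 P.* (3 ×ᵛ P.1# P.+ 3 ×ᵛ E P.+ E ^ᵛ 2)
    M = π ^ 3 * cubic u ∷ π ^ 3 * (3 RD.× (u * w) + - 1#) ∷ 1# ∷ []

    M-monic : IsMonic M
    M-monic = record { degree = 2 ; leading = refl ; above = λ { (ℕ.s≤s (ℕ.s≤s (ℕ.s≤s _))) → refl } }

    WΠ≈1+E : W P.* Π ≈ₚ P.1# P.+ E
    WΠ≈1+E = P.trans (P.sym (ν.*-homo w π)) (P.trans (ν.⟦⟧-cong wπ≈1+e) (ν.+-homo 1# e))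

    coefficient₀ : π ^ 3 * cubic u ∷ [] ≈ₚ Π ^ᵛ 3 P.* cubicᵛ U
    coefficient₀ = *-homo′ polyRing ν-hom (π ^ 3) (cubic u) (^-homo polyRing ν-hom 3 π) ν-cubic

    coefficient₁ : π ^ 3 * (3 RD.× (u * w) + - 1#) ∷ [] ≈ₚ Π ^ᵛ 3 P.* (3 ×ᵛ (U P.* W) P.+ P.- P.1#)
    coefficient₁ = P.trans (ν.*-homo (π ^ 3) (3 RD.× (u * w) + - 1#)) (P.*-cong (^-homo polyRing ν-hom 3 π)
      (P.trans (ν.+-homo (3 RD.× (u * w)) (- 1#)) (P.+-congʳ {P.- P.1#} (P.trans (×-homo polyRing ν-hom 3 (u * w))
        (P.+-cong UW (P.+-cong UW (P.+-congʳ {P.0#} UW)))))))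
      where UW = ν.*-homo u w

    equation : Π ^ᵛ 3 P.* surfaceᵛ ≈ₚ M P.+ scale e r
    equation = begin
      Π ^ᵛ 3 P.* surfaceᵛ
        ≈⟨ RingSolver.solve polyRing 6 (λ b c u v w p →
             p :^ 3 :* (v :^ 2 :* w :^ 3 :+ 3 :× (u :* v :* w) :+ u :^ 3 :+ :- (b :* u) :+ :- v :+ :- c) :=
             (p :^ 3 :* (u :^ 3 :+ :- (b :* u) :+ :- c) :+ v :* (p :^ 3 :* (3 :× (u :* w) :+ :- con 1))) :+ v :^ 2 :* (w :* p) :^ 3)
             P.refl B C U V W Π ⟩
      (Π ^ᵛ 3 P.* cubicᵛ U P.+ V P.* (Π ^ᵛ 3 P.* (3 ×ᵛ (U P.* W) P.+ P.- P.1#))) P.+ V ^ᵛ 2 P.* (W P.* Π) ^ᵛ 3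
        ≈⟨ P.+-cong (P.+-cong (P.sym coefficient₀) (P.*-congˡ {V} (P.sym coefficient₁))) (P.*-congˡ {V ^ᵛ 2} (^-cong polyRing ν-hom 3 WΠ≈1+E)) ⟩
      ((m₀ ∷ []) P.+ V P.* (m₁ ∷ [])) P.+ V ^ᵛ 2 P.* (P.1# P.+ E) ^ᵛ 3
        ≈⟨ RingSolver.solve polyRing 4 (λ a b v e → (a :+ v :* b) :+ v :^ 2 :* (con 1 :+ e) :^ 3 :=
             (a :+ v :* (b :+ v :* con 1)) :+ e :* (v :^ 2 :* (3 :× con 1 :+ 3 :× e :+ e :^ 2)))
             P.refl (m₀ ∷ []) (m₁ ∷ []) V E ⟩
      ((m₀ ∷ []) P.+ V P.* ((m₁ ∷ []) P.+ V P.* P.1#)) P.+ E P.* r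
        ≈⟨ P.+-cong (P.sym (P.trans (V-expand m₀ (m₁ ∷ 1# ∷ [])) (P.+-congˡ {m₀ ∷ []} (P.*-congˡ {V} (V-expand m₁ P.1#))))) (ν* e r) ⟩
      M P.+ scale e r ∎
      where
      m₀ m₁ : Carrier
      m₀ = π ^ 3 * cubic u
      m₁ = π ^ 3 * (3 RD.× (u * w) + - 1#)

ideal-vanishes : ∀ {R} (S : CommutativeRing 0ℓ 0ℓ) {χ : ∣ R ∣ → CommutativeRing.Carrier S} →
  IsRingHomomorphism R (CommutativeRing.rawRing S) χ →
  ∀ fs → All (λ f → CommutativeRing._≈_ S (χ f) (CommutativeRing.0# S)) fs →
  ∀ h → InIdeal R fs h → CommutativeRing._≈_ S (χ h) (CommutativeRing.0# S)
ideal-vanishes {R} S {χ} χ-hom = go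
  where
  module R = RawRing R
  open CommutativeRing S
  open IsRingHomomorphism χ-hom
  open import Relation.Binary.Reasoning.Setoid setoid
  go : ∀ fs → All (λ f → χ f ≈ 0#) fs → ∀ h → InIdeal R fs h → χ h ≈ 0#
  go []       []            h h≈0     = trans (⟦⟧-cong h≈0) 0#-homo
  go (f ∷ fs) (χf≈0 ∷ χfs≈0) h (q , r) = begin
    χ h                                          ≈⟨ RingSolver.solve S 2 (λ h x → h := h :- x :+ x) refl (χ h) (χ q * χ f) ⟩
    χ h + - (χ q * χ f) + χ q * χ f              ≈⟨ +-cong (+-congˡ (-‿cong (sym (*-homo q f)))) (*-congˡ χf≈0) ⟩
    χ h + - χ (q R.* f) + χ q * 0#               ≈⟨ +-cong (+-congˡ (sym (-‿homo (q R.* f)))) (zeroʳ _) ⟩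
    χ h + χ (R.- (q R.* f)) + 0#                 ≈⟨ +-identityʳ _ ⟩
    χ h + χ (R.- (q R.* f))                      ≈⟨ +-homo h (R.- (q R.* f)) ⟨
    χ (h R.+ R.- (q R.* f))                      ≈⟨ go fs χfs≈0 _ r ⟩
    0#                                           ∎

domain-regular : ∀ {R} (isCR : IsCR R) → IsDecidableDomain R → ∀ x → ¬ RawRing._≈_ R x (RawRing.0# R) →
  Regularity.Regular (bundle R isCR) x
domain-regular isCR dom x x≉0 = Regularity.regular λ y xy≈0 → [ (λ x≈0 → contradiction x≈0 x≉0) , id ]′ (domain x y xy≈0)
  where open IsDecidableDomain dom

module SurfaceOverField (k : Ring) (k-isCR : IsCR k) (k-dom : IsDecidableDomain k) (b c : ∣ k ∣) where
  open Affine k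
  open Polynomials k k-isCR
  open FunctionFields k k-isCR

  module k = CommutativeRing (bundle k k-isCR)
  module S = CommutativeRing (kX 3)
  module T = CommutativeRing (kX 2)

  b₂ c₂ : ∣ k[X 2 ] ∣
  b₂ = const 2 b
  c₂ = const 2 c
  b₃ c₃ u v w : ∣ k[X 3 ] ∣
  b₃ = const 3 b
  c₃ = const 3 c
  u = var 3 zero
  v = var 3 (suc zero)
  w = var 3 (suc (suc zero))

  module F₂ = Forms k[X 2 ] b₂ c₂
  module F₃ = Forms k[X 3 ] b₃ c₃

  equation : ∣ k[X 3 ] ∣
  equation = F₃.surface u v w

  X : ClosedSubscheme
  X = V 3 (equation ∷ [])

  open Ideals k[X 3 ] (kX-isCR 3) public using (quotientRing; regular⇒∉; projection-isRingHomomorphism; ∈⇒≈/0; ≈/0⇒∈; generator-∈)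
  kX-isDecidableDomain : ∀ n → IsDecidableDomain k[X n ]
  kX-isDecidableDomain zero    = k-dom
  kX-isDecidableDomain (suc n) = poly-isDecidableDomain (kX-isCR n) (kX-isDecidableDomain n)

  id-hom : IsRingHomomorphism k k id
  id-hom = ringHomomorphism k k id id (λ _ _ → k.refl) (λ _ _ → k.refl) (λ _ → k.refl) k.refl k.refl

  module Evaluate {n} (xs : Vec ∣ k ∣ n) where
    ev : ∣ k[X n ] ∣ → ∣ k ∣
    ev = eval k id xs
    ev-hom : IsRingHomomorphism k[X n ] k ev
    ev-hom = eval-isRingHomomorphism (bundle k k-isCR) id id-hom xs
    ev-const : ∀ a → ev (const n a) k.≈ a
    ev-const = eval-const (bundle k k-isCR) id id-hom xs
    ev-var : ∀ i → ev (var n i) k.≈ lookup xs i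
    ev-var = eval-var (bundle k k-isCR) id id-hom xs
    open IsRingHomomorphism ev-hom public

  u₂ w₂ : ∣ k[X 2 ] ∣
  u₂ = var 2 zero
  w₂ = var 2 (suc zero)

  w₂≉0 : ¬ (w₂ T.≈ T.0#)
  w₂≉0 w₂≈0 = 1≉0 (k.trans (k.sym (ev-var (suc zero))) (k.trans (⟦⟧-cong {w₂} {T.0#} w₂≈0) 0#-homo))
    where
    open Evaluate (k.0# ∷ k.1# ∷ [])
    open IsDecidableDomain k-dom

  -- Its value at the origin is -1.
  cleared≉0 : ¬ (F₂.cleared u₂ w₂ T.≈ T.0#)
  cleared≉0 e≈0 = 1≉0 (begin
    k.1#                         ≈⟨ RingSolver.solve (bundle k k-isCR) 2 (λ b c → con 1 :=
                                      :- ((z :* z :+ :- con 1) :^ 3 :+ :- (b :* (z :* z :+ :- con 1) :* z :^ 2) :+ :- (c :* z :^ 3)))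
                                      k.refl b c ⟩
    k.- F.cleared k.0# k.0#      ≈⟨ k.-‿cong (cleared-homo (bundle k k-isCR) ev-hom {b₂} {c₂} (ev-const b) (ev-const c) u₂ w₂
                                      (ev-var zero) (ev-var (suc zero))) ⟨
    k.- ev (F₂.cleared u₂ w₂)    ≈⟨ k.-‿cong (k.trans (⟦⟧-cong {F₂.cleared u₂ w₂} {T.0#} e≈0) 0#-homo) ⟩
    k.- k.0#                     ≈⟨ RingSolver.solve (bundle k k-isCR) 0 (:- z := z) k.refl ⟩
    k.0#                         ∎)
    where
    module F = Forms k b c
    open Evaluate (k.0# ∷ k.0# ∷ [])
    open IsDecidableDomain k-dom
    open import Relation.Binary.Reasoning.Setoid k.setoid
    z : ∀ {n} → Expr n
    z = con 0

  module SR = SurfaceRegularity k[X 2 ] (kX-isCR 2) b₂ c₂ u₂ w₂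

  module Sʷ = CommutativeRing (Wrap.wrappedRing k[X 3 ] (kX-isCR 3))
  open Wrap k[X 3 ] using (wrap; unwrap; wrap-isRingHomomorphism)

  -- SurfaceRegularity takes v as the main variable, but the main variable
  -- of k[X 3 ] is u.
  σ : ∣ k[X 3 ] ∣ → ∣ k[X 3 ] ∣
  σ = eval k[X 3 ] (const 3) (v ∷ u ∷ w ∷ [])

  σ-hom : IsRingHomomorphism k[X 3 ] k[X 3 ] σ
  σ-hom = eval-isRingHomomorphism (kX 3) (const 3) (const-isRingHomomorphism 3) (v ∷ u ∷ w ∷ [])

  σ-homʷ : IsRingHomomorphism k[X 3 ] Sʷ.rawRing σ
  σ-homʷ = wrap-isRingHomomorphism σ-hom

  σ-const : ∀ a → σ (const 3 a) Sʷ.≈ const 3 a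
  σ-const a = wrap (eval-const (kX 3) (const 3) (const-isRingHomomorphism 3) (v ∷ u ∷ w ∷ []) a)

  σ-var : ∀ i → σ (var 3 i) Sʷ.≈ lookup (v ∷ u ∷ w ∷ []) i
  σ-var i = wrap (eval-var (kX 3) (const 3) (const-isRingHomomorphism 3) (v ∷ u ∷ w ∷ []) i)

  σ-cong : ∀ {x y} → x Sʷ.≈ y → σ x Sʷ.≈ σ y
  σ-cong {x} {y} x≈y = wrap (IsRingHomomorphism.⟦⟧-cong σ-hom {x} {y} (unwrap x≈y))

  σσ≈id : ∀ h → σ (σ h) Sʷ.≈ h
  σσ≈id h = Sʷ.trans {σ (σ h)} {eval k[X 3 ] (const 3) (u ∷ v ∷ w ∷ []) h} {h}
    (wrap (eval-unique (kX 3) (const 3) (σ ∘ σ) (∘-isRingHomomorphism (kX 3) σ-hom σ-hom) (u ∷ v ∷ w ∷ [])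
      (λ i → unwrap (Sʷ.trans (σ-cong (σ-var i)) (σσ-var i)))
      (λ a → unwrap (Sʷ.trans (σ-cong (σ-const a)) (σ-const a))) h))
    (Sʷ.sym {h} {eval k[X 3 ] (const 3) (u ∷ v ∷ w ∷ []) h} (wrap (eval-unique (kX 3) (const 3) id S-id-hom (u ∷ v ∷ w ∷ [])
      (λ i → unwrap (var-lookup i)) (λ a → unwrap (Sʷ.refl {const 3 a})) h)))
    where
    S-id-hom : IsRingHomomorphism k[X 3 ] k[X 3 ] id
    S-id-hom = ringHomomorphism k[X 3 ] k[X 3 ] id id (λ x y → S.refl {x S.+ y}) (λ x y → S.refl {x S.* y})
      (λ x → S.refl {S.- x}) (S.refl {S.0#}) (S.refl {S.1#})
    σσ-var : ∀ i → σ (lookup (v ∷ u ∷ w ∷ []) i) Sʷ.≈ lookup (u ∷ v ∷ w ∷ []) i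
    σσ-var zero             = σ-var (suc zero)
    σσ-var (suc zero)       = σ-var zero
    σσ-var (suc (suc zero)) = σ-var (suc (suc zero))
    var-lookup : ∀ i → var 3 i Sʷ.≈ lookup (u ∷ v ∷ w ∷ []) i
    var-lookup zero             = Sʷ.refl
    var-lookup (suc zero)       = Sʷ.refl
    var-lookup (suc (suc zero)) = Sʷ.refl

  A : CommutativeRing 0ℓ 0ℓ
  A = quotientRing (equation ∷ [])

  σ-equation : σ equation Sʷ.≈ SR.surfaceᵛ
  σ-equation = surface-homo (Wrap.wrappedRing k[X 3 ] (kX-isCR 3)) σ-homʷ {b₃} {c₃} (σ-const b) (σ-const c) u v w
    (σ-var zero) (σ-var (suc zero)) (σ-var (suc (suc zero)))

  σ-cleared : σ (F₃.cleared u w) Sʷ.≈ (F₂.cleared u₂ w₂ ∷ [])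
  σ-cleared = Sʷ.trans
    (cleared-homo Sʷ-ring σ-homʷ {b₃} {c₃} (σ-const b) (σ-const c) u w (σ-var zero) (σ-var (suc (suc zero))))
    (Sʷ.sym (cleared-homo Sʷ-ring (wrap-isRingHomomorphism (constant-isRingHomomorphism k[X 2 ] (kX-isCR 2)))
      {b₂} {c₂} (Sʷ.refl {b₃}) (Sʷ.refl {c₃}) u₂ w₂ (Sʷ.refl {v}) (Sʷ.refl {w})))
    where
    Sʷ-ring : CommutativeRing 0ℓ 0ℓ
    Sʷ-ring = Wrap.wrappedRing k[X 3 ] (kX-isCR 3)

  open Regularity A public using () renaming (Regular to Regularᴬ)

  abstract
    w-regular : Regularᴬ w
    w-regular = involution-regular k[X 3 ] (kX-isCR 3) σ-hom (λ x → unwrap (σσ≈id x))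
      {equation} {SR.surfaceᵛ} {w} {w} (unwrap σ-equation) (unwrap (σ-var (suc (suc zero))))
      (Regularity.regular (Regularity.cancel (SR.W-regular (domain-regular (kX-isCR 2) (kX-isDecidableDomain 2) w₂ w₂≉0))))

    cleared-regularᴬ : Regularᴬ (F₃.cleared u w)
    cleared-regularᴬ = involution-regular k[X 3 ] (kX-isCR 3) σ-hom (λ x → unwrap (σσ≈id x))
      {equation} {SR.surfaceᵛ} {F₃.cleared u w} {F₂.cleared u₂ w₂ ∷ []} (unwrap σ-equation) (unwrap σ-cleared)
      (Regularity.regular (Regularity.cancel (SR.cleared-regular
          (domain-regular (kX-isCR 2) (kX-isDecidableDomain 2) (F₂.cleared u₂ w₂) cleared≉0))))

-- Rationality

-- R plays the role of the polynomial ring of the plane and Q that of its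
-- fraction field.
module PlaneFractions (R : Ring) (Q : CommutativeRing 0ℓ 0ℓ) {ι : ∣ R ∣ → CommutativeRing.Carrier Q}
  (ι-hom : IsRingHomomorphism R (CommutativeRing.rawRing Q) ι) (b c y t : ∣ R ∣) where
  open CommutativeRing Q
  private
    module R = RawRing R
    module R^ = RawSemiringDefs R.rawSemiring
    module F = Forms R b c
    module ι = IsRingHomomorphism ι-hom
  open RawSemiringDefs (RawRing.rawSemiring rawRing) using (_^_)
  open Identities Q (ι b) (ι c)
  open import Relation.Binary.Reasoning.Setoid setoid

  private
    D γ : R.Carrier
    D = F.conic y t
    γ = F.cubic t

    ιD : ι D ≈ conic (ι y) (ι t)
    ιD = conic-homo Q ι-hom {b} {c} refl refl y t refl refl

    ιγ : ι γ ≈ cubic (ι t)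
    ιγ = cubic-homo Q ι-hom {b} {c} refl refl t refl

  module Coordinates {x₁ x₂ x₃ δ : Carrier}
    (x₁-eq : x₁ * ι D ≈ ι (t R.* D R.+ γ))
    (x₂-eq : x₂ * ι (D R^.^ 3) ≈ ι (R.- F.cubic y R.* γ R^.^ 2))
    (x₃-eq : x₃ * ι γ ≈ ι D)
    (Dδ≈1 : ι D * δ ≈ 1#) where

    private
      u-eq : x₁ * conic (ι y) (ι t) ≈ ι t * conic (ι y) (ι t) + cubic (ι t)
      u-eq = begin
        x₁ * conic (ι y) (ι t)    ≈⟨ *-congˡ ιD ⟨
        x₁ * ι D                  ≈⟨ x₁-eq ⟩
        ι (t R.* D R.+ γ)         ≈⟨ +-homo′ Q ι-hom (t R.* D) γ (*-homo′ Q ι-hom t D refl ιD) ιγ ⟩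
        ι t * conic (ι y) (ι t) + cubic (ι t) ∎

      v-eq : x₂ * conic (ι y) (ι t) ^ 3 ≈ - cubic (ι y) * cubic (ι t) ^ 2
      v-eq = begin
        x₂ * conic (ι y) (ι t) ^ 3                ≈⟨ *-congˡ (^-homo′ Q ι-hom 3 D ιD) ⟨
        x₂ * ι (D R^.^ 3)                         ≈⟨ x₂-eq ⟩
        ι (R.- F.cubic y R.* γ R^.^ 2)            ≈⟨ *-homo′ Q ι-hom (R.- F.cubic y) (γ R^.^ 2)
                                                       (trans (ι.-‿homo (F.cubic y)) (-‿cong (cubic-homo Q ι-hom {b} {c} refl refl y refl)))
                                                       (^-homo′ Q ι-hom 2 γ ιγ) ⟩
        - cubic (ι y) * cubic (ι t) ^ 2           ∎

      w-eq : x₃ * cubic (ι t) ≈ conic (ι y) (ι t)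
      w-eq = trans (*-congˡ (sym ιγ)) (trans x₃-eq ιD)

    open FromPlane (ι y) (ι t) u-eq v-eq w-eq (trans (*-congʳ (sym ιD)) Dδ≈1) public

module _ (R : CommutativeRing 0ℓ 0ℓ) where
  open CommutativeRing R
  open import Relation.Binary.Reasoning.Setoid setoid

  -- Serves to show that the fraction 1/w has the value u - t; `i` and `w′` are the images of its
  -- numerator and denominator.
  reciprocal-from-t : ∀ {i w′ u w t} → i ≈ 1# → w′ ≈ w → u * w + - 1# ≈ w * t → i ≈ w′ * (u + - t)
  reciprocal-from-t {i} {w′} {u} {w} {t} i≈1 w′≈w uw-1≈wt = begin
    i                          ≈⟨ i≈1 ⟩
    1#                         ≈⟨ RingSolver.solve R 2 (λ u w → con 1 := w :* u :- (u :* w :- con 1)) refl u w ⟩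
    w * u + - (u * w + - 1#)   ≈⟨ +-congˡ (-‿cong uw-1≈wt) ⟩
    w * u + - (w * t)          ≈⟨ RingSolver.solve R 3 (λ u w t → w :* u :- w :* t := w :* (u :- t)) refl u w t ⟩
    w * (u + - t)              ≈⟨ *-congʳ (sym w′≈w) ⟩
    w′ * (u + - t)             ∎

  minus-minus : ∀ x t → x + - (x + - t) ≈ t
  minus-minus = RingSolver.solve R 2 (λ x t → x :- (x :- t) := t) refl

module Rationality (k : Ring) (k-isCR : IsCR k) (k-dom : IsDecidableDomain k) (b c : ∣ k ∣)
  (c≉0 : ¬ RawRing._≈_ k c (RawRing.0# k)) where
  open Affine k
  open Polynomials k k-isCR
  open FunctionFields k k-isCR
  open SurfaceOverField k k-isCR k-dom b c

  plane-isVariety : IsVariety (𝔸 2)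
  plane-isVariety = affine-isVariety 2 k-dom

  module L where
    open FunctionField plane-isVariety public
    open FunctionFieldRing plane-isVariety public
    open CommutativeRing K-ring public hiding (refl; zero)
    open CommutativeRing K-ring public using () renaming (refl to ≈-refl)

  y₂ t₂ D₂ γ₂ : ∣ k[X 2 ] ∣
  y₂ = var 2 zero
  t₂ = var 2 (suc zero)
  D₂ = F₂.conic y₂ t₂
  γ₂ = F₂.cubic t₂

  module T^ = RawSemiringDefs (RawRing.rawSemiring k[X 2 ])

  -- The mixed difference of D with respect to y and t is −1.
  D₂≉0 : ¬ (D₂ T.≈ T.0#)
  D₂≉0 D≈0 = 1≉0 (begin
    k.1#
      ≈⟨ RingSolver.solve (bundle k k-isCR) 1 (λ b → i := :- (((D b i i :- D b i o) :- D b o i) :+ D b o o)) k.refl b ⟩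
    k.- (((F.conic k.1# k.1# k.+ k.- F.conic k.1# k.0#) k.+ k.- F.conic k.0# k.1#) k.+ F.conic k.0# k.0#)
      ≈⟨ k.-‿cong (k.+-cong (k.+-cong (k.+-cong (value k.1# k.1#) (k.-‿cong (value k.1# k.0#)))
           (k.-‿cong (value k.0# k.1#))) (value k.0# k.0#)) ⟩
    k.- (((k.0# k.+ k.- k.0#) k.+ k.- k.0#) k.+ k.0#)
      ≈⟨ RingSolver.solve (bundle k k-isCR) 0 (:- (((o :- o) :- o) :+ o) := o) k.refl ⟩
    k.0# ∎)
    where
    module F = Forms k b c
    open IsDecidableDomain k-dom
    open import Relation.Binary.Reasoning.Setoid k.setoid
    o i : ∀ {n} → Expr n
    o = con 0
    i = con 1
    D : ∀ {n} → Expr n → Expr n → Expr n → Expr n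
    D b y t = b :+ :- (y :* y :+ y :* t :+ t :* t)
    value : ∀ y t → F.conic y t k.≈ k.0#
    value y t = k.trans (k.sym (conic-homo (bundle k k-isCR) ev-hom {b₂} {c₂} (ev-const b) (ev-const c) y₂ t₂
      (ev-var zero) (ev-var (suc zero)))) (k.trans (⟦⟧-cong {D₂} {T.0#} D≈0) 0#-homo)
      where open Evaluate (y ∷ t ∷ [])

  -- At t = 0 the cubic takes the value -c.
  γ₂≉0 : ¬ (γ₂ T.≈ T.0#)
  γ₂≉0 γ≈0 = c≉0 (begin
    c                   ≈⟨ RingSolver.solve (bundle k k-isCR) 2 (λ b c → c := :- (con 0 :^ 3 :+ :- (b :* con 0) :+ :- c)) k.refl b c ⟩
    k.- F.cubic k.0#    ≈⟨ k.-‿cong (cubic-homo (bundle k k-isCR) ev-hom {b₂} {c₂} (ev-const b) (ev-const c) t₂ (ev-var (suc zero))) ⟨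
    k.- ev γ₂           ≈⟨ k.-‿cong (k.trans (⟦⟧-cong {γ₂} {T.0#} γ≈0) 0#-homo) ⟩
    k.- k.0#            ≈⟨ RingSolver.solve (bundle k k-isCR) 0 (:- con 0 := con 0) k.refl ⟩
    k.0#                ∎)
    where
    module F = Forms k b c
    open Evaluate (k.0# ∷ k.0# ∷ [])
    open import Relation.Binary.Reasoning.Setoid k.setoid

  D₂³≉0 : ¬ (D₂ T^.^ 3 T.≈ T.0#)
  D₂³≉0 = *-∉I {D₂} {D₂ T^.^ 2} D₂≉0 (*-∉I {D₂} {D₂ T^.^ 1} D₂≉0 (*-∉I {D₂} {T.1#} D₂≉0 1∉I))
    where open IsVariety plane-isVariety

  ψ : Vec L.Fraction 3
  ψ = L.frac (t₂ T.* D₂ T.+ γ₂) D₂ D₂≉0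
    ∷ L.frac (T.- F₂.cubic y₂ T.* γ₂ T^.^ 2) (D₂ T^.^ 3) D₂³≉0
    ∷ L.frac D₂ γ₂ γ₂≉0
    ∷ []

  -- A homomorphism ρ from k[X], under which w is invertible and the
  -- denominators of ψ become regular, inverts ψ.
  module Inverting (B : CommutativeRing 0ℓ 0ℓ) {ρ : ∣ k[X 3 ] ∣ → CommutativeRing.Carrier B}
    (ρ-hom : IsRingHomomorphism k[X 3 ] (CommutativeRing.rawRing B) ρ)
    (ρ-equation : CommutativeRing._≈_ B (ρ equation) (CommutativeRing.0# B))
    (w-invertible : Regularity.Invertible B (ρ w))
    (cleared-regular : Regularity.Regular B (ρ (F₃.cleared u w))) where
    private module B = CommutativeRing B
    open Regularity B
    open RawSemiringDefs (RawRing.rawSemiring B.rawRing) using (_^_)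
    open import Relation.Binary.Reasoning.Setoid B.setoid

    a : B.Carrier
    a = inv w-invertible

    wa≈1 : ρ w B.* a B.≈ B.1#
    wa≈1 = *-inverse w-invertible

    κ : ∣ k ∣ → B.Carrier
    κ = ρ ∘ const 3

    private
      κ-hom : IsRingHomomorphism k B.rawRing κ
      κ-hom = ∘-isRingHomomorphism B (const-isRingHomomorphism 3) ρ-hom

    open Identities B (κ b) (κ c)

    ρ-on-surface : surface (ρ u) (ρ v) (ρ w) B.≈ B.0#
    ρ-on-surface = B.trans (B.sym (surface-homo B ρ-hom {b₃} {c₃} B.refl B.refl u v w B.refl B.refl B.refl)) ρ-equation

    open ToPlane (ρ u) (ρ v) (ρ w) a wa≈1 ρ-on-surface public

    χ : ∣ k[X 2 ] ∣ → B.Carrier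
    χ = eval B.rawRing κ (y ∷ t ∷ [])

    χ-hom : IsRingHomomorphism k[X 2 ] B.rawRing χ
    χ-hom = eval-isRingHomomorphism B κ κ-hom (y ∷ t ∷ [])

    χ-const : ∀ a → χ (const 2 a) B.≈ κ a
    χ-const = eval-const B κ κ-hom (y ∷ t ∷ [])

    private
      module χ = IsRingHomomorphism χ-hom

      χy : χ y₂ B.≈ y
      χy = eval-var B κ κ-hom (y ∷ t ∷ []) zero

      χt : χ t₂ B.≈ t
      χt = eval-var B κ κ-hom (y ∷ t ∷ []) (suc zero)

      χD : χ D₂ B.≈ D
      χD = conic-homo B χ-hom {b₂} {c₂} (χ-const b) (χ-const c) y₂ t₂ χy χt

      χγ : χ γ₂ B.≈ γ
      χγ = cubic-homo B χ-hom {b₂} {c₂} (χ-const b) (χ-const c) t₂ χt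

      χ-cubic-y : χ (F₂.cubic y₂) B.≈ cubic y
      χ-cubic-y = cubic-homo B χ-hom {b₂} {c₂} (χ-const b) (χ-const c) y₂ χy

      w-unit-regular : Regular (ρ w)
      w-unit-regular = regular-factorʳ a (regular-cong (B.trans (B.sym wa≈1) (B.*-comm (ρ w) a)) 1-regular)

      -- `cleared u w` becomes w³γ once `w` is invertible, and a factor of a regular element is
      -- regular.
      γ-regular : Regular γ
      γ-regular = regular-factorʳ (ρ w ^ 3) (regular-cong
        (B.trans (cleared-homo B ρ-hom {b₃} {c₃} B.refl B.refl u w B.refl B.refl) (cleared-cubic (ρ u) (ρ w) a wa≈1))
        cleared-regular)

      D-regular : Regular D
      D-regular = regular-cong (B.sym D≈wγ) (*-regular w-unit-regular γ-regular)

    χ-vanishes : ∀ h → InIdeal k[X 2 ] [] h → χ h B.≈ B.0#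
    χ-vanishes = ideal-vanishes B χ-hom [] []

    open Transport plane-isVariety B χ-hom χ-const χ-vanishes public

    ψ-↦ : ∀ i → lookup ψ i ↦ lookup (ρ u ∷ ρ v ∷ ρ w ∷ []) i
    ψ-↦ zero = (begin
      χ (t₂ T.* D₂ T.+ γ₂)      ≈⟨ χ.+-homo (t₂ T.* D₂) γ₂ ⟩
      χ (t₂ T.* D₂) B.+ χ γ₂    ≈⟨ B.+-cong (*-homo′ B χ-hom t₂ D₂ χt χD) χγ ⟩
      t B.* D B.+ γ             ≈⟨ u-from-yt ⟩
      D B.* ρ u                 ≈⟨ B.*-congʳ χD ⟨
      χ D₂ B.* ρ u              ∎) , regular-cong (B.sym χD) D-regular
    ψ-↦ (suc zero) = (begin
      χ (T.- F₂.cubic y₂ T.* γ₂ T^.^ 2)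
        ≈⟨ *-homo′ B χ-hom (T.- F₂.cubic y₂) (γ₂ T^.^ 2) (B.trans (χ.-‿homo (F₂.cubic y₂)) (B.-‿cong χ-cubic-y))
             (^-homo′ B χ-hom 2 γ₂ χγ) ⟩
      B.- cubic y B.* γ ^ 2     ≈⟨ v-from-yt ⟩
      D ^ 3 B.* ρ v             ≈⟨ B.*-congʳ χD³ ⟨
      χ (D₂ T^.^ 3) B.* ρ v     ∎) , regular-cong (B.sym χD³) (*-regular D-regular (*-regular D-regular (*-regular D-regular 1-regular)))
      where
      χD³ : χ (D₂ T^.^ 3) B.≈ D ^ 3
      χD³ = ^-homo′ B χ-hom 3 D₂ χD
    ψ-↦ (suc (suc zero)) = (begin
      χ D₂           ≈⟨ χD ⟩
      D              ≈⟨ D≈wγ ⟩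
      ρ w B.* γ      ≈⟨ B.*-comm (ρ w) γ ⟩
      γ B.* ρ w      ≈⟨ B.*-congʳ χγ ⟨
      χ γ₂ B.* ρ w   ∎) , regular-cong (B.sym χγ) γ-regular

    -- The values of the coordinates of ψ under `χ` are the images of u, v, w, so every polynomial
    -- relation between the former holds for the latter.
    ψ-relation : ∀ h → L.IsZero (L.evalK ψ h) → ρ h B.≈ B.0#
    ψ-relation h ψh≈0 = B.trans
      (eval-unique B κ ρ ρ-hom (ρ u ∷ ρ v ∷ ρ w ∷ []) ρ-var (λ _ → B.refl) h)
      (relation-transport ψ (ρ u ∷ ρ v ∷ ρ w ∷ []) ψ-↦ h ψh≈0)
      where
      ρ-var : ∀ i → ρ (var 3 i) B.≈ lookup (ρ u ∷ ρ v ∷ ρ w ∷ []) i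
      ρ-var zero             = B.refl
      ρ-var (suc zero)       = B.refl
      ρ-var (suc (suc zero)) = B.refl

  ψ* : ∣ k[X 3 ] ∣ → L.Fraction
  ψ* = L.evalK ψ

  ψ*-hom : IsRingHomomorphism k[X 3 ] L.rawRing ψ*
  ψ*-hom = L.evalK-isRingHomomorphism ψ

  D₂-recip : ∃ λ δ → (L.fromPoly D₂ L.* δ) L.≈ L.1#
  D₂-recip = L.recip (L.fromPoly D₂) D₂≉0

  module Ψ = PlaneFractions.Coordinates k[X 2 ] L.K-ring L.fromPoly-isRingHomomorphism b₂ c₂ y₂ t₂
    {lookup ψ zero} {lookup ψ (suc zero)} {lookup ψ (suc (suc zero))} {proj₁ D₂-recip}
    (L.*-den (lookup ψ zero)) (L.*-den (lookup ψ (suc zero))) (L.*-den (lookup ψ (suc (suc zero)))) (proj₂ D₂-recip)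

  ψ*-equation : ψ* equation L.≈ L.0#
  ψ*-equation = L.trans
    (surface-homo L.K-ring ψ*-hom {b₃} {c₃} (L.evalK-const ψ b) (L.evalK-const ψ c) u v w
      (L.evalK-var ψ zero) (L.evalK-var ψ (suc zero)) (L.evalK-var ψ (suc (suc zero))))
    Ψ.on-surface

  ψ*-vanishes : ∀ h → InIdeal k[X 3 ] (equation ∷ []) h → ψ* h L.≈ L.0#
  ψ*-vanishes = ideal-vanishes L.K-ring ψ*-hom (equation ∷ []) (ψ*-equation ∷ [])

  private
    module Aʳ = Regularity A
    *-regularᴬ : ∀ {x y} → Regularᴬ x → Regularᴬ y → Regularᴬ (CommutativeRing._*_ A x y)
    *-regularᴬ {x} {y} = Aʳ.*-regular {x} {y}

    -- The total ring of fractions of k[u, v, w]/(f₁), available before (f₁) is known to be prime.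
    -- The quotient ring embeds into it, and `w` becomes invertible.
    module Loc = Localisation A Regularᴬ Aʳ.1-regular *-regularᴬ id
    module Locᴿ = CommutativeRing Loc.localisation
    module W = Wrap Locᴿ.rawRing

    Aᵗ : CommutativeRing 0ℓ 0ℓ
    Aᵗ = W.wrappedRing Locᴿ.isCommutativeRing

    module Aᵗ = CommutativeRing Aᵗ

    ρ-hom : IsRingHomomorphism k[X 3 ] Aᵗ.rawRing Loc.fraction
    ρ-hom = W.wrap-isRingHomomorphism (∘-isRingHomomorphism Loc.localisation
      {f = id} {g = Loc.fraction} (projection-isRingHomomorphism (equation ∷ [])) Loc.fraction-isRingHomomorphism)

    ρ-equation : Loc.fraction equation Aᵗ.≈ Aᵗ.0#
    ρ-equation = W.wrap (Loc.num≈0⇒≈0 (Loc.fraction equation) (∈⇒≈/0 (equation ∷ []) {equation} (generator-∈ equation)))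

    fraction-regular : ∀ {x} → Regularᴬ x → Regularity.Regular Aᵗ (Loc.fraction x)
    fraction-regular {x} x-reg = Regularity.regular λ r xr≈0 →
      W.wrap (Regularity.cancel (Loc.fraction-regular {x} x-reg) r (W.unwrap xr≈0))

    w-invertible : Regularity.Invertible Aᵗ (Loc.fraction w)
    w-invertible = Regularity.invertible (proj₁ (Loc.inverse (Loc.fraction w) w-regular))
      (W.wrap (proj₂ (Loc.inverse (Loc.fraction w) w-regular)))

    generic-relation : ∀ h → L.IsZero (L.evalK ψ h) → Loc.fraction h Aᵗ.≈ Aᵗ.0#
    generic-relation = Inverting.ψ-relation Aᵗ {Loc.fraction} ρ-hom ρ-equation w-invertible
      (fraction-regular {F₃.cleared u w} cleared-regularᴬ)

  -- Such an `h` vanishes in the total ring of fractions, and a fraction with denominator 1 vanishes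
  -- there only if its numerator does in the quotient ring. With `ψ*-vanishes` this makes (f₁) the
  -- kernel of `ψ*`.
  ψ-dominant : ∀ h → L.IsZero (L.evalK ψ h) → InIdeal k[X 3 ] (equation ∷ []) h
  ψ-dominant h ψh≈0 = ≈/0⇒∈ (equation ∷ []) {h} (Loc.≈0⇒num≈0 (Loc.fraction h) (W.unwrap (generic-relation h ψh≈0)))

  X-isVariety : IsVariety X
  X-isVariety = record
    { 1∉I   = λ 1∈I → IsVariety.1∉I plane-isVariety
        (L.≈0⇒IsZero L.1# (L.trans (L.sym ψ*.1#-homo) (ψ*-vanishes S.1# 1∈I)))
    ; prime = λ f h fh∈I → ⊎.map (ψ-dominant f) (ψ-dominant h)
        (L.zero-product (ψ* f) (ψ* h) (L.trans (L.sym (ψ*.*-homo f h)) (ψ*-vanishes (f S.* h) fh∈I)))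
    }
    where module ψ* = IsRingHomomorphism ψ*-hom

  module K where
    open FunctionField X-isVariety public
    open FunctionFieldRing X-isVariety public
    open CommutativeRing K-ring public hiding (refl; zero)
    open CommutativeRing K-ring public using () renaming (refl to ≈-refl)

  regular⇒∉I : ∀ e → Regularᴬ e → ¬ InIdeal k[X 3 ] (equation ∷ []) e
  regular⇒∉I e = regular⇒∉ (equation ∷ []) e (IsVariety.1∉I X-isVariety)

  w∉I : ¬ InIdeal k[X 3 ] (equation ∷ []) w
  w∉I = regular⇒∉I w w-regular

  w-invertible-K : Regularity.Invertible K.K-ring (K.fromPoly w)
  w-invertible-K = Regularity.invertible (K.frac S.1# w w∉I) (proj₂ (K.recip (K.fromPoly w) w∉I))

  -- The second run of the computation, in the function field that primality has made available; it
  -- shows that the coordinates of ψ, evaluated at φ, are u, v, w.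
  module Φ = Inverting K.K-ring {K.fromPoly} K.fromPoly-isRingHomomorphism
    (K.IsZero⇒≈0 (K.fromPoly equation) (generator-∈ equation)) w-invertible-K
    (K.≉0⇒regular (K.fromPoly (F₃.cleared u w)) (regular⇒∉I (F₃.cleared u w) cleared-regularᴬ))

  φ : Vec K.Fraction 2
  φ = Φ.y ∷ Φ.t ∷ []

  private
    -- The opposite direction: rational functions on the surface take values in the function field
    -- of the plane along `ψ*`, whose kernel contains no denominator.
    module Q = Transport X-isVariety L.K-ring ψ*-hom (L.evalK-const ψ) ψ*-vanishes

    ψ*-regular : ∀ h → ¬ InIdeal k[X 3 ] (equation ∷ []) h → Regularity.Regular L.K-ring (ψ* h)
    ψ*-regular h h∉I = L.≉0⇒regular (ψ* h) (λ ψh≈0 → h∉I (ψ-dominant h ψh≈0))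

    var-↦ : ∀ i → K.fromPoly (var 3 i) Q.↦ lookup ψ i
    var-↦ i = Q.fromPoly-↦ {var 3 i} (L.evalK-var ψ i)

    w⁻¹-↦ : K.frac S.1# w w∉I Q.↦ (lookup ψ zero L.+ L.- L.fromPoly t₂)
    w⁻¹-↦ = reciprocal-from-t L.K-ring {ψ* S.1#} {ψ* w} {lookup ψ zero} {lookup ψ (suc (suc zero))} {L.fromPoly t₂}
      (IsRingHomomorphism.1#-homo ψ*-hom) (L.evalK-var ψ (suc (suc zero))) Ψ.t-from-uvw
      Q., ψ*-regular w w∉I

    φ-↦ : ∀ i → lookup φ i Q.↦ lookup (L.fromPoly y₂ ∷ L.fromPoly t₂ ∷ []) i
    φ-↦ zero = Q.↦-cong Ψ.y-from-uvw (Q.↦-+ (var-↦ zero) (Q.↦-* (var-↦ (suc zero))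
      -- The square of w unfolds to w (w 1), hence the last factor.
      (Q.↦-* (var-↦ (suc (suc zero))) (Q.↦-* (var-↦ (suc (suc zero))) (Q.fromPoly-↦ {S.1#} (IsRingHomomorphism.1#-homo ψ*-hom))))))
    φ-↦ (suc zero) = Q.↦-cong (minus-minus L.K-ring (lookup ψ zero) (L.fromPoly t₂)) (Q.↦-+ (var-↦ zero) (Q.↦-neg w⁻¹-↦))

  -- Substituting ψ into the relation h(φ) = 0 turns φ back into (y, t), so h itself vanishes in the
  -- function field of the plane.
  φ-dominant : ∀ h → K.IsZero (K.evalK φ h) → InIdeal k[X 2 ] [] h
  φ-dominant h φh≈0 = L.≈0⇒IsZero (L.fromPoly h) (L.trans
    (eval-unique L.K-ring (L.fromPoly ∘ const 2) L.fromPoly L.fromPoly-isRingHomomorphism (L.fromPoly y₂ ∷ L.fromPoly t₂ ∷ [])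
      vars (λ _ → L.≈-refl) h)
    (Q.relation-transport φ (L.fromPoly y₂ ∷ L.fromPoly t₂ ∷ []) φ-↦ h φh≈0))
    where
    vars : ∀ i → L.fromPoly (var 2 i) L.≈ lookup (L.fromPoly y₂ ∷ L.fromPoly t₂ ∷ []) i
    vars zero       = L.≈-refl
    vars (suc zero) = L.≈-refl

  private
    χ≡evalK : ∀ f → Φ.χ f ≡ K.evalK φ f
    χ≡evalK f = ≡.refl

    ψ-IsZero : ∀ h → ψ* h L.≈ L.0# →
      FunctionField.IsZero plane-isVariety (FunctionField.evalK plane-isVariety ψ h)
    ψ-IsZero h = L.≈0⇒IsZero (ψ* h)

    ψ*-equations : All (λ f → ψ* f L.≈ L.0#) (equation ∷ [])
    ψ*-equations = ψ*-equation ∷ []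

    ψ-into : ∀ fs → All (λ f → ψ* f L.≈ L.0#) fs →
      All (λ f → FunctionField.IsZero plane-isVariety (FunctionField.evalK plane-isVariety ψ f)) fs
    ψ-into fs = All.map {P = λ f → ψ* f L.≈ L.0#} (λ {f} → ψ-IsZero f)

  φ-map : RationalMap X-isVariety (𝔸 2)
  φ-map = record { coords = φ ; into = [] }

  ψ-map : RationalMap plane-isVariety X
  ψ-map = record { coords = ψ ; into = ψ-into (equation ∷ []) ψ*-equations }

  private
    -- The pullback is compared for a variable r: for the coordinates
    -- themselves, conversion would multiply out the polynomials.
    pullback-φ : ∀ r x → r Φ.↦ K.fromPoly x → RawRing._≈_ (FunctionField.K X-isVariety)
      (RationalMap.pullback φ-map plane-isVariety φ-dominant r) (FunctionField.fromPoly X-isVariety x)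
    pullback-φ r x r↦x = K.divide-≈ (K.evalK φ (L.num r)) (K.evalK φ (L.den r)) x (L.den∉I r ∘ φ-dominant (L.den r))
      (≡.subst₂ (λ n d → n K.≈ d K.* K.fromPoly x) (χ≡evalK (L.num r)) (χ≡evalK (L.den r)) (Φ.num≈den* r↦x))

    pullback-ψ : ∀ r x → r Q.↦ L.fromPoly x → RawRing._≈_ (FunctionField.K plane-isVariety)
      (RationalMap.pullback ψ-map X-isVariety ψ-dominant r) (FunctionField.fromPoly plane-isVariety x)
    pullback-ψ r x r↦x = L.divide-≈ (L.evalK ψ (K.num r)) (L.evalK ψ (K.den r)) x (K.den∉I r ∘ ψ-dominant (K.den r)) (Q.num≈den* r↦x)

    ψ-↦-var : ∀ i → lookup ψ i Φ.↦ K.fromPoly (var 3 i)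
    ψ-↦-var zero             = Φ.ψ-↦ zero
    ψ-↦-var (suc zero)       = Φ.ψ-↦ (suc zero)
    ψ-↦-var (suc (suc zero)) = Φ.ψ-↦ (suc (suc zero))

    φ-↦-var : ∀ i → lookup φ i Q.↦ L.fromPoly (var 2 i)
    φ-↦-var zero       = φ-↦ zero
    φ-↦-var (suc zero) = φ-↦ (suc zero)

  ψ∘φ≈id : IsLeftInverse ψ-map φ-map φ-dominant
  ψ∘φ≈id i = pullback-φ (lookup ψ i) (var 3 i) (ψ-↦-var i)

  φ∘ψ≈id : IsLeftInverse φ-map ψ-map ψ-dominant
  φ∘ψ≈id i = pullback-ψ (lookup φ i) (var 2 i) (φ-↦-var i)

  birational : Birational X (𝔸 2)
  birational = record
    { X-var  = X-isVariety
    ; Y-var  = plane-isVariety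
    ; φ      = φ-map
    ; ψ      = ψ-map
    ; φ-dom  = φ-dominant
    ; ψ-dom  = ψ-dominant
    ; ψ∘φ≈id = ψ∘φ≈id
    ; φ∘ψ≈id = φ∘ψ≈id
    }

-- Finite fields

-- With the missed value punched out, `f` lands in a set with one element fewer, and the pigeonhole
-- principle applies.
avoiding⇒collision : ∀ {n} (f : Fin n → Fin n) y → (∀ x → f x ≢ y) → ∃₂ λ i j → i ≢ j × f i ≡ f j
avoiding⇒collision {suc n} f y f≢y with Finₚ.pigeonhole (ℕₚ.n<1+n n) (λ x → punchOut (f≢y x ∘ ≡.sym))
... | i , j , i<j , eq = i , j , Finₚ.<⇒≢ i<j , Finₚ.punchOut-injective (f≢y i ∘ ≡.sym) (f≢y j ∘ ≡.sym) eq

injective⇒surjective : ∀ {n} (f : Fin n → Fin n) → (∀ {i j} → f i ≡ f j → i ≡ j) → ∀ y → ∃ λ x → f x ≡ y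
injective⇒surjective f f-inj y with Finₚ.any? (λ x → f x Finₚ.≟ y)
... | yes found = found
... | no avoids with avoiding⇒collision f y (λ x fx≡y → avoids (x , fx≡y))
...   | i , j , i≢j , fi≡fj = contradiction (f-inj fi≡fj) i≢j

module FiniteDomain {n} {plus times : Op₂ (Fin n)} {minus : Op₁ (Fin n)} {zero# one# : Fin n}
  (isCR : IsCommutativeRing _≡_ plus times minus zero# one#)
  (domain : ∀ x y → times x y ≡ zero# → x ≡ zero# ⊎ y ≡ zero#) (1≢0 : one# ≢ zero#) where

  commutativeRing : CommutativeRing 0ℓ 0ℓ
  commutativeRing = record { isCommutativeRing = isCR }

  open CommutativeRing commutativeRing hiding (refl; sym; trans; zero)
  open import Algebra.Properties.AbelianGroup +-abelianGroup using (x∙y⁻¹≈ε⇒x≈y)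
  open RawSemiringDefs (RawRing.rawSemiring rawRing) using (_^_)
  open import Algebra.Properties.CommutativeMonoid.Sum *-commutativeMonoid using () renaming
    (sum to product; ∑-distrib-+ to product-*; sum-permute to product-permute; sum-replicate to product-replicate;
     sum-cong-≗ to product-cong; sum-remove to product-remove; sum-replicate-zero to product-ones)
  open ≡.≡-Reasoning

  *-cancelˡ : ∀ a → a ≢ 0# → ∀ {x y} → a * x ≡ a * y → x ≡ y
  *-cancelˡ a a≢0 {x} {y} ax≡ay = x∙y⁻¹≈ε⇒x≈y x y ([ (λ a≡0 → contradiction a≡0 a≢0) , id ]′ (domain a (x - y) (begin
    a * (x - y)        ≡⟨ RingSolver.solve commutativeRing 3 (λ a x y → a :* (x :- y) := a :* x :- a :* y) ≡.refl a x y ⟩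
    (a * x) - (a * y)  ≡⟨ ≡.cong (_- (a * y)) ax≡ay ⟩
    (a * y) - (a * y)  ≡⟨ -‿inverseʳ _ ⟩
    0#                 ∎)))

  -- Multiplication by a nonzero element is injective, hence surjective on a finite set. The
  -- condition sits on the equation only, so that inversion is a total function; at `0#` its value
  -- is the placeholder `0#`.
  inverse : ∀ a → ∃ λ a⁻¹ → a ≢ 0# → a * a⁻¹ ≡ 1#
  inverse a with a Finₚ.≟ 0#
  ... | yes a≡0 = 0# , λ a≢0 → contradiction a≡0 a≢0
  ... | no a≢0 with injective⇒surjective (a *_) (*-cancelˡ a a≢0) 1#
  ...   | a⁻¹ , aa⁻¹≡1 = a⁻¹ , λ _ → aa⁻¹≡1

  private
    module _ (a : Fin n) (a≢0 : a ≢ 0#) where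
      a⁻¹ : Fin n
      a⁻¹ = proj₁ (inverse a)

      aa⁻¹≡1 : a * a⁻¹ ≡ 1#
      aa⁻¹≡1 = proj₂ (inverse a) a≢0

      π : Perm.Permutation n n
      π = Perm.permutation (a *_) (a⁻¹ *_)
        (λ x → begin
          a * (a⁻¹ * x)    ≡⟨ *-assoc a a⁻¹ x ⟨
          (a * a⁻¹) * x    ≡⟨ ≡.cong (_* x) aa⁻¹≡1 ⟩
          1# * x           ≡⟨ *-identityˡ x ⟩
          x                ∎)
        (λ x → begin
          a⁻¹ * (a * x)    ≡⟨ RingSolver.solve commutativeRing 3 (λ a a⁻¹ x → a⁻¹ :* (a :* x) := (a :* a⁻¹) :* x) ≡.refl a a⁻¹ x ⟩
          (a * a⁻¹) * x    ≡⟨ ≡.cong (_* x) aa⁻¹≡1 ⟩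
          1# * x           ≡⟨ *-identityˡ x ⟩
          x                ∎)

      unless-zero : Fin n → Fin n → Fin n
      unless-zero x y with x Finₚ.≟ 0#
      ... | yes _ = 1#
      ... | no  _ = y

      -- All products run over the whole of `Fin n`, so the factor at zero is masked by `1#`: the
      -- first product is that of the nonzero elements and the second is the power n - 1 of `a`. The
      -- third family is `a` at zero only and supplies the missing factor.
      nonzero-part scale-part zero-part : Fin n → Fin n
      nonzero-part x = unless-zero x x
      scale-part x = unless-zero x a
      zero-part x with x Finₚ.≟ 0#
      ... | yes _ = a
      ... | no  _ = 1#

      nonzero-part-≢0 : ∀ x → nonzero-part x ≢ 0#
      nonzero-part-≢0 x with x Finₚ.≟ 0#
      ... | yes _  = 1≢0
      ... | no x≢0 = x≢0

      nonzero-part-* : ∀ x → nonzero-part (a * x) ≡ scale-part x * nonzero-part x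
      nonzero-part-* x with x Finₚ.≟ 0# | (a * x) Finₚ.≟ 0#
      ... | yes _   | yes _     = ≡.sym (*-identityˡ 1#)
      ... | yes x≡0 | no ax≢0   = contradiction (≡.trans (≡.cong (a *_) x≡0) (zeroʳ a)) ax≢0
      ... | no x≢0  | yes ax≡0  = contradiction (domain a x ax≡0) [ a≢0 , x≢0 ]′
      ... | no _    | no _      = ≡.refl

      zero-part-* : ∀ x → a ≡ zero-part x * scale-part x
      zero-part-* x with x Finₚ.≟ 0#
      ... | yes _ = ≡.sym (*-identityʳ a)
      ... | no  _ = ≡.sym (*-identityˡ a)

      product-≢0 : ∀ {m} (f : Fin m → Fin n) → (∀ i → f i ≢ 0#) → product f ≢ 0#
      product-≢0 {zero}  f f≢0 = 1≢0
      product-≢0 {suc m} f f≢0 fΠ≡0 = [ f≢0 zero , product-≢0 (f ∘ suc) (f≢0 ∘ suc) ]′ (domain _ _ fΠ≡0)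

      -- Multiplication by a permutes the nonzero elements, hence preserves
      -- their product.
      scale-product : product scale-part ≡ 1#
      scale-product = *-cancelˡ (product nonzero-part) (product-≢0 nonzero-part nonzero-part-≢0) (begin
        product nonzero-part * product scale-part              ≡⟨ *-comm (product nonzero-part) (product scale-part) ⟩
        product scale-part * product nonzero-part              ≡⟨ product-* scale-part nonzero-part ⟨
        product (λ x → scale-part x * nonzero-part x)          ≡⟨ product-cong (λ x → ≡.sym (nonzero-part-* x)) ⟩
        product (λ x → nonzero-part (a * x))                   ≡⟨ product-permute nonzero-part π ⟨
        product nonzero-part                                   ≡⟨ *-identityʳ (product nonzero-part) ⟨
        product nonzero-part * 1#                              ∎)

  product-single : ∀ {m} (f : Fin m → Fin n) i a → f i ≡ a → (∀ j → j ≢ i → f j ≡ 1#) → product f ≡ a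
  product-single {suc m} f i a fi≡a rest = begin
    product f                            ≡⟨ product-remove {i = i} f ⟩
    f i * product (removeAt f i)         ≡⟨ ≡.cong₂ _*_ fi≡a (≡.trans (product-cong (λ j → rest (punchIn i j) (Finₚ.punchInᵢ≢i i j))) (product-ones m)) ⟩
    a * 1#                               ≡⟨ *-identityʳ a ⟩
    a                                    ∎

  private
    -- Split into the factor at zero, which is `a`, and the n - 1 others, whose product
    -- `scale-product` shows to be 1.
    fermat-≢0 : ∀ a → a ≢ 0# → a ^ n ≡ a
    fermat-≢0 a a≢0 = begin
      a ^ n                                                        ≡⟨ product-replicate n ⟨
      product (replicate n a)                                      ≡⟨ product-cong (zero-part-* a a≢0) ⟩
      product (λ x → zero-part a a≢0 x * scale-part a a≢0 x)       ≡⟨ product-* (zero-part a a≢0) (scale-part a a≢0) ⟩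
      product (zero-part a a≢0) * product (scale-part a a≢0)       ≡⟨ ≡.cong₂ _*_ (product-single (zero-part a a≢0) 0# a at-zero elsewhere) (scale-product a a≢0) ⟩
      a * 1#                                                       ≡⟨ *-identityʳ a ⟩
      a                                                            ∎
      where
      at-zero : zero-part a a≢0 0# ≡ a
      at-zero with 0# Finₚ.≟ 0#
      ... | yes _  = ≡.refl
      ... | no 0≢0 = contradiction ≡.refl 0≢0
      elsewhere : ∀ j → j ≢ 0# → zero-part a a≢0 j ≡ 1#
      elsewhere j j≢0 with j Finₚ.≟ 0#
      ... | yes j≡0 = contradiction j≡0 j≢0
      ... | no _    = ≡.refl

    -- The element of `Fin m` witnesses that the exponent is positive.
    0^ : ∀ m → Fin m → 0# ^ m ≡ 0#
    0^ (suc m) _ = zeroˡ (0# ^ m)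

  fermat : ∀ a → a ^ n ≡ a
  fermat a with a Finₚ.≟ 0#
  ... | yes ≡.refl = 0^ n a
  ... | no a≢0     = fermat-≢0 a a≢0

  module _ {q} (n≡5+6q : n ≡ 5 ℕ.+ 6 ℕ.* q) where
    open import Algebra.Properties.CommutativeSemiring.Exp commutativeSemiring using (^-homo-*; ^-assocʳ)

    -- 3(3 + 4q) = n + (4 + 6q) = 1 + 2(n − 1)
    cube-root : ∀ x → (x ^ 3) ^ (3 ℕ.+ 4 ℕ.* q) ≡ x
    cube-root x = begin
      (x ^ 3) ^ (3 ℕ.+ 4 ℕ.* q)          ≡⟨ ^-assocʳ x 3 (3 ℕ.+ 4 ℕ.* q) ⟩
      x ^ (3 ℕ.* (3 ℕ.+ 4 ℕ.* q))        ≡⟨ ≡.cong (x ^_) exponent ⟩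
      x ^ (n ℕ.+ (4 ℕ.+ 6 ℕ.* q))        ≡⟨ ^-homo-* x n (4 ℕ.+ 6 ℕ.* q) ⟩
      x ^ n * x ^ (4 ℕ.+ 6 ℕ.* q)        ≡⟨ ≡.cong (_* x ^ (4 ℕ.+ 6 ℕ.* q)) (fermat x) ⟩
      x ^ (5 ℕ.+ 6 ℕ.* q)                ≡⟨ ≡.cong (x ^_) n≡5+6q ⟨
      x ^ n                              ≡⟨ fermat x ⟩
      x                                  ∎
      where
      exponent : 3 ℕ.* (3 ℕ.+ 4 ℕ.* q) ≡ n ℕ.+ (4 ℕ.+ 6 ℕ.* q)
      exponent = ≡.trans
        (+-*-Solver.solve 1 (λ q → conₙ 3 :*ₙ (conₙ 3 :+ₙ conₙ 4 :*ₙ q) :=ₙ conₙ 5 :+ₙ conₙ 6 :*ₙ q :+ₙ (conₙ 4 :+ₙ conₙ 6 :*ₙ q)) ≡.refl q)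
        (≡.cong (ℕ._+ (4 ℕ.+ 6 ℕ.* q)) (≡.sym n≡5+6q))
        where open +-*-Solver using () renaming (con to conₙ; _:*_ to _:*ₙ_; _:+_ to _:+ₙ_; _:=_ to _:=ₙ_)

    cube-injective : ∀ {x y} → x ^ 3 ≡ y ^ 3 → x ≡ y
    cube-injective {x} {y} x³≡y³ =
      ≡.trans (≡.sym (cube-root x)) (≡.trans (≡.cong (_^ (3 ℕ.+ 4 ℕ.* q)) x³≡y³) (cube-root y))

    -- The form is (x³ - y³)/(x - y), so a zero of it gives x³ = y³ and thus x = y; on the diagonal
    -- it is 3x².
    anisotropic : 1# + (1# + 1#) ≢ 0# → ∀ x y → (x * x + x * y) + y * y ≡ 0# → x ≡ 0# × y ≡ 0#
    anisotropic 3≢0 x y Q≡0 = x≡0 , ≡.trans (≡.sym x≡y) x≡0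
      where
      x≡y : x ≡ y
      x≡y = cube-injective (x∙y⁻¹≈ε⇒x≈y (x ^ 3) (y ^ 3) (begin
        x ^ 3 - y ^ 3                             ≡⟨ RingSolver.solve commutativeRing 2 (λ x y → x :^ 3 :- y :^ 3 := (x :- y) :* (x :* x :+ x :* y :+ y :* y)) ≡.refl x y ⟩
        (x - y) * ((x * x + x * y) + y * y)       ≡⟨ ≡.cong ((x - y) *_) Q≡0 ⟩
        (x - y) * 0#                              ≡⟨ zeroʳ (x - y) ⟩
        0#                                        ∎))
      3xx≡0 : (1# + (1# + 1#)) * (x * x) ≡ 0#
      3xx≡0 = begin
        (1# + (1# + 1#)) * (x * x)   ≡⟨ RingSolver.solve commutativeRing 1 (λ x → (con 1 :+ (con 1 :+ con 1)) :* (x :* x) := x :* x :+ x :* x :+ x :* x) ≡.refl x ⟩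
        (x * x + x * x) + x * x      ≡⟨ ≡.cong (λ z → (x * x + x * z) + z * z) x≡y ⟩
        (x * x + x * y) + y * y      ≡⟨ Q≡0 ⟩
        0#                           ∎
      x≡0 : x ≡ 0#
      x≡0 = [ (λ 3≡0 → contradiction 3≡0 3≢0) , (λ xx≡0 → [ id , id ]′ (domain x x xx≡0)) ]′ (domain _ (x * x) 3xx≡0)

-- Counting points

Fin-≡-irrelevant : ∀ {n} {x y : Fin n} (p q : x ≡ y) → p ≡ q
Fin-≡-irrelevant = Decidable⇒UIP.≡-irrelevant Finₚ._≟_

Σ-≡ : ∀ {A : Set} {P : A → Set} → (∀ {x} (p q : P x) → p ≡ q) → {r s : Σ A P} → proj₁ r ≡ proj₁ s → r ≡ s
Σ-≡ irr {x , p} {.x , q} ≡.refl = ≡.cong (x ,_) (irr p q)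

-- Irrelevance is asked of `P` alone: any two refutations are already definitionally equal.
decidable-split : ∀ {A : Set} {P : A → Set} → (∀ x → Dec (P x)) → (∀ {x} (p q : P x) → p ≡ q) →
  A ↔ (Σ A P ⊎ Σ A (¬_ ∘ P))
decidable-split {A} {P} P? irr = mk↔ₛ′ to [ proj₁ , proj₁ ]′ to-from from-to
  where
  to : A → Σ A P ⊎ Σ A (¬_ ∘ P)
  to x with P? x
  ... | yes p = inj₁ (x , p)
  ... | no ¬p = inj₂ (x , ¬p)
  to-from : ∀ s → to ([ proj₁ , proj₁ ]′ s) ≡ s
  to-from (inj₁ (x , p)) with P? x
  ... | yes p′ = ≡.cong (λ p → inj₁ (x , p)) (irr p′ p)
  ... | no ¬p  = contradiction p ¬p
  to-from (inj₂ (x , ¬p)) with P? x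
  ... | yes p = contradiction p ¬p
  ... | no _  = ≡.refl
  from-to : ∀ x → [ proj₁ , proj₁ ]′ (to x) ≡ x
  from-to x with P? x
  ... | yes _ = ≡.refl
  ... | no _  = ≡.refl

-- The image `∞` of the extra point is removed from `Fin (suc n)` and the gap closed by `punchOut`.
cancel-⊤ : ∀ {A : Set} {n} → (A ⊎ ⊤) ↔ Fin (suc n) → A ↔ Fin n
cancel-⊤ {A} {n} A⊎⊤↔ = mk↔ₛ′ f f⁻¹ f∘f⁻¹ f⁻¹∘f
  where
  open Inverse A⊎⊤↔ using (to; from; strictlyInverseˡ; strictlyInverseʳ)
  ∞ : Fin (suc n)
  ∞ = to (inj₂ tt)

  ∞≢ : ∀ a → ∞ ≢ to (inj₁ a)
  ∞≢ a eq with ≡.trans (≡.sym (strictlyInverseʳ (inj₂ tt))) (≡.trans (≡.cong from eq) (strictlyInverseʳ (inj₁ a)))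
  ... | ()

  f : A → Fin n
  f a = punchOut (∞≢ a)

  left : ∀ i → from i ≢ inj₂ tt → A
  left i i≢ with from i
  ... | inj₁ a = a
  ... | inj₂ _ = contradiction ≡.refl i≢

  left-inj₁ : ∀ i i≢ → inj₁ (left i i≢) ≡ from i
  left-inj₁ i i≢ with from i
  ... | inj₁ a = ≡.refl
  ... | inj₂ _ = contradiction ≡.refl i≢

  punched : ∀ i → from (punchIn ∞ i) ≢ inj₂ tt
  punched i eq = Finₚ.punchInᵢ≢i ∞ i (≡.trans (≡.sym (strictlyInverseˡ (punchIn ∞ i))) (≡.cong to eq))

  f⁻¹ : Fin n → A
  f⁻¹ i = left (punchIn ∞ i) (punched i)

  to-f⁻¹ : ∀ i → to (inj₁ (f⁻¹ i)) ≡ punchIn ∞ i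
  to-f⁻¹ i = ≡.trans (≡.cong to (left-inj₁ (punchIn ∞ i) (punched i))) (strictlyInverseˡ (punchIn ∞ i))

  f∘f⁻¹ : ∀ i → f (f⁻¹ i) ≡ i
  f∘f⁻¹ i = ≡.trans (Finₚ.punchOut-cong ∞ {i≢k = Finₚ.punchInᵢ≢i ∞ i ∘ ≡.sym} (to-f⁻¹ i)) (Finₚ.punchOut-punchIn ∞)

  f⁻¹∘f : ∀ a → f⁻¹ (f a) ≡ a
  f⁻¹∘f a = inj₁-injective (≡.trans (≡.sym (strictlyInverseʳ (inj₁ (f⁻¹ (f a)))))
    (≡.trans (≡.cong from (≡.trans (to-f⁻¹ (f a)) (Finₚ.punchIn-punchOut (∞≢ a)))) (strictlyInverseʳ (inj₁ a))))

module Count {n} {plus times : Op₂ (Fin n)} {minus : Op₁ (Fin n)} {zero# one# : Fin n}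
  (isCR : IsCommutativeRing _≡_ plus times minus zero# one#)
  (domain : ∀ x y → times x y ≡ zero# → x ≡ zero# ⊎ y ≡ zero#) (1≢0 : one# ≢ zero#) where

  open FiniteDomain isCR domain 1≢0 using (commutativeRing; inverse)
  open CommutativeRing commutativeRing hiding (refl; sym; trans; zero)
  open RawSemiringDefs (RawRing.rawSemiring rawRing) using (_^_) renaming (_×_ to _×ᴿ_)
  open import Algebra.Properties.AbelianGroup +-abelianGroup using (x∙y⁻¹≈ε⇒x≈y)
  open ≡.≡-Reasoning

  module _ (b c : Fin n) where
    open Identities commutativeRing b c

    module _ (no-root : ∀ z → cubic z ≢ 0#) (anisotropic : ∀ x y → x * x + x * y + y * y ≡ 0# → x ≡ 0# × y ≡ 0#) where

      private
        A : Set
        A = Fin n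

        infix 8 _⁻¹
        _⁻¹ : A → A
        x ⁻¹ = proj₁ (inverse x)

        *-⁻¹ : ∀ {x} → x ≢ 0# → x * x ⁻¹ ≡ 1#
        *-⁻¹ {x} = proj₂ (inverse x)

        *-≢0 : ∀ {x y} → x ≢ 0# → y ≢ 0# → x * y ≢ 0#
        *-≢0 x≢0 y≢0 xy≡0 = [ x≢0 , y≢0 ]′ (domain _ _ xy≡0)

        factor-≢0 : ∀ {x y} → x * y ≢ 0# → x ≢ 0#
        factor-≢0 {x} {y} xy≢0 x≡0 = xy≢0 (≡.trans (≡.cong (_* y) x≡0) (zeroˡ y))

        undivide : ∀ x {y} → y ≢ 0# → x * y * y ⁻¹ ≡ x
        undivide x {y} y≢0 = begin
          x * y * y ⁻¹      ≡⟨ *-assoc x y (y ⁻¹) ⟩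
          x * (y * y ⁻¹)    ≡⟨ ≡.cong (x *_) (*-⁻¹ y≢0) ⟩
          x * 1#            ≡⟨ *-identityʳ x ⟩
          x                 ∎

        divide : ∀ x {y} → y ≢ 0# → x * y ⁻¹ * y ≡ x
        divide x {y} y≢0 = ≡.trans (RingSolver.solve commutativeRing 3 (λ x y z → x :* z :* y := x :* y :* z) ≡.refl x y (y ⁻¹)) (undivide x y≢0)

      Surface : Set
      Surface = ∃ λ ((u , v , w) : A × A × A) → surface u v w ≡ 0#

      OnConic OffConic : Set
      OnConic = ∃ λ (x : A × A) → uncurry conic x ≡ 0#
      OffConic = ∃ λ (x : A × A) → uncurry conic x ≢ 0#

      W : Surface → A
      W ((_ , _ , w) , _) = w

      w≡0-part : (∃ λ s → W s ≡ 0#) ↔ A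
      w≡0-part = mk↔ₛ′ (λ (((u , _) , _) , _) → u) from (λ _ → ≡.refl) from-to
        where
        surface-0 : ∀ u v → surface u v 0# ≡ cubic u - v
        surface-0 u v = RingSolver.solve commutativeRing 4 (λ b c u v →
          v :^ 2 :* con 0 :^ 3 :+ 3 :× (u :* v :* con 0) :+ u :^ 3 :+ :- (b :* u) :+ :- v :+ :- c :=
          u :^ 3 :+ :- (b :* u) :+ :- c :- v) ≡.refl b c u v
        from : A → ∃ λ s → W s ≡ 0#
        from u = ((u , cubic u , 0#) , ≡.trans (surface-0 u (cubic u)) (-‿inverseʳ (cubic u))) , ≡.refl
        from-to : ∀ s → from (proj₁ (proj₁ (proj₁ s))) ≡ s
        from-to (((u , v , w) , on-s) , w≡0) = Σ-≡ Fin-≡-irrelevant (Σ-≡ Fin-≡-irrelevant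
          (×-≡,≡→≡ (≡.refl , ×-≡,≡→≡ (x∙y⁻¹≈ε⇒x≈y (cubic u) v (begin
            cubic u - v        ≡⟨ surface-0 u v ⟨
            surface u v 0#     ≡⟨ ≡.cong (surface u v) w≡0 ⟨
            surface u v w      ≡⟨ on-s ⟩
            0#                 ∎) , ≡.sym w≡0))))

      w≢0-part : (∃ λ s → W s ≢ 0#) ↔ OffConic
      w≢0-part = mk↔ₛ′ to from to-from from-to
        where
        to : (∃ λ s → W s ≢ 0#) → OffConic
        to (((u , v , w) , on-s) , w≢0) = (y , t) , λ D≡0 → *-≢0 w≢0 (no-root t) (≡.trans (≡.sym D≈wγ) D≡0)
          where open ToPlane u v w (w ⁻¹) (*-⁻¹ w≢0) on-s

        module From (y t : A) (D≢0 : conic y t ≢ 0#) where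
          D γ δ u v w : A
          D = conic y t
          γ = cubic t
          δ = D ⁻¹
          u = (t * D + γ) * δ
          v = (- cubic y * γ ^ 2) * δ ^ 3
          w = D * γ ⁻¹

          v-eq : v * D ^ 3 ≡ - cubic y * γ ^ 2
          v-eq = begin
            (x * δ ^ 3) * D ^ 3      ≡⟨ RingSolver.solve commutativeRing 3 (λ x δ D → (x :* δ :^ 3) :* D :^ 3 := x :* (D :* δ) :^ 3) ≡.refl x δ D ⟩
            x * (D * δ) ^ 3          ≡⟨ ≡.cong (λ z → x * z ^ 3) (*-⁻¹ D≢0) ⟩
            x * 1# ^ 3               ≡⟨ RingSolver.solve commutativeRing 1 (λ x → x :* con 1 :^ 3 := x) ≡.refl x ⟩
            x                        ∎
            where x = - cubic y * γ ^ 2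

          open FromPlane y t {u} {v} {w} {δ} (divide (t * D + γ) D≢0) v-eq (divide D (no-root t)) (*-⁻¹ D≢0) public

          w≢0 : w ≢ 0#
          w≢0 = factor-≢0 (λ wγ≡0 → D≢0 (≡.trans (≡.sym (divide D (no-root t))) wγ≡0))

        from : OffConic → ∃ λ s → W s ≢ 0#
        from ((y , t) , D≢0) = ((u , v , w) , on-surface) , w≢0
          where open From y t D≢0

        to-from : ∀ x → to (from x) ≡ x
        to-from ((y , t) , D≢0) = Σ-≡ (λ _ _ → ≡.refl) (×-≡,≡→≡ (y-from-uvw , (begin
          u - w ⁻¹                    ≡⟨ ≡.cong (_- w ⁻¹) (undivide u w≢0) ⟨
          u * w * w ⁻¹ - w ⁻¹         ≡⟨ RingSolver.solve commutativeRing 3 (λ u w z → u :* w :* z :- z := (u :* w :- con 1) :* z) ≡.refl u w (w ⁻¹) ⟩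
          (u * w - 1#) * w ⁻¹         ≡⟨ ≡.cong (_* w ⁻¹) t-from-uvw ⟩
          w * t * w ⁻¹                ≡⟨ ≡.cong (_* w ⁻¹) (*-comm w t) ⟩
          t * w * w ⁻¹                ≡⟨ undivide t w≢0 ⟩
          t                           ∎)))
          where open From y t D≢0

        from-to : ∀ s → from (to s) ≡ s
        from-to s@(((u , v , w) , on-s) , w≢0) = Σ-≡ (λ _ _ → ≡.refl) (Σ-≡ Fin-≡-irrelevant
          (×-≡,≡→≡ (u-eq , ×-≡,≡→≡ (v-eq , w-eq))))
          where
          open ToPlane u v w (w ⁻¹) (*-⁻¹ w≢0) on-s
          D≢0 : D ≢ 0#
          D≢0 = proj₂ (to s)
          u-eq : (t * D + γ) * D ⁻¹ ≡ u
          u-eq = begin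
            (t * D + γ) * D ⁻¹    ≡⟨ ≡.cong (_* D ⁻¹) u-from-yt ⟩
            D * u * D ⁻¹          ≡⟨ ≡.cong (_* D ⁻¹) (*-comm D u) ⟩
            u * D * D ⁻¹          ≡⟨ undivide u D≢0 ⟩
            u                     ∎
          v-eq : (- cubic y * γ ^ 2) * (D ⁻¹) ^ 3 ≡ v
          v-eq = begin
            (- cubic y * γ ^ 2) * (D ⁻¹) ^ 3    ≡⟨ ≡.cong (_* (D ⁻¹) ^ 3) v-from-yt ⟩
            D ^ 3 * v * (D ⁻¹) ^ 3              ≡⟨ RingSolver.solve commutativeRing 3 (λ v D z → D :^ 3 :* v :* z :^ 3 := v :* (D :* z) :^ 3) ≡.refl v D (D ⁻¹) ⟩
            v * (D * D ⁻¹) ^ 3                  ≡⟨ ≡.cong (λ z → v * z ^ 3) (*-⁻¹ D≢0) ⟩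
            v * 1# ^ 3                          ≡⟨ RingSolver.solve commutativeRing 1 (λ x → x :* con 1 :^ 3 := x) ≡.refl v ⟩
            v                                   ∎
          w-eq : D * γ ⁻¹ ≡ w
          w-eq = ≡.trans (≡.cong (_* γ ⁻¹) D≈wγ) (undivide w (no-root t))

      Q : A → A → A
      Q x y = x * x + x * y + y * y

      -- Since z³ − bz misses the value c, it is not injective either; but
      -- y³ − by = t³ − bt with y ≠ t means that (y, t) lies on the conic.
      base-point : ∃₂ λ y₀ t₀ → conic y₀ t₀ ≡ 0# × b ≢ 0#
      base-point with avoiding⇒collision (λ z → z ^ 3 - b * z) c
          (λ z eq → no-root z (≡.trans (≡.cong (_- c) eq) (-‿inverseʳ c)))
      ... | y₀ , t₀ , y₀≢t₀ , collision = y₀ , t₀ , on-conic , b≢0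
        where
        on-conic : conic y₀ t₀ ≡ 0#
        on-conic = [ (λ y₀-t₀≡0 → contradiction (x∙y⁻¹≈ε⇒x≈y y₀ t₀ y₀-t₀≡0) y₀≢t₀) , id ]′ (domain (y₀ - t₀) (conic y₀ t₀) (begin
          (y₀ - t₀) * conic y₀ t₀
            ≡⟨ RingSolver.solve commutativeRing 3 (λ b y t → (y :- t) :* (b :+ :- (y :* y :+ y :* t :+ t :* t)) :=
                 (t :^ 3 :- b :* t) :- (y :^ 3 :- b :* y)) ≡.refl b y₀ t₀ ⟩
          (t₀ ^ 3 - b * t₀) - (y₀ ^ 3 - b * y₀)
            ≡⟨ ≡.cong (_- (y₀ ^ 3 - b * y₀)) collision ⟨
          (y₀ ^ 3 - b * y₀) - (y₀ ^ 3 - b * y₀)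
            ≡⟨ -‿inverseʳ _ ⟩
          0# ∎))
        -- For b = 0 the point would be a zero of the anisotropic form, hence y₀ = t₀ = 0, but the
        -- two collide without being equal.
        b≢0 : b ≢ 0#
        b≢0 b≡0 = y₀≢t₀ (≡.trans (proj₁ both-zero) (≡.sym (proj₂ both-zero)))
          where
          both-zero : y₀ ≡ 0# × t₀ ≡ 0#
          both-zero = anisotropic y₀ t₀ (≡.trans (≡.sym (x∙y⁻¹≈ε⇒x≈y b (Q y₀ t₀) on-conic)) b≡0)

      -- Let Q be the norm form of R[ω], ω² + ω + 1 = 0, so that (x, y) stands
      -- for x − ωy. The points of the conic other than P = (y₀, t₀) are
      -- P(1 + 1/η) with η of trace −1, that is η = (m, −1 − 2m).
      module Parametrisation (y₀ t₀ : A) (P-on : conic y₀ t₀ ≡ 0#) (b≢0 : b ≢ 0#) where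
        private
          b≡Q : b ≡ Q y₀ t₀
          b≡Q = x∙y⁻¹≈ε⇒x≈y b (Q y₀ t₀) P-on

          norm : A → A
          norm m = 3 ×ᴿ (m * m) + 3 ×ᴿ m + 1#

          norm≢0 : ∀ m → norm m ≢ 0#
          norm≢0 m N≡0 = 1≢0 (begin
            1#                           ≡⟨ RingSolver.solve commutativeRing 1 (λ m → con 1 := :- (:- (con 1 :+ (m :+ m))) :- (m :+ m)) ≡.refl m ⟩
            - m₂ - (m + m)               ≡⟨ ≡.cong₂ (λ x m → - x - (m + m)) (proj₂ both-zero) (proj₁ both-zero) ⟩
            - 0# - (0# + 0#)             ≡⟨ RingSolver.solve commutativeRing 0 (:- con 0 :- (con 0 :+ con 0) := con 0) ≡.refl ⟩
            0#                           ∎)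
            where
            m₂ : A
            m₂ = - (1# + (m + m))
            both-zero : m ≡ 0# × m₂ ≡ 0#
            both-zero = anisotropic m m₂ (≡.trans
              (RingSolver.solve commutativeRing 1 (λ m → let m₂ = :- (con 1 :+ (m :+ m)) in
                m :* m :+ m :* m₂ :+ m₂ :* m₂ := 3 :× (m :* m) :+ 3 :× m :+ con 1) ≡.refl m) N≡0)

          -- The coordinates of P times the conjugate of η, which is (-1 - m, 1 + 2m). Divided by
          -- the norm of η they become those of P/η, the displacement from P.
          e₁ e₂ : A → A
          e₁ m = y₀ * (- (1# + m)) - t₀ * (1# + (m + m))
          e₂ m = y₀ * (1# + (m + m)) + t₀ * m

          d₁ d₂ : A → A
          d₁ m = e₁ m * norm m ⁻¹
          d₂ m = e₂ m * norm m ⁻¹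

          -- Multiplicativity of the norm, P having norm b.
          e-norm : ∀ m → Q (e₁ m) (e₂ m) ≡ b * norm m
          e-norm m = ≡.trans
            (RingSolver.solve commutativeRing 3 (λ y t m →
              let e₁ = y :* (:- (con 1 :+ m)) :- t :* (con 1 :+ (m :+ m))
                  e₂ = y :* (con 1 :+ (m :+ m)) :+ t :* m
              in e₁ :* e₁ :+ e₁ :* e₂ :+ e₂ :* e₂ :=
                 (y :* y :+ y :* t :+ t :* t) :* (3 :× (m :* m) :+ 3 :× m :+ con 1)) ≡.refl y₀ t₀ m)
            (≡.cong (_* norm m) (≡.sym b≡Q))

          d-norm : ∀ m → Q (d₁ m) (d₂ m) ≡ b * norm m ⁻¹
          d-norm m = begin
            Q (e₁ m * k) (e₂ m * k)
              ≡⟨ RingSolver.solve commutativeRing 3 (λ e₁ e₂ k → e₁ :* k :* (e₁ :* k) :+ e₁ :* k :* (e₂ :* k) :+ e₂ :* k :* (e₂ :* k) :=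
                   (e₁ :* e₁ :+ e₁ :* e₂ :+ e₂ :* e₂) :* k :* k) ≡.refl (e₁ m) (e₂ m) k ⟩
            Q (e₁ m) (e₂ m) * k * k    ≡⟨ ≡.cong (λ z → z * k * k) (e-norm m) ⟩
            b * norm m * k * k         ≡⟨ ≡.cong (_* k) (undivide b (norm≢0 m)) ⟩
            b * k                      ∎
            where k = norm m ⁻¹

          d-norm≢0 : ∀ m → Q (d₁ m) (d₂ m) ≢ 0#
          d-norm≢0 m Q≡0 = b≢0 (begin
            b                                    ≡⟨ divide b (norm≢0 m) ⟨
            b * norm m ⁻¹ * norm m               ≡⟨ ≡.cong (_* norm m) (≡.trans (≡.sym (d-norm m)) Q≡0) ⟩
            0# * norm m                          ≡⟨ zeroˡ (norm m) ⟩
            0#                                   ∎)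

          point-on : ∀ m → conic (y₀ + d₁ m) (t₀ + d₂ m) ≡ 0#
          point-on m = begin
            conic (y₀ + d₁ m) (t₀ + d₂ m)
              ≡⟨ RingSolver.solve commutativeRing 5 (λ b y t m k →
                   let e₁ = y :* (:- (con 1 :+ m)) :- t :* (con 1 :+ (m :+ m))
                       e₂ = y :* (con 1 :+ (m :+ m)) :+ t :* m
                       N = 3 :× (m :* m) :+ 3 :× m :+ con 1
                       y′ = y :+ e₁ :* k
                       t′ = t :+ e₂ :* k
                       q = y :* y :+ y :* t :+ t :* t
                   in b :+ :- (y′ :* y′ :+ y′ :* t′ :+ t′ :* t′) :=
                      (b :+ :- q) :+ :- (q :* k :* (N :* k :- con 1))) ≡.refl b y₀ t₀ m (norm m ⁻¹) ⟩
            conic y₀ t₀ - Q y₀ t₀ * norm m ⁻¹ * (norm m * norm m ⁻¹ - 1#)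
              ≡⟨ ≡.cong₂ (λ x z → x - Q y₀ t₀ * norm m ⁻¹ * (z - 1#)) P-on (*-⁻¹ (norm≢0 m)) ⟩
            0# - Q y₀ t₀ * norm m ⁻¹ * (1# - 1#)
              ≡⟨ RingSolver.solve commutativeRing 1 (λ x → con 0 :- x :* (con 1 :- con 1) := con 0) ≡.refl (Q y₀ t₀ * norm m ⁻¹) ⟩
            0# ∎

          point : A → OnConic
          point m = (y₀ + d₁ m , t₀ + d₂ m) , point-on m

          -- The first coordinate of η = P/(x - P), computed as P times the conjugate of x - P over
          -- its norm. The conjugate of (a₁, a₂) is (a₁ + a₂, -a₂).
          slope : A → A → A
          slope y t = (y₀ * ((y - y₀) + (t - t₀)) + t₀ * (t - t₀)) * Q (y - y₀) (t - t₀) ⁻¹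

          is-base? : ∀ (x : A × A) → Dec (x ≡ (y₀ , t₀))
          is-base? = λ x → ≡-dec Finₚ._≟_ Finₚ._≟_ x (y₀ , t₀)

          -- The decision is an argument, so that the inverse laws can be proved by matching on an
          -- arbitrary decision.
          from-dec : (x : A × A) → Dec (x ≡ (y₀ , t₀)) → A ⊎ ⊤
          from-dec _ (yes _)      = inj₂ tt
          from-dec (y , t) (no _) = inj₁ (slope y t)

          from : OnConic → A ⊎ ⊤
          from (x , _) = from-dec x (is-base? x)

          to : A ⊎ ⊤ → OnConic
          to (inj₁ m) = point m
          to (inj₂ _) = (y₀ , t₀) , P-on

          minus-base : ∀ x d → x + d - x ≡ d
          minus-base = RingSolver.solve commutativeRing 2 (λ x d → x :+ d :- x := d) ≡.refl

          point≢base : ∀ m → (y₀ + d₁ m , t₀ + d₂ m) ≢ (y₀ , t₀)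
          point≢base m eq = d-norm≢0 m (begin
            Q (d₁ m) (d₂ m)                              ≡⟨ ≡.cong₂ Q (minus-base y₀ (d₁ m)) (minus-base t₀ (d₂ m)) ⟨
            Q (y₀ + d₁ m - y₀) (t₀ + d₂ m - t₀)          ≡⟨ ≡.cong (λ (y , t) → Q (y - y₀) (t - t₀)) eq ⟩
            Q (y₀ - y₀) (t₀ - t₀)                        ≡⟨ RingSolver.solve commutativeRing 2 (λ y t → (y :- y) :* (y :- y) :+ (y :- y) :* (t :- t) :+ (t :- t) :* (t :- t) := con 0) ≡.refl y₀ t₀ ⟩
            0#                                           ∎)

          slope-point : ∀ m → slope (y₀ + d₁ m) (t₀ + d₂ m) ≡ m
          slope-point m = begin
            slope (y₀ + d₁ m) (t₀ + d₂ m)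
              ≡⟨ ≡.cong₂ (λ a b → (y₀ * (a + b) + t₀ * b) * Q a b ⁻¹) (minus-base y₀ (d₁ m)) (minus-base t₀ (d₂ m)) ⟩
            (y₀ * (d₁ m + d₂ m) + t₀ * d₂ m) * Q (d₁ m) (d₂ m) ⁻¹
              ≡⟨ ≡.cong (_* Q (d₁ m) (d₂ m) ⁻¹) numerator ⟩
            m * Q (d₁ m) (d₂ m) * Q (d₁ m) (d₂ m) ⁻¹
              ≡⟨ undivide m (d-norm≢0 m) ⟩
            m ∎
            where
            numerator : y₀ * (d₁ m + d₂ m) + t₀ * d₂ m ≡ m * Q (d₁ m) (d₂ m)
            numerator = begin
              y₀ * (d₁ m + d₂ m) + t₀ * d₂ m
                ≡⟨ RingSolver.solve commutativeRing 4 (λ y t m k →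
                     let d₁ = (y :* (:- (con 1 :+ m)) :- t :* (con 1 :+ (m :+ m))) :* k
                         d₂ = (y :* (con 1 :+ (m :+ m)) :+ t :* m) :* k
                     in y :* (d₁ :+ d₂) :+ t :* d₂ := m :* ((y :* y :+ y :* t :+ t :* t) :* k)) ≡.refl y₀ t₀ m (norm m ⁻¹) ⟩
              m * (Q y₀ t₀ * norm m ⁻¹)   ≡⟨ ≡.cong (λ z → m * (z * norm m ⁻¹)) b≡Q ⟨
              m * (b * norm m ⁻¹)         ≡⟨ ≡.cong (m *_) (d-norm m) ⟨
              m * Q (d₁ m) (d₂ m)         ∎

          module Slope (y t : A) (on : conic y t ≡ 0#) (≢base : (y , t) ≢ (y₀ , t₀)) where
            a₁ a₂ k m m₂ : A
            a₁ = y - y₀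
            a₂ = t - t₀
            k = Q a₁ a₂ ⁻¹
            m = slope y t
            m₂ = (t₀ * a₁ - y₀ * a₂) * k

            Qa≢0 : Q a₁ a₂ ≢ 0#
            Qa≢0 Q≡0 = ≢base (×-≡,≡→≡ (x∙y⁻¹≈ε⇒x≈y y y₀ (proj₁ both-zero) , x∙y⁻¹≈ε⇒x≈y t t₀ (proj₂ both-zero)))
              where
              both-zero : a₁ ≡ 0# × a₂ ≡ 0#
              both-zero = anisotropic a₁ a₂ Q≡0

            -- The element η = (m, m₂) has trace 2m + m₂. That it equals -1 expresses that P and (y,
            -- t) have the same norm b, both being on the conic.
            trace : 1# + (m + m) ≡ - m₂
            trace = x∙y⁻¹≈ε⇒x≈y (1# + (m + m)) (- m₂) (begin
              1# + (m + m) - (- m₂)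
                ≡⟨ RingSolver.solve commutativeRing 6 (λ b y t y₀ t₀ k →
                     let a₁ = y :- y₀
                         a₂ = t :- t₀
                         m = (y₀ :* (a₁ :+ a₂) :+ t₀ :* a₂) :* k
                         m₂ = (t₀ :* a₁ :- y₀ :* a₂) :* k
                     in con 1 :+ (m :+ m) :- (:- m₂) :=
                        (con 1 :- (a₁ :* a₁ :+ a₁ :* a₂ :+ a₂ :* a₂) :* k)
                          :+ ((b :+ :- (y₀ :* y₀ :+ y₀ :* t₀ :+ t₀ :* t₀)) :- (b :+ :- (y :* y :+ y :* t :+ t :* t))) :* k)
                     ≡.refl b y t y₀ t₀ k ⟩
              (1# - Q a₁ a₂ * k) + (conic y₀ t₀ - conic y t) * k
                ≡⟨ ≡.cong₂ (λ x z → (1# - x) + z * k) (*-⁻¹ Qa≢0) (≡.cong₂ _-_ P-on on) ⟩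
              (1# - 1#) + (0# - 0#) * k
                ≡⟨ RingSolver.solve commutativeRing 1 (λ k → (con 1 :- con 1) :+ (con 0 :- con 0) :* k := con 0) ≡.refl k ⟩
              0# ∎)

            -1-m : - (1# + m) ≡ m + m₂
            -1-m = begin
              - (1# + m)            ≡⟨ RingSolver.solve commutativeRing 1 (λ m → :- (con 1 :+ m) := m :- (con 1 :+ (m :+ m))) ≡.refl m ⟩
              m - (1# + (m + m))    ≡⟨ ≡.cong (λ x → m - x) trace ⟩
              m - (- m₂)            ≡⟨ RingSolver.solve commutativeRing 2 (λ m n → m :- (:- n) := m :+ n) ≡.refl m m₂ ⟩
              m + m₂                ∎

            -- Multiplicativity again: the norm of η = P/(x - P) is b over the norm of x - P.
            norm-m : norm m ≡ b * k
            norm-m = begin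
              norm m
                ≡⟨ RingSolver.solve commutativeRing 1 (λ m → 3 :× (m :* m) :+ 3 :× m :+ con 1 :=
                     m :* m :- m :* (con 1 :+ (m :+ m)) :+ (con 1 :+ (m :+ m)) :* (con 1 :+ (m :+ m))) ≡.refl m ⟩
              m * m - m * (1# + (m + m)) + (1# + (m + m)) * (1# + (m + m))
                ≡⟨ ≡.cong (λ x → m * m - m * x + x * x) trace ⟩
              m * m - m * (- m₂) + (- m₂) * (- m₂)
                ≡⟨ RingSolver.solve commutativeRing 5 (λ y t a₁ a₂ k →
                     let m = (y :* (a₁ :+ a₂) :+ t :* a₂) :* k
                         m₂ = (t :* a₁ :- y :* a₂) :* k
                     in m :* m :- m :* (:- m₂) :+ (:- m₂) :* (:- m₂) :=
                        (y :* y :+ y :* t :+ t :* t) :* k :* ((a₁ :* a₁ :+ a₁ :* a₂ :+ a₂ :* a₂) :* k)) ≡.refl y₀ t₀ a₁ a₂ k ⟩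
              Q y₀ t₀ * k * (Q a₁ a₂ * k)   ≡⟨ ≡.cong₂ (λ x z → x * k * z) (≡.sym b≡Q) (*-⁻¹ Qa≢0) ⟩
              b * k * 1#                    ≡⟨ *-identityʳ (b * k) ⟩
              b * k                         ∎

            unscale : ∀ a {e} → e ≡ a * (b * k) → e * norm m ⁻¹ ≡ a
            unscale a {e} e≡ = begin
              e * norm m ⁻¹                 ≡⟨ ≡.cong (_* norm m ⁻¹) (≡.trans e≡ (≡.cong (a *_) (≡.sym norm-m))) ⟩
              a * norm m * norm m ⁻¹        ≡⟨ undivide a (norm≢0 m) ⟩
              a                             ∎

            d₁≡a₁ : d₁ m ≡ a₁
            d₁≡a₁ = unscale a₁ (begin
              y₀ * (- (1# + m)) - t₀ * (1# + (m + m))    ≡⟨ ≡.cong₂ (λ x z → y₀ * x - t₀ * z) -1-m trace ⟩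
              y₀ * (m + m₂) - t₀ * (- m₂)
                ≡⟨ RingSolver.solve commutativeRing 5 (λ y t a₁ a₂ k →
                     let m = (y :* (a₁ :+ a₂) :+ t :* a₂) :* k
                         m₂ = (t :* a₁ :- y :* a₂) :* k
                     in y :* (m :+ m₂) :- t :* (:- m₂) := a₁ :* ((y :* y :+ y :* t :+ t :* t) :* k)) ≡.refl y₀ t₀ a₁ a₂ k ⟩
              a₁ * (Q y₀ t₀ * k)                         ≡⟨ ≡.cong (λ x → a₁ * (x * k)) b≡Q ⟨
              a₁ * (b * k)                               ∎)

            d₂≡a₂ : d₂ m ≡ a₂
            d₂≡a₂ = unscale a₂ (begin
              y₀ * (1# + (m + m)) + t₀ * m               ≡⟨ ≡.cong (λ x → y₀ * x + t₀ * m) trace ⟩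
              y₀ * (- m₂) + t₀ * m
                ≡⟨ RingSolver.solve commutativeRing 5 (λ y t a₁ a₂ k →
                     let m = (y :* (a₁ :+ a₂) :+ t :* a₂) :* k
                         m₂ = (t :* a₁ :- y :* a₂) :* k
                     in y :* (:- m₂) :+ t :* m := a₂ :* ((y :* y :+ y :* t :+ t :* t) :* k)) ≡.refl y₀ t₀ a₁ a₂ k ⟩
              a₂ * (Q y₀ t₀ * k)                         ≡⟨ ≡.cong (λ x → a₂ * (x * k)) b≡Q ⟨
              a₂ * (b * k)                               ∎)

          plus-base : ∀ x y → x + (y - x) ≡ y
          plus-base = RingSolver.solve commutativeRing 2 (λ x y → x :+ (y :- x) := y) ≡.refl

          point≡ : ∀ y t → conic y t ≡ 0# → (y , t) ≢ (y₀ , t₀) →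
            (y₀ + d₁ (slope y t) , t₀ + d₂ (slope y t)) ≡ (y , t)
          point≡ y t on ≢base = ×-≡,≡→≡
            ( ≡.trans (≡.cong (y₀ +_) d₁≡a₁) (plus-base y₀ y)
            , ≡.trans (≡.cong (t₀ +_) d₂≡a₂) (plus-base t₀ t))
            where open Slope y t on ≢base

          to-from-dec : ∀ x → uncurry conic x ≡ 0# → (x≟ : Dec (x ≡ (y₀ , t₀))) → proj₁ (to (from-dec x x≟)) ≡ x
          to-from-dec x       on (yes eq)   = ≡.sym eq
          to-from-dec (y , t) on (no ≢base) = point≡ y t on ≢base

          to-from : ∀ x → to (from x) ≡ x
          to-from (x , on) = Σ-≡ Fin-≡-irrelevant (to-from-dec x on (is-base? x))

          from-dec-point : ∀ m (x≟ : Dec ((y₀ + d₁ m , t₀ + d₂ m) ≡ (y₀ , t₀))) →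
            from-dec (y₀ + d₁ m , t₀ + d₂ m) x≟ ≡ inj₁ m
          from-dec-point m (yes eq) = contradiction eq (point≢base m)
          from-dec-point m (no _)   = ≡.cong inj₁ (slope-point m)

          from-dec-base : (x≟ : Dec ((y₀ , t₀) ≡ (y₀ , t₀))) → from-dec (y₀ , t₀) x≟ ≡ inj₂ tt
          from-dec-base (yes _)    = ≡.refl
          from-dec-base (no ≢base) = contradiction ≡.refl ≢base

          from-to : ∀ x → from (to x) ≡ x
          from-to (inj₁ m)  = from-dec-point m (is-base? (y₀ + d₁ m , t₀ + d₂ m))
          from-to (inj₂ tt) = from-dec-base (is-base? (y₀ , t₀))

        on-conic : OnConic ↔ (A ⊎ ⊤)
        on-conic = mk↔ₛ′ from to from-to to-from

      private
        surface-parts : Surface ↔ (A ⊎ OffConic)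
        surface-parts = ⊎-cong w≡0-part w≢0-part
          ↔-∘ decidable-split (λ s → W s Finₚ.≟ 0#) Fin-≡-irrelevant

        plane-parts : (A × A) ↔ (OnConic ⊎ OffConic)
        plane-parts = decidable-split (λ x → uncurry conic x Finₚ.≟ 0#) Fin-≡-irrelevant

        exchange : ∀ (X Y Z : Set) → ((X ⊎ Y) ⊎ Z) ↔ ((X ⊎ Z) ⊎ Y)
        exchange X Y Z = ↔-sym (⊎-assoc 0ℓ X Z Y) ↔-∘ (⊎-cong (↔-id X) (⊎-comm Y Z) ↔-∘ ⊎-assoc 0ℓ X Y Z)

        count-with : OnConic ↔ (A ⊎ ⊤) → (Surface ⊎ ⊤) ↔ (A × A)
        count-with conic↔ = ↔-sym plane-parts
          ↔-∘ (⊎-cong (↔-sym conic↔) (↔-id OffConic)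
          ↔-∘ (exchange A OffConic ⊤
          ↔-∘ ⊎-cong surface-parts (↔-id ⊤)))

      -- The surface and one more point make up A + OffConic + 1. The line and the extra point
      -- together match the conic, and conic and complement fill the plane. Adding a point on the
      -- left avoids subtracting on the right.
      surface-count : (Surface ⊎ ⊤) ↔ (A × A)
      surface-count = count-with (Parametrisation.on-conic (proj₁ base-point) (proj₁ (proj₂ base-point))
        (proj₁ (proj₂ (proj₂ base-point))) (proj₂ (proj₂ (proj₂ base-point))))

-- Irreducible cubics have no roots

module _ (R : Ring) (isCR : IsCR R) where
  open CommutativeRing (bundle R isCR)
  open PolyRing R isCR
  open Monic R isCR
  private module P = CommutativeRing polyRing

  -- Write a putative inverse as a + X q. Then a f - 1 has degree at most that of f and cancels X f
  -- q, so q = 0; now a f = 1, whose coefficient in the degree of f is a, so a = 0 as well.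
  monic-nonunit : ¬ (1# ≈ 0#) → ∀ {f} (f-monic : IsMonic f) → 0 ℕ.< IsMonic.degree f-monic →
    ∀ q → ¬ (f P.* q ≈ₚ P.1#)
  monic-nonunit 1≉0 {f} f-monic 0<d []      f*0≈1 = 1≉0 (sym (trans (sym (at (P.zeroʳ f) 0)) (at f*0≈1 0)))
  monic-nonunit 1≉0 {f} f-monic 0<d (a ∷ q) fq≈1  = 1≉0 (begin
    1#                        ≈⟨ at af≈1 0 ⟨
    coeff R (scale a f) 0     ≈⟨ coeff-scale a f 0 ⟩
    a * coeff R f 0           ≈⟨ *-congʳ a≈0 ⟩
    0# * coeff R f 0          ≈⟨ zeroˡ _ ⟩
    0#                        ∎)
    where
    open IsMonic f-monic
    open import Relation.Binary.Reasoning.Setoid setoid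
    open import Algebra.Properties.Ring ring using (-0#≈0#)

    r : List Carrier
    r = scale a f P.- P.1#

    coeff-1 : ∀ {i} → 0 ℕ.< i → coeff R P.1# i ≈ 0#
    coeff-1 {suc i} _ = refl

    r-above : ∀ {i} → degree ℕ.< i → coeff R r i ≈ 0#
    r-above {i} d<i = begin
      coeff R r i                                      ≈⟨ coeff-+ (scale a f) (P.- P.1#) i ⟩
      coeff R (scale a f) i + coeff R (P.- P.1#) i     ≈⟨ +-cong (coeff-scale a f i) (coeff-neg P.1# i) ⟩
      a * coeff R f i + - coeff R P.1# i               ≈⟨ +-cong (*-congˡ (above d<i)) (-‿cong (coeff-1 (ℕₚ.<-trans 0<d d<i))) ⟩
      a * 0# + - 0#                                    ≈⟨ +-cong (zeroʳ a) -0#≈0# ⟩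
      0# + 0#                                          ≈⟨ +-identityʳ 0# ⟩
      0#                                               ∎

    remainder≈0 : r P.+ shift (f P.* q) ≈ₚ []
    remainder≈0 = P.trans
      (RingSolver.solve polyRing 3 (λ x y z → (x :- y) :+ z := (x :+ z) :- y) P.refl (scale a f) P.1# (shift (f P.* q)))
      (P.trans (P.+-congʳ {P.- P.1#} (P.trans (P.sym (*ₚ-∷ f a q)) fq≈1)) (P.-‿inverseʳ P.1#))

    q≈0 : q ≈ₚ []
    -- The case e = 0, where being a multiple of `e` means being zero.
    q≈0 = let h , q≈0h = monic-*-multiple 0# f-monic r q r-above (λ i → 0# , trans (at remainder≈0 i) (sym (zeroˡ 0#)))
          in P.trans q≈0h (scale-zero refl h)

    af≈1 : scale a f ≈ₚ P.1#
    af≈1 = P.trans (P.sym (P.+-identityʳ (scale a f)))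
      (P.trans (P.+-congˡ {scale a f} (P.sym (P.trans (shift-cong (P.trans (*ₚ-congˡ f q≈0) (P.zeroʳ f))) shift-zero)))
      (P.trans (P.sym (*ₚ-∷ f a q)) fq≈1))

    a≈0 : a ≈ 0#
    a≈0 = begin
      a                               ≈⟨ *-identityʳ a ⟨
      a * 1#                          ≈⟨ *-congˡ leading ⟨
      a * coeff R f degree            ≈⟨ coeff-scale a f degree ⟨
      coeff R (scale a f) degree      ≈⟨ at af≈1 degree ⟩
      coeff R P.1# degree             ≈⟨ coeff-1 0<d ⟩
      0#                              ∎

  module _ (1≉0 : ¬ (1# ≈ 0#)) (b c : Carrier) where
    private
      X : List Carrier
      X = 0# ∷ 1# ∷ []
      module F = Forms R b c
      module Fₚ = Forms (Poly R) (b ∷ []) (c ∷ [])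

    open RawSemiringDefs (RawRing.rawSemiring (Poly R)) using (Irreducible) renaming (_^_ to _^ₚ_)

    -- A root z gives c = z (z² - b), and then the cubic splits as (x - z)(x² + zx + z² - b).
    -- Neither factor is a unit, both being monic of positive degree.
    irreducible⇒no-root : Irreducible (Fₚ.cubic X) → ∀ z → ¬ (F.cubic z ≈ 0#)
    irreducible⇒no-root irreducible z root = [ linear-nonunit , quadratic-nonunit ]′
      (split-∣1 (at factorisation))
      where
      open RawSemiringDefs.Irreducible irreducible
      open RawMagmaDefs (RawRing.*-rawMagma (Poly R)) using (_,_) renaming (_∣_ to _∣ₚ_)

      linear quadratic : List Carrier
      linear = - z ∷ 1# ∷ []
      quadratic = z * z + - b ∷ z ∷ 1# ∷ []

      linear-monic : IsMonic linear
      linear-monic = record { degree = 1 ; leading = refl ; above = λ { (ℕ.s≤s (ℕ.s≤s _)) → refl } }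

      quadratic-monic : IsMonic quadratic
      quadratic-monic = record { degree = 2 ; leading = refl ; above = λ { (ℕ.s≤s (ℕ.s≤s (ℕ.s≤s _))) → refl } }

      linear-nonunit : ¬ (linear ∣ₚ P.1#)
      linear-nonunit (q , ql≈1) = monic-nonunit 1≉0 linear-monic (ℕ.s≤s ℕ.z≤n) q
        (P.trans (P.*-comm linear q) (pointwise ql≈1))

      quadratic-nonunit : ¬ (quadratic ∣ₚ P.1#)
      quadratic-nonunit (q , ql≈1) = monic-nonunit 1≉0 quadratic-monic (ℕ.s≤s ℕ.z≤n) q
        (P.trans (P.*-comm quadratic q) (pointwise ql≈1))

      module ν = IsRingHomomorphism (constant-polyRing-isRingHomomorphism R isCR)

      Z B C : List Carrier
      Z = z ∷ []
      B = b ∷ []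
      C = c ∷ []

      expand : ∀ a f → a ∷ f ≈ₚ (a ∷ []) P.+ X P.* f
      expand a f = P.sym (constant-+-X* R isCR a f)

      constant-term : z * z + - b ∷ [] ≈ₚ Z P.* Z P.+ P.- B
      constant-term = P.trans (ν.+-homo (z * z) (- b)) (P.+-cong (ν.*-homo z z) (ν.-‿homo b))

      C≈ : C ≈ₚ Z P.* (Z P.* Z P.+ P.- B)
      C≈ = P.trans (∷-cong c≈ P.refl)
        (P.trans (ν.*-homo z (z * z + - b)) (P.*-congˡ {Z} constant-term))
        where
        c≈ : c ≈ z * (z * z + - b)
        c≈ = trans (sym (+-identityˡ c)) (trans (+-congʳ (sym root)) (RingSolver.solve (bundle R isCR) 3 (λ b c z →
          z :^ 3 :+ :- (b :* z) :+ :- c :+ c := z :* (z :* z :+ :- b)) refl b c z))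

      linear≈ : linear ≈ₚ P.- Z P.+ X P.* P.1#
      linear≈ = expand (- z) P.1#

      quadratic≈ : quadratic ≈ₚ (Z P.* Z P.+ P.- B) P.+ X P.* (Z P.+ X P.* P.1#)
      quadratic≈ = P.trans (expand (z * z + - b) (z ∷ 1# ∷ []))
        (P.+-cong constant-term (P.*-congˡ {X} (expand z P.1#)))

      factorisation : Fₚ.cubic X ≈ₚ linear P.* quadratic
      factorisation = P.sym (P.trans (P.*-cong linear≈ quadratic≈) (P.trans
        (RingSolver.solve polyRing 3 (λ x z b → (:- z :+ x :* con 1) :*
            ((z :* z :+ :- b) :+ x :* (z :+ x :* con 1)) :=
          x :^ 3 :+ :- (b :* x) :+ :- (z :* (z :* z :+ :- b))) P.refl X Z B)
        (P.+-congˡ {X ^ₚ 3 P.+ P.- (B P.* X)} (P.-‿cong (P.sym C≈)))))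

open Data.Nat.Base using (_^_; _∸_)

-- The prime field

module PrimeField (p : ℕ) .{{_ : NonZero p}} where
  private
    module F = RawRing (𝔽 p)
    ℤ-isCR : IsCR ℤ.+-*-rawRing
    ℤ-isCR = ℤₚ.+-*-isCommutativeRing

    ℤ/p : CommutativeRing 0ℓ 0ℓ
    ℤ/p = Ideals.quotientRing ℤ.+-*-rawRing ℤ-isCR (ℤ.+ p ∷ [])
    module ℤ/p = CommutativeRing ℤ/p

    lift : Fin p → ℤ.ℤ
    lift x = ℤ.+ toℕ x

  toℕ-mod : ∀ m → toℕ (m mod p) ≡ m % p
  toℕ-mod m = Finₚ.toℕ-fromℕ< (DivMod.m%n<n m p)

  private
    lift-mod : ∀ m → lift (m mod p) ℤ/p.≈ ℤ.+ m
    -- The remainder minus m is -(m / p) times p.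
    lift-mod m = ℤ.- (ℤ.+ (m / p)) , ≡.trans
      (≡.cong₂ (λ r n → ℤ.+ r ℤ.+ ℤ.- n ℤ.+ ℤ.- (ℤ.- (ℤ.+ (m / p)) ℤ.* ℤ.+ p)) (toℕ-mod m) split)
      (RingSolver.solve (bundle ℤ.+-*-rawRing ℤ-isCR) 3 (λ r k p → r :+ :- (r :+ k :* p) :+ :- ((:- k) :* p) := con 0) ≡.refl
        (ℤ.+ (m % p)) (ℤ.+ (m / p)) (ℤ.+ p))
      where
      split : ℤ.+ m ≡ ℤ.+ (m % p) ℤ.+ ℤ.+ (m / p) ℤ.* ℤ.+ p
      split = ≡.trans (≡.cong ℤ.+_ (DivMod.m≡m%n+[m/n]*n m p))
        (≡.cong (λ z → ℤ.+ (m % p) ℤ.+ z) (ℤₚ.pos-* (m / p) p))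

    lift-neg : ∀ x → lift (F.- x) ℤ/p.≈ ℤ.- lift x
    -- The representatives p - x and -x differ by p, hence the cofactor 1.
    lift-neg x = ℤ/p.trans {lift (F.- x)} {ℤ.+ (p ∸ toℕ x)} {ℤ.- lift x} (lift-mod (p ∸ toℕ x)) (ℤ.+ 1 , ≡.trans
      (≡.cong (λ z → z ℤ.+ ℤ.- (ℤ.- lift x) ℤ.+ ℤ.- (ℤ.+ 1 ℤ.* ℤ.+ p))
        (≡.trans (≡.sym (ℤₚ.⊖-≥ (ℕₚ.<⇒≤ (Finₚ.toℕ<n x)))) (≡.sym (ℤₚ.m-n≡m⊖n p (toℕ x)))))
      (RingSolver.solve (bundle ℤ.+-*-rawRing ℤ-isCR) 2 (λ p x → p :+ :- x :+ :- (:- x) :+ :- (con 1 :* p) := con 0) ≡.refl (ℤ.+ p) (lift x)))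

    -- The difference is a multiple of p below p, so it is zero.
    small-multiple : ∀ {m n} → m ℕ.≤ n → n ℕ.< p → p ℕ∣.∣ n ∸ m → m ≡ n
    small-multiple {m} {n} m≤n n<p p∣n∸m = ℕₚ.≤-antisym m≤n (ℕₚ.m∸n≡0⇒m≤n (small (ℕₚ.≤-<-trans (ℕₚ.m∸n≤m n m) n<p) p∣n∸m))
      where
      small : ∀ {k} → k ℕ.< p → p ℕ∣.∣ k → k ≡ 0
      small {zero}  _   _   = ≡.refl
      small {suc k} k<p p∣k = contradiction p∣k (ℕ∣.>⇒∤ k<p)

    lift-injective : ∀ {x y} → lift x ℤ/p.≈ lift y → x ≡ y
    lift-injective {x} {y} (q , eq) = Finₚ.toℕ-injective ([ case-≤ , case-≥ ]′ (ℕₚ.≤-total (toℕ x) (toℕ y)))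
      where
      difference : toℕ x ℤ.⊖ toℕ y ≡ q ℤ.* ℤ.+ p
      difference = ≡.trans (≡.sym (ℤₚ.m-n≡m⊖n (toℕ x) (toℕ y))) (ℤₚ.i-j≡0⇒i≡j _ _ eq)
      p∣ : p ℕ∣.∣ ℤ.∣ toℕ x ℤ.⊖ toℕ y ∣
      p∣ = divides ℤ.∣ q ∣ (≡.trans (≡.cong ℤ.∣_∣ difference) (ℤₚ.abs-* q (ℤ.+ p)))
      case-≤ : toℕ x ℕ.≤ toℕ y → toℕ x ≡ toℕ y
      case-≤ x≤y = small-multiple x≤y (Finₚ.toℕ<n y) (≡.subst (p ℕ∣.∣_) (ℤₚ.∣⊖∣-≤ x≤y) p∣)
      case-≥ : toℕ y ℕ.≤ toℕ x → toℕ x ≡ toℕ y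
      case-≥ y≤x = ≡.sym (small-multiple y≤x (Finₚ.toℕ<n x)
        (≡.subst (p ℕ∣.∣_) (≡.trans (ℤₚ.∣m⊖n∣≡∣n⊖m∣ (toℕ x) (toℕ y)) (ℤₚ.∣⊖∣-≤ y≤x)) p∣))

  -- The laws are pulled back from the quotient of the integers by (p), where they hold for free;
  -- this asks only that the operations modulo p agree with those of the quotient and that residues
  -- be told apart by it.
  𝔽-isCR : IsCR (𝔽 p)
  𝔽-isCR = transfer-isCR (𝔽 p) ℤ/p lift
    (ringHomomorphism (𝔽 p) ℤ/p.rawRing lift
      (λ { {x} ≡.refl → ℤ/p.refl {lift x} })
      (λ x y → lift-mod (toℕ x ℕ.+ toℕ y))
      (λ x y → ≡.subst (λ z → lift (x F.* y) ℤ/p.≈ z) (ℤₚ.pos-* (toℕ x) (toℕ y)) (lift-mod (toℕ x ℕ.* toℕ y)))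
      lift-neg (lift-mod 0) (lift-mod 1))
    lift-injective

  toℕ-0 : toℕ F.0# ≡ 0
  toℕ-0 = ≡.trans (toℕ-mod 0) (DivMod.m<n⇒m%n≡m (ℕ.>-nonZero⁻¹ p))

  module _ (p-prime : Prime p) where
    1<p : 1 ℕ.< p
    1<p = ℕ.nonTrivial⇒n>1 p {{prime⇒nonTrivial p-prime}}

    𝔽-1≢0 : F.1# ≢ F.0#
    𝔽-1≢0 1≡0 with ≡.trans (≡.sym (≡.trans (toℕ-mod 1) (DivMod.m<n⇒m%n≡m 1<p))) (≡.trans (≡.cong toℕ 1≡0) toℕ-0)
    ... | ()

    𝔽-domain : ∀ x y → x F.* y ≡ F.0# → x ≡ F.0# ⊎ y ≡ F.0#
    𝔽-domain x y xy≡0 = ⊎.map (≡0 x) (≡0 y) (euclidsLemma (toℕ x) (toℕ y) p-prime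
      (ℕ∣.m%n≡0⇒n∣m (toℕ x ℕ.* toℕ y) p
        (≡.trans (≡.sym (toℕ-mod (toℕ x ℕ.* toℕ y))) (≡.trans (≡.cong toℕ xy≡0) toℕ-0))))
      where
      ≡0 : ∀ x → p ℕ∣.∣ toℕ x → x ≡ F.0#
      ≡0 x p∣x = Finₚ.toℕ-injective (≡.trans (≡.sym (small-multiple ℕ.z≤n (Finₚ.toℕ<n x) p∣x)) (≡.sym toℕ-0))

    𝔽-isDecidableDomain : IsDecidableDomain (𝔽 p)
    𝔽-isDecidableDomain = record { zero? = zero? ; domain = 𝔽-domain ; 1≉0 = 𝔽-1≢0 }
      where
      zero? : ∀ x → x ≡ F.0# ⊎ x ≢ F.0#
      zero? x with x Finₚ.≟ F.0#
      ... | yes x≡0 = inj₁ x≡0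
      ... | no x≢0  = inj₂ x≢0

  3≢0 : 3 ℕ.< p → F.1# F.+ (F.1# F.+ F.1#) ≢ F.0#
  3≢0 3<p 3≡0 = contradiction (≡.trans (≡.sym toℕ-3) (≡.trans (≡.cong toℕ 3≡0) toℕ-0)) λ ()
    where
    small : ∀ {m} → m ℕ.≤ 3 → toℕ (m mod p) ≡ m
    small {m} m≤3 = ≡.trans (toℕ-mod m) (DivMod.m<n⇒m%n≡m (ℕₚ.≤-<-trans m≤3 3<p))
    toℕ-1 : toℕ F.1# ≡ 1
    toℕ-1 = small (ℕ.s≤s ℕ.z≤n)
    toℕ-2 : toℕ (F.1# F.+ F.1#) ≡ 2
    toℕ-2 = ≡.trans (≡.cong₂ (λ a b → toℕ ((a ℕ.+ b) mod p)) toℕ-1 toℕ-1) (small (ℕ.s≤s (ℕ.s≤s ℕ.z≤n)))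
    toℕ-3 : toℕ (F.1# F.+ (F.1# F.+ F.1#)) ≡ 3
    toℕ-3 = ≡.trans (≡.cong₂ (λ a b → toℕ ((a ℕ.+ b) mod p)) toℕ-1 toℕ-2) (small ℕₚ.≤-refl)

-- Rationality and point count over the prime field

module _ (p : ℕ) .{{_ : NonZero p}} (p-prime : Prime p) (p%6≡5 : p % 6 ≡ 5) (b c : Fin p)
  (irreducible : IrreduciblePoly p (g p b c)) where
  open PrimeField p
  open Affine (𝔽 p)
  private
    module F = CommutativeRing (bundle (𝔽 p) 𝔽-isCR)
    open Forms (𝔽 p) b c

    p≡5+6q : p ≡ 5 ℕ.+ 6 ℕ.* (p / 6)
    p≡5+6q = ≡.trans (DivMod.m≡m%n+[m/n]*n p 6) (≡.cong₂ ℕ._+_ p%6≡5 (ℕₚ.*-comm (p / 6) 6))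

    3<p : 3 ℕ.< p
    3<p = ≡.subst (3 ℕ.<_) (≡.sym p≡5+6q) (ℕₚ.≤-trans (ℕₚ.n≤1+n 4) (ℕₚ.m≤m+n 5 (6 ℕ.* (p / 6))))

    no-root : ∀ z → cubic z ≢ F.0#
    no-root = irreducible⇒no-root (𝔽 p) 𝔽-isCR (𝔽-1≢0 p-prime) b c irreducible

    -- As g(0) = -c, otherwise 0 would be a root.
    c≢0 : c ≢ F.0#
    c≢0 c≡0 = no-root F.0# (≡.trans (RingSolver.solve (bundle (𝔽 p) 𝔽-isCR) 2 (λ b c → con 0 :^ 3 :+ :- (b :* con 0) :+ :- c := :- c) ≡.refl b c)
      (≡.trans (≡.cong F.-_ c≡0) (RingSolver.solve (bundle (𝔽 p) 𝔽-isCR) 0 (:- con 0 := con 0) ≡.refl)))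

    module R = Rationality (𝔽 p) 𝔽-isCR (𝔽-isDecidableDomain p-prime) b c c≢0
    module C = Count 𝔽-isCR (𝔽-domain p-prime) (𝔽-1≢0 p-prime)
    module D = FiniteDomain 𝔽-isCR (𝔽-domain p-prime) (𝔽-1≢0 p-prime)

    anisotropic : ∀ x y → x F.* x F.+ x F.* y F.+ y F.* y ≡ F.0# → x ≡ F.0# × y ≡ F.0#
    anisotropic = D.anisotropic {p / 6} p≡5+6q (3≢0 3<p)

    SurfacePoint : Set
    SurfacePoint = C.Surface b c no-root anisotropic

    eval-f₁ : ∀ u v w → eval (𝔽 p) id (u ∷ v ∷ w ∷ []) (f₁ p b c) ≡ surface u v w
    eval-f₁ u v w = surface-homo (bundle (𝔽 p) 𝔽-isCR) ev-hom {const 3 b} {const 3 c} (ev-const b) (ev-const c)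
      (var 3 zero) (var 3 (suc zero)) (var 3 (suc (suc zero)))
      (ev-var zero) (ev-var (suc zero)) (ev-var (suc (suc zero)))
      where open SurfaceOverField.Evaluate (𝔽 p) 𝔽-isCR (𝔽-isDecidableDomain p-prime) b c (u ∷ v ∷ w ∷ [])

    points↔surface : Points (X₁ p b c) ↔ SurfacePoint
    points↔surface = mk↔ₛ′
      (λ { (u ∷ v ∷ w ∷ [] , eq ∷ []) → (u , v , w) , ≡.trans (≡.sym (eval-f₁ u v w)) eq })
      (λ ((u , v , w) , eq) → (u ∷ v ∷ w ∷ []) , ≡.trans (eval-f₁ u v w) eq ∷ [])
      (λ _ → Σ-≡ Fin-≡-irrelevant ≡.refl)
      (λ { (u ∷ v ∷ w ∷ [] , eq ∷ []) → Σ-≡ (λ { (e ∷ []) (e′ ∷ []) → ≡.cong (_∷ []) (Fin-≡-irrelevant e e′) }) ≡.refl })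

    p*p≡ : p ℕ.* p ≡ suc (p ^ 2 ∸ 1)
    p*p≡ = ≡.trans (≡.cong (p ℕ.*_) (≡.sym (ℕₚ.*-identityʳ p)))
      (≡.sym (ℕₚ.suc-pred (p ^ 2) {{ℕₚ.m^n≢0 p 2}}))

  -- `f₁` unfolds to the form `surface` at the three variables, so `X₁` is definitionally the scheme
  -- treated above.
  surface-rational : RationalSurface (X₁ p b c)
  surface-rational = R.birational

  -- The points together with the extra one of `surface-count` are in bijection with p · p elements;
  -- writing p · p as a successor lets the extra one be cancelled.
  points-count : Points (X₁ p b c) ↔ Fin (p ^ 2 ∸ 1)
  points-count = cancel-⊤ (≡.subst (λ n → (Points (X₁ p b c) ⊎ ⊤) ↔ Fin n) p*p≡
    (↔-sym Finₚ.*↔× ↔-∘ (C.surface-count b c no-root anisotropic ↔-∘ ⊎-cong points↔surface (↔-id ⊤))))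

theorem46 : (p : ℕ) .{{_ : NonZero p}} → Prime p → p % 6 ≡ 5 →
    (b c : Fin p) → IrreduciblePoly p (g p b c) →
    Affine.RationalSurface (𝔽 p) (X₁ p b c)
    × (Affine.Points (𝔽 p) (X₁ p b c) ↔ Fin (p ^ 2 ∸ 1))
theorem46 p p-prime p%6≡5 b c irreducible =
  surface-rational p p-prime p%6≡5 b c irreducible , points-count p p-prime p%6≡5 b c irreducible
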